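{- The problem Robust Submodular Minimizer restricted to instances with $k=2$ can be solved in polynomial time via a maximum flow computation. That is, there is a polynomial-time algorithm (based on a maximum flow computation) that, given a finite set $V$, submodular functions $f_1,f_2:2^V\to\mathbb{R}$ (via compact representations of $\arg\min f_1$ and $\arg\min f_2$) and an integer $d\in\mathbb{N}$, finds a set $X\subseteq V$ such that for each $i\in\{1,2\}$ there exists $Y_i\in\arg\min f_i$ with $|X\triangle Y_i|\le d$, or correctly reports that no such set exists.
   Context: Here $\mathbb{N}$ contains $0$, $[k]=\{1,\dots,k\}$, and $\triangle$ denotes symmetric difference. A function $f:2^V\to\mathbb{R}$ is submodular if $f(X)+f(Y)\ge f(X\cup Y)+f(X\cap Y)$ for all $X,Y\subseteq V$; $\arg\min f=\{Y\subseteq V: f(Y)\le f(Y')\ \forall Y'\subseteq V\}$ is its set of minimizers. Robust Submodular Minimizer: the input is a finite set $V$, submodular functions $f_1,\dots,f_k:2^V\to\mathbb{R}$, and $d\in\mathbb{N}$; the task is to find a set $X\subseteq V$ such that for each $i\in[k]$ there exists $Y_i\in\arg\min f_i$ with $|X\triangle Y_i|\le d$, or detect that no such set exists. Each $f_i$ is given via a compact representation of the distributive lattice $\mathcal{L}_i=\arg\min f_i$. A compact representation of a distributive lattice $\mathcal{L}\subseteq 2^V$ (a family closed under union and intersection) consists of a partition of $V$ into $U_0,U_1,\dots,U_b,U_\infty$ (with $U_0,U_\infty$ possibly empty) such that every set in $\mathcal{L}$ contains $U_0$, is disjoint from $U_\infty$, and is of the form $U_0\cup\bigcup_{j\in J}U_j$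 for some $J\subseteq[b]$, together with a directed acyclic graph $G(\mathcal{L})$ with vertex set $\{U_0,\dots,U_b\}$ whose unique sink (vertex of out-degree zero) is $U_0$ and such that a non-empty set $Z$ of vertices of $G(\mathcal{L})$ has no out-going edge if and only if $\bigcup_{U_j\in Z}U_j\in\mathcal{L}$. -}

module Defs where

open import Data.Bool using (Bool; true; false; T)
open import Data.Fin using (Fin; zero; suc; toℕ)
import Data.Fin.Properties as Fin
open import Data.Fin.Subset
  using (Subset; Nonempty; Empty; _∈_; _∉_; _⊆_; _∪_; _∩_; _─_; ⋃; ∣_∣)
open import Data.Fin.Subset.Properties using (_∈?_)
import Data.Integer as ℤ
open ℤ using (ℤ)
open import Data.List using (List; []; _∷_)
import Data.List as List
open import Data.Maybe using (Maybe; just; nothing)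
import Data.Maybe.Properties as Maybe
open import Data.Nat using (ℕ; zero; suc; _+_; _*_; _^_; _≤_)
open import Data.Nat.Binary using (ℕᵇ; zero; 2[1+_]; 1+[2_]; fromℕ)
open import Data.Product using (∃; ∃-syntax; _×_)
import Data.Rational as ℚ
open ℚ using (ℚ; ½; 1ℚ)
import Data.Rational.Properties as ℚ
import Data.Rational.Solver as ℚ
open import Data.Vec using (Vec; []; _∷_; lookup; tabulate; toList; sum)
open import Function.Bundles using (_⇔_)
open import Relation.Binary.Construct.Closure.Transitive using (TransClosure)
open import Relation.Binary.PropositionalEquality
  using (_≡_; _≢_; refl; cong)
open import Relation.Nullary using (¬_; does)

½^_ : ℕ → ℚ
½^ zero  = 1ℚ
½^ suc n = ½ ℚ.* (½^ n)

-- Bishop's regular Cauchy sequences, with modulus 2⁻ⁿ: the n-th term is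
-- within 2⁻ⁿ of the number represented.
record ℝ : Set where
  constructor mkℝ
  field
    seq     : ℕ → ℚ
    regular : ∀ m n → ℚ.∣ seq m ℚ.- seq n ∣ ℚ.≤ (½^ m) ℚ.+ (½^ n)
open ℝ

infix 4 _≤ᵣ_
_≤ᵣ_ : ℝ → ℝ → Set
x ≤ᵣ y = ∀ n → seq x n ℚ.≤ seq y n ℚ.+ ((½^ n) ℚ.+ (½^ n))

private
  half+half : ∀ p q → (½ ℚ.* p ℚ.+ ½ ℚ.* q) ℚ.+ (½ ℚ.* p ℚ.+ ½ ℚ.* q) ≡ p ℚ.+ q
  half+half = solve 2 (λ p q → (con ½ :* p :+ con ½ :* q) :+ (con ½ :* p :+ con ½ :* q)
                               := p :+ q) refl
    where open ℚ.+-*-Solver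

  interchange : ∀ a b c d → (a ℚ.+ b) ℚ.- (c ℚ.+ d) ≡ (a ℚ.- c) ℚ.+ (b ℚ.- d)
  interchange = solve 4 (λ a b c d → (a :+ b) :- (c :+ d) := (a :- c) :+ (b :- d)) refl
    where open ℚ.+-*-Solver

-- The index shift compensates for the two errors adding up.
infixl 6 _+ᵣ_
_+ᵣ_ : ℝ → ℝ → ℝ
seq     (x +ᵣ y) n   = seq x (suc n) ℚ.+ seq y (suc n)
regular (x +ᵣ y) m n = begin
  ℚ.∣ (x′ m ℚ.+ y′ m) ℚ.- (x′ n ℚ.+ y′ n) ∣
    ≡⟨ cong ℚ.∣_∣ (interchange (x′ m) (y′ m) (x′ n) (y′ n)) ⟩
  ℚ.∣ (x′ m ℚ.- x′ n) ℚ.+ (y′ m ℚ.- y′ n) ∣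
    ≤⟨ ℚ.∣p+q∣≤∣p∣+∣q∣ (x′ m ℚ.- x′ n) (y′ m ℚ.- y′ n) ⟩
  ℚ.∣ x′ m ℚ.- x′ n ∣ ℚ.+ ℚ.∣ y′ m ℚ.- y′ n ∣
    ≤⟨ ℚ.+-mono-≤ (regular x (suc m) (suc n)) (regular y (suc m) (suc n)) ⟩
  ((½^ suc m) ℚ.+ (½^ suc n)) ℚ.+ ((½^ suc m) ℚ.+ (½^ suc n))
    ≡⟨ half+half (½^ m) (½^ n) ⟩
  (½^ m) ℚ.+ (½^ n) ∎
  where
  open ℚ.≤-Reasoning
  x′ y′ : ℕ → ℚ
  x′ k = seq x (suc k)
  y′ k = seq y (suc k)

-- The ground set V is Fin n throughout.
Submodular : ∀ {n} → (Subset n → ℝ) → Set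
Submodular f = ∀ X Y → f (X ∪ Y) +ᵣ f (X ∩ Y) ≤ᵣ f X +ᵣ f Y

argmin : ∀ {n} → (Subset n → ℝ) → Subset n → Set
argmin f Y = ∀ Y′ → f Y ≤ᵣ f Y′

infixl 6 _△_
_△_ : ∀ {n} → Subset n → Subset n → Subset n
X △ Y = (X ─ Y) ∪ (Y ─ X)

-- The partition U₀, U₁, …, U_b, U∞ is given by the block containing each
-- element: `just zero` stands for U₀, `just j` with j ≢ zero for one of
-- U₁, …, U_b, and `nothing` for U∞.
record CompactRepresentation {n : ℕ} (L : Subset n → Set) : Set where
  field
    b     : ℕ
    block : Vec (Maybe (Fin (suc b))) n
    graph : Vec (Vec Bool (suc b)) (suc b)

  Vertex : Set
  Vertex = Fin (suc b)

  Edge : Vertex → Vertex → Set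
  Edge i j = T (lookup (lookup graph i) j)

  class : Maybe Vertex → Subset n
  class c = tabulate (λ v → does (Maybe.≡-dec Fin._≟_ (lookup block v) c))

  U : Vertex → Subset n
  U j = class (just j)

  U∞ : Subset n
  U∞ = class nothing

  ⋃U : Subset (suc b) → Subset n
  ⋃U Z = ⋃ (List.map U (List.filter (_∈? Z) (List.allFin (suc b))))

  NoOutgoingEdge : Subset (suc b) → Set
  NoOutgoingEdge Z = ∀ {i j} → i ∈ Z → j ∉ Z → ¬ Edge i j

  field
    nonempty : ∀ j → j ≢ zero → Nonempty (U j)

    contains-U₀ : ∀ {X} → L X → U zero ⊆ X
    disjoint-U∞ : ∀ {X} → L X → Empty (X ∩ U∞)
    union-form  : ∀ {X} → L X → ∃[ J ] (zero ∉ J × X ≡ U zero ∪ ⋃U J)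

    acyclic : ∀ i → ¬ TransClosure Edge i i
    sink    : ∀ i → (∀ j → ¬ Edge i j) ⇔ i ≡ zero

    -- A non-empty vertex set without outgoing edges contains the unique
    -- sink U₀ of the acyclic graph, so only sets with zero ∈ Z matter.  When
    -- U₀ = ∅, a set Z and Z ∪ {U₀} have the same union, and the equivalence
    -- is meant for the latter.
    closed : ∀ Z → zero ∈ Z → NoOutgoingEdge Z ⇔ L (⋃U Z)

infixr 5 _∙_
data Tree : Set where
  nil : Tree
  _∙_ : Tree → Tree → Tree

size : Tree → ℕ
size nil     = 1
size (s ∙ t) = suc (size s + size t)

head tail : Tree → Tree
head nil     = nil
head (s ∙ _) = s
tail nil     = nil
tail (_ ∙ t) = t

-- A first-order language over binary trees with unbounded iteration, a
-- variant of Jones's WHILE language; Term n has n variables in scope, as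
-- de Bruijn indices.
data Term : ℕ → Set where
  var        : ∀ {n} → Fin n → Term n
  nil        : ∀ {n} → Term n
  cons       : ∀ {n} → Term n → Term n → Term n
  hd tl      : ∀ {n} → Term n → Term n
  if         : ∀ {n} → Term n → Term n → Term n → Term n
  let-in     : ∀ {n} → Term n → Term (suc n) → Term n
  -- `while c t` repeats x := t as long as c is not nil, where x is
  -- variable 0, and returns the final value of x.
  while      : ∀ {n} → Term (suc n) → Term (suc n) → Term (suc n)

-- ρ ⊢ t ⇓ v cost k: in environment ρ, t terminates with value v after k
-- unit-cost steps.  With trees stored as shared pointer structures, every
-- step takes constant time on a pointer machine, so that costs agree with
-- running times on the usual machine models up to a polynomial.
infix 3 _⊢_⇓_cost_
data _⊢_⇓_cost_ : ∀ {n} → Vec Tree n → Term n → Tree → ℕ → Set where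
  var : ∀ {n} {ρ : Vec Tree n} {i} →
    ρ ⊢ var i ⇓ lookup ρ i cost 1
  nil : ∀ {n} {ρ : Vec Tree n} →
    ρ ⊢ nil ⇓ nil cost 1
  cons : ∀ {n} {ρ : Vec Tree n} {t u v w k l} →
    ρ ⊢ t ⇓ v cost k → ρ ⊢ u ⇓ w cost l →
    ρ ⊢ cons t u ⇓ v ∙ w cost suc (k + l)
  hd : ∀ {n} {ρ : Vec Tree n} {t v k} →
    ρ ⊢ t ⇓ v cost k →
    ρ ⊢ hd t ⇓ head v cost suc k
  tl : ∀ {n} {ρ : Vec Tree n} {t v k} →
    ρ ⊢ t ⇓ v cost k →
    ρ ⊢ tl t ⇓ tail v cost suc k
  if-cons : ∀ {n} {ρ : Vec Tree n} {c t u x y v k l} →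
    ρ ⊢ c ⇓ x ∙ y cost k → ρ ⊢ t ⇓ v cost l →
    ρ ⊢ if c t u ⇓ v cost suc (k + l)
  if-nil : ∀ {n} {ρ : Vec Tree n} {c t u v k l} →
    ρ ⊢ c ⇓ nil cost k → ρ ⊢ u ⇓ v cost l →
    ρ ⊢ if c t u ⇓ v cost suc (k + l)
  let-in : ∀ {n} {ρ : Vec Tree n} {t u v w k l} →
    ρ ⊢ t ⇓ v cost k → v ∷ ρ ⊢ u ⇓ w cost l →
    ρ ⊢ let-in t u ⇓ w cost suc (k + l)
  while-stop : ∀ {n} {ρ : Vec Tree n} {c t x k} →
    x ∷ ρ ⊢ c ⇓ nil cost k →
    x ∷ ρ ⊢ while c t ⇓ x cost suc k
  while-step : ∀ {n} {ρ : Vec Tree n} {c t x y z x′ v k l m} →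
    x ∷ ρ ⊢ c ⇓ y ∙ z cost k → x ∷ ρ ⊢ t ⇓ x′ cost l →
    x′ ∷ ρ ⊢ while c t ⇓ v cost m →
    x ∷ ρ ⊢ while c t ⇓ v cost suc (k + l + m)

-- On input x the program t halts with output y within time B.  The size of
-- the output is charged too: by sharing, a program could otherwise build a
-- tree of size exponential in its number of steps.
Computes : Term 1 → Tree → Tree → ℕ → Set
Computes t x y B = ∃[ k ] ((x ∷ [] ⊢ t ⇓ y cost k) × k + size y ≤ B)

record Problem : Set₁ where
  field
    Instance : Set
    Solution : Instance → Set
    Correct  : ∀ I → Solution I → Set
    codeᴵ    : Instance → Tree
    codeˢ    : ∀ {I} → Solution I → Tree

-- As size x ≥ 1, every polynomial in size x is at most a * size x ^ e for
-- suitable a and e.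
PolynomialTimeSolvable : Problem → Set
PolynomialTimeSolvable P =
  ∃[ t ] ∃[ a ] ∃[ e ] ∀ (I : Instance) →
    ∃[ S ] (Correct I S × Computes t (codeᴵ I) (codeˢ S) (a * size (codeᴵ I) ^ e))
  where open Problem P

-- P is solved by polynomial-time computations around a single call to an
-- arbitrary procedure for Q: `pre` produces an instance of Q, and `post`
-- turns every correct solution of it into a solution of P.
PolynomialTimeVia : Problem → Problem → Set
PolynomialTimeVia P Q =
  ∃[ pre ] ∃[ post ] ∃[ a ] ∃[ e ] ∀ (I : P.Instance) →
    ∃[ J ] (Computes pre (P.codeᴵ I) (Q.codeᴵ J) (a * size (P.codeᴵ I) ^ e) ×
      (∀ (R : Q.Solution J) → Q.Correct J R →
        let x = P.codeᴵ I ∙ Q.codeˢ R in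
        ∃[ S ] (P.Correct I S × Computes post x (P.codeˢ S) (a * size x ^ e))))
  where
  module P = Problem P
  module Q = Problem Q

codeBool : Bool → Tree
codeBool false = nil
codeBool true  = nil ∙ nil

codeList : ∀ {A : Set} → (A → Tree) → List A → Tree
codeList code []       = nil
codeList code (x ∷ xs) = code x ∙ codeList code xs

codeVec : ∀ {A : Set} {n} → (A → Tree) → Vec A n → Tree
codeVec code xs = codeList code (toList xs)

codeMaybe : ∀ {A : Set} → (A → Tree) → Maybe A → Tree
codeMaybe code nothing  = nil
codeMaybe code (just x) = nil ∙ code x

-- Elements and cardinalities of explicitly listed sets are in unary, all
-- other numbers in binary (least significant digit first, with digits 1, 2).
codeUnary : ℕ → Tree
codeUnary zero    = nil
codeUnary (suc n) = nil ∙ codeUnary n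

codeFin : ∀ {n} → Fin n → Tree
codeFin i = codeUnary (toℕ i)

codeℕᵇ : ℕᵇ → Tree
codeℕᵇ zero     = nil
codeℕᵇ 2[1+ x ] = (nil ∙ nil) ∙ codeℕᵇ x
codeℕᵇ 1+[2 x ] = nil ∙ codeℕᵇ x

codeℕ : ℕ → Tree
codeℕ n = codeℕᵇ (fromℕ n)

codeCompactRepresentation : ∀ {n} {L : Subset n → Set} →
  CompactRepresentation L → Tree
codeCompactRepresentation C =
  codeVec (codeMaybe codeFin) block ∙ codeVec (codeVec codeBool) graph
  where open CompactRepresentation C

record RSMInstance (k : ℕ) : Set where
  field
    n          : ℕ
    f          : Fin k → Subset n → ℝ
    submodular : ∀ i → Submodular (f i)
    compact    : ∀ i → CompactRepresentation (argmin (f i))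
    d          : ℕ

  Robust : Subset n → Set
  Robust X = ∀ i → ∃[ Y ] (argmin (f i) Y × ∣ X △ Y ∣ ≤ d)

  Answers : Maybe (Subset n) → Set
  Answers (just X) = Robust X
  Answers nothing  = ¬ ∃ Robust

-- Only the compact
-- representations of the argmin f i are part of the input, not the f i.
RobustSubmodularMinimizer : ℕ → Problem
RobustSubmodularMinimizer k = record
  { Instance = RSMInstance k
  ; Solution = λ I → Maybe (Subset (RSMInstance.n I))
  ; Correct  = RSMInstance.Answers
  ; codeᴵ    = λ I → let open RSMInstance I in
      codeUnary n ∙ codeℕ d ∙
      codeList (λ i → codeCompactRepresentation (compact i)) (List.allFin k)
  ; codeˢ    = codeMaybe (codeVec codeBool)
  }

record Network : Set where
  field
    n        : ℕ
    source   : Fin n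
    target   : Fin n
    distinct : source ≢ target
    capacity : Fin n → Fin n → ℕ

-- As the capacities are integral, the maximum over integral flows is the
-- maximum over all flows.
record Flow (N : Network) : Set where
  open Network N
  field
    flow : Fin n → Fin n → ℕ

  inflow : Fin n → ℕ
  inflow v = sum (tabulate (λ u → flow u v))

  outflow : Fin n → ℕ
  outflow v = sum (tabulate (λ w → flow v w))

  field
    bounded   : ∀ u v → flow u v ≤ capacity u v
    conserved : ∀ v → v ≢ source → v ≢ target → inflow v ≡ outflow v

  value : ℤ
  value = outflow source ℤ.⊖ inflow source

codeMatrix : ∀ {m n} → (Fin m → Fin n → ℕ) → Tree
codeMatrix M = codeVec (codeVec codeℕ) (tabulate (λ i → tabulate (M i)))

MaximumFlow : Problem
MaximumFlow = record
  { Instance = Network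
  ; Solution = Flow
  ; Correct  = λ N φ → ∀ (ψ : Flow N) → Flow.value ψ ℤ.≤ Flow.value φ
  ; codeᴵ    = λ N → let open Network N in
      codeFin source ∙ codeFin target ∙ codeMatrix capacity
  ; codeˢ    = λ φ → codeMatrix (Flow.flow φ)
  }

{-# OPTIONS --safe #-}
module Submission where

-- If Y₀ and Y₁ are minimizers of f₁ and f₂ that differ in at most 2d elements,
-- then moving d of these differences from Y₀ towards Y₁ gives a robust set X;
-- conversely, the triangle inequality through X bounds |Y₀ △ Y₁| by 2d.  So it
-- suffices to minimize |Y₀ △ Y₁|.  By its compact representation, argmin fᵢ
-- consists of the sets that are closed under a relation on V extended by two
-- elements standing for "always in" and "never in".  Hence the minimum is a
-- minimum cut in a network with two copies of the extended ground set, where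
-- the relations are edges of infinite capacity and the two copies of an element
-- of V are joined by unit edges.  The nodes that are reachable in the residual
-- graph of a maximum flow form such a cut.  As its capacity is at most |V|,
-- augmenting paths find a maximum flow in polynomially many rounds, and infinity
-- can be replaced by a number of |V| + 3 binary digits.
--
-- The programs are written in a loop language in which every loop runs for as
-- many rounds as the input has nodes, so that their running times are
-- polynomials by construction and only their values have to be computed.

open import Defs
open import Data.Bool using (Bool; true; false; if_then_else_; not; _∨_; _xor_; T)
import Data.Bool.Properties as Bool
open import Data.Bool.Properties using (if-float; T-≡)
open import Data.Fin using (Fin; zero; suc; toℕ; splitAt; _↑ˡ_; _↑ʳ_)
import Data.Fin.Properties as Fin
open import Data.Fin.Properties
  using (any?; toℕ<n; toℕ-injective; toℕ-↑ˡ; splitAt-↑ˡ; splitAt-↑ʳ) renaming (_≟_ to _≟ᶠ_)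
open import Data.Fin.Subset using (Subset; _∈_; _∉_; _∪_; _∩_; ⋃; ⁅_⁆; ∣_∣) renaming (⊤ to full)
open import Data.Fin.Subset.Properties
  using (_∈?_; nonempty?; p⊂q⇒∣p∣<∣q∣; ∣p∣≤n; x∈p∪q⁺; x∈p∪q⁻; x∈p∩q⁺; x∈p∩q⁻; x∈⁅x⁆; x∈⁅y⁆⇒x≡y; ∉⊥; ∈⊤; ⊆-antisym)
import Data.Integer as ℤ
import Data.Integer.Properties as ℤ
open import Data.List as List using (List; []; _∷_; foldr; foldl; length; filter; allFin; _ʳ++_)
open import Data.List.Membership.Propositional using () renaming (_∈_ to _∈ˡ_; _∉_ to _∉ˡ_)
open import Data.List.Membership.Propositional.Properties using (∈-allFin; ∈-filter⁺; ∈-filter⁻; ∈-map⁺; ∈-map⁻)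
open import Data.List.Properties
  using (tabulate-cong; length-tabulate; length-reverse; length-take; length-replicate; length-map; take-all; foldl-ʳ++)
open import Data.List.Relation.Unary.All using (All; []; _∷_)
import Data.List.Relation.Unary.All as All
open import Data.List.Relation.Unary.Any using (here; there)
open import Data.Maybe using (Maybe; just; nothing)
import Data.Maybe.Properties as Maybe
open import Data.Nat
open import Data.Nat.Binary as ℕᵇ using (ℕᵇ; 2[1+_]; 1+[2_]; fromℕ)
import Data.Nat.Binary.Properties as ℕᵇ
open import Data.Nat.Properties
open import Data.Nat.Tactic.RingSolver using (solve-∀)
open import Data.Product using (∃; ∃-syntax; _×_; _,_; proj₁; proj₂)
open import Data.Sum using (_⊎_; inj₁; inj₂; [_,_]′)
open import Data.Sum.Properties using ([,]-map)
open import Data.Unit using (⊤; tt)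
open import Data.Vec as Vec using (Vec; []; _∷_; lookup; tabulate)
open import Data.Vec.Properties using (lookup∘tabulate; []=⇒lookup; lookup⇒[]=; length-toList)
open import Function using (_∘_)
open import Function.Bundles using (Equivalence)
import Algebra.Properties.Semiring.Sum +-*-semiring as Sum
open import Relation.Binary.PropositionalEquality
open import Relation.Nullary using (yes; no; contradiction; does; _×-dec_)
open import Relation.Nullary.Decidable using (dec-true)

-- A loop language with polynomial running times

-- The argument has to serve two kinds of flows: one found by augmentation, and an arbitrary maximum
-- flow returned by a procedure that sees only finite integers. Augmentation works with the symbolic
-- capacities `none`, `unit` and `inf`; there, maximality means that the target is unreachable in
-- the residual graph, and residual edges depend only on the signs of the flow. A foreign maximum
-- flow may carry large numbers, and it is optimal only among flows of the finite network. Its value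
-- is therefore compared with that of `maxFlow`, whose entries are at most its value and so fit the
-- finite capacities. Hence the foreign flow saturates a minimum cut, and the target is unreachable
-- for it as well. From then on both flows are read by the same program. The other obstacle is d,
-- which is given in binary and may be exponential in the size of the input. Distances never exceed
-- the number of elements, so d can be replaced by a unary number that equals d unless both are at
-- least the clock.

infixr 5 _⊗_
infixl 4 _>>>_

data Prog : Set where
  arg nil : Prog
  _⊗_     : Prog → Prog → Prog
  hd tl   : Prog → Prog
  if      : Prog → Prog → Prog → Prog
  _>>>_   : Prog → Prog → Prog
  loop    : Prog → Prog → Prog

iter : ∀ {A : Set} → ℕ → (A → A) → A → A
iter zero    f x = x
iter (suc k) f x = iter k f (f x)

ifᵀ : Tree → Tree → Tree → Tree
ifᵀ nil     x y = y
ifᵀ (_ ∙ _) x y = x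

-- The argument K is the clock: every loop runs for exactly K rounds, so that
-- the running time is a polynomial in K whatever data the loops work on.
⟦_⟧ : Prog → ℕ → Tree → Tree
⟦ arg ⟧      K x = x
⟦ nil ⟧      K x = nil
⟦ s ⊗ t ⟧    K x = ⟦ s ⟧ K x ∙ ⟦ t ⟧ K x
⟦ hd s ⟧     K x = head (⟦ s ⟧ K x)
⟦ tl s ⟧     K x = tail (⟦ s ⟧ K x)
⟦ if c s t ⟧ K x = ifᵀ (⟦ c ⟧ K x) (⟦ s ⟧ K x) (⟦ t ⟧ K x)
⟦ s >>> t ⟧  K x = ⟦ t ⟧ K (⟦ s ⟧ K x)
⟦ loop s t ⟧ K x = iter K (⟦ t ⟧ K) (⟦ s ⟧ K x)

tick : ∀ {m} → Term (suc m) → Term (suc m)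
tick t = cons (tl (hd (var zero))) t

-- The compiled term finds its input in variable zero and the clock in variable `suc c`. A loop
-- counts down a copy of the clock, paired with the data, so that inner loops find the original
-- untouched.
compile : Prog → ∀ {m} → Fin m → Term (suc m)
compile arg        c = var zero
compile nil        c = nil
compile (s ⊗ t)    c = cons (compile s c) (compile t c)
compile (hd s)     c = hd (compile s c)
compile (tl s)     c = tl (compile s c)
compile (if b s t) c = if (compile b c) (compile s c) (compile t c)
compile (s >>> t)  c = let-in (compile s c) (compile t (suc c))
compile (loop s t) c =
  tl (let-in (cons (var (suc c)) (compile s c))
    (while (hd (var zero))
      (tick (let-in (tl (var zero)) (compile t (suc (suc c)))))))

-- Conditionals pay for both branches, which keeps the bound independent of the data. In a loop, 10
-- per round covers the test, the decrement of the clock and the unpacking of the data; 7 covers the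
-- setup and the final test.
bound : Prog → ℕ → ℕ
bound arg        K = 1
bound nil        K = 1
bound (s ⊗ t)    K = suc (bound s K + bound t K)
bound (hd s)     K = suc (bound s K)
bound (tl s)     K = suc (bound s K)
bound (if c s t) K = suc (bound c K + (bound s K + bound t K))
bound (s >>> t)  K = suc (bound s K + bound t K)
bound (loop s t) K = 7 + bound s K + K * (10 + bound t K)

infix 3 _⊢_⇓_within_
_⊢_⇓_within_ : ∀ {n} → Vec Tree n → Term n → Tree → ℕ → Set
ρ ⊢ t ⇓ v within B = ∃[ k ] (ρ ⊢ t ⇓ v cost k × k ≤ B)

while-loop : ∀ {m} {ρ : Vec Tree m} {t : Term (2 + m)} (g : Tree → Tree) {b} →
  (∀ z y → y ∷ z ∷ ρ ⊢ t ⇓ g y within b) →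
  ∀ k y → (codeUnary k ∙ y) ∷ ρ ⊢ while (hd (var zero)) (tick (let-in (tl (var zero)) t))
            ⇓ nil ∙ iter k g y within (3 + k * (10 + b))
while-loop g t⇓ zero y = _ , while-stop (hd var) , ≤-refl
while-loop g {b} t⇓ (suc k) y with t⇓ (codeUnary (suc k) ∙ y) y | while-loop g t⇓ k (g y)
... | l , d , l≤ | m , e , m≤ =
  _ , while-step (hd var) (cons (tl (hd var)) (let-in (tl var) d)) e ,
  ≤-trans (+-mono-≤ (+-monoʳ-≤ 10 l≤) m≤) (≤-reflexive (shuffle (10 + b) (k * (10 + b))))
  where
  shuffle : ∀ p q → p + (3 + q) ≡ 3 + (p + q)
  shuffle = solve-∀

compile-correct : ∀ p {m} {ρ : Vec Tree m} (c : Fin m) {K} → lookup ρ c ≡ codeUnary K →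
  ∀ x → x ∷ ρ ⊢ compile p c ⇓ ⟦ p ⟧ K x within bound p K
compile-correct arg c eq x = _ , var , ≤-refl
compile-correct nil c eq x = _ , nil , ≤-refl
compile-correct (s ⊗ t) c eq x with compile-correct s c eq x | compile-correct t c eq x
... | _ , d , k≤ | _ , e , l≤ = _ , cons d e , s≤s (+-mono-≤ k≤ l≤)
compile-correct (hd s) c eq x with compile-correct s c eq x
... | _ , d , k≤ = _ , hd d , s≤s k≤
compile-correct (tl s) c eq x with compile-correct s c eq x
... | _ , d , k≤ = _ , tl d , s≤s k≤
compile-correct (if b s t) c {K} eq x with ⟦ b ⟧ K x | compile-correct b c eq x
... | nil   | _ , d , k≤ with compile-correct t c eq x
...   | _ , e , l≤ = _ , if-nil d e , s≤s (+-mono-≤ k≤ (≤-trans l≤ (m≤n+m _ (bound s K))))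
compile-correct (if b s t) c {K} eq x | _ ∙ _ | _ , d , k≤ with compile-correct s c eq x
...   | _ , e , l≤ = _ , if-cons d e , s≤s (+-mono-≤ k≤ (≤-trans l≤ (m≤m+n _ _)))
compile-correct (s >>> t) c {K} eq x
  with compile-correct s c eq x | compile-correct t (suc c) {K} eq (⟦ s ⟧ K x)
... | _ , d , k≤ | _ , e , l≤ = _ , let-in d e , s≤s (+-mono-≤ k≤ l≤)
compile-correct (loop s t) {ρ = ρ} c {K} eq x
  with compile-correct s c eq x
     | while-loop (⟦ t ⟧ K) (λ z y → compile-correct t (suc (suc c)) {K} eq y) K (⟦ s ⟧ K x)
... | k , d , k≤ | l , e , l≤ =
  _ , tl (let-in (cons (subst (λ v → x ∷ ρ ⊢ var (suc c) ⇓ v cost 1) eq var) d) e) ,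
  ≤-trans (s≤s (s≤s (+-mono-≤ (+-monoʳ-≤ 2 k≤) l≤)))
    (≤-reflexive (shuffle (bound s K) (K * (10 + bound t K))))
  where
  shuffle : ∀ p q → 2 + (2 + p + (3 + q)) ≡ 7 + p + q
  shuffle = solve-∀

-- Excluding K = 0 makes `K ^ e` monotone in e, so that a sum is bounded by adding both the
-- coefficients and the exponents.
PolynomiallyBounded : (ℕ → ℕ) → Set
PolynomiallyBounded g = ∃[ a ] ∃[ e ] ∀ K → .{{_ : NonZero K}} → g K ≤ a * K ^ e

const-bounded : ∀ c → PolynomiallyBounded (λ _ → c)
const-bounded c = c , 0 , λ K → ≤-reflexive (sym (*-identityʳ c))

id-bounded : PolynomiallyBounded (λ K → K)
id-bounded = 1 , 1 , λ K → ≤-reflexive (sym (trans (+-identityʳ _) (*-identityʳ K)))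

+-bounded : ∀ {g h} → PolynomiallyBounded g → PolynomiallyBounded h →
  PolynomiallyBounded (λ K → g K + h K)
+-bounded {g} {h} (a , e , p) (a′ , e′ , p′) = a + a′ , e + e′ , λ K → let open ≤-Reasoning in begin
  g K + h K                                ≤⟨ +-mono-≤ (p K) (p′ K) ⟩
  a * K ^ e + a′ * K ^ e′                  ≤⟨ +-mono-≤ (*-monoʳ-≤ a (^-monoʳ-≤ K (m≤m+n e e′)))
                                                       (*-monoʳ-≤ a′ (^-monoʳ-≤ K (m≤n+m e′ e))) ⟩
  a * K ^ (e + e′) + a′ * K ^ (e + e′)     ≡⟨ *-distribʳ-+ (K ^ (e + e′)) a a′ ⟨
  (a + a′) * K ^ (e + e′)                  ∎

*-bounded : ∀ {g h} → PolynomiallyBounded g → PolynomiallyBounded h →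
  PolynomiallyBounded (λ K → g K * h K)
*-bounded {g} {h} (a , e , p) (a′ , e′ , p′) = a * a′ , e + e′ , λ K → let open ≤-Reasoning in begin
  g K * h K                        ≤⟨ *-mono-≤ (p K) (p′ K) ⟩
  (a * K ^ e) * (a′ * K ^ e′)      ≡⟨ shuffle a (K ^ e) a′ (K ^ e′) ⟩
  (a * a′) * (K ^ e * K ^ e′)      ≡⟨ cong (a * a′ *_) (^-distribˡ-+-* K e e′) ⟨
  (a * a′) * K ^ (e + e′)          ∎
  where
  shuffle : ∀ p q r s → (p * q) * (r * s) ≡ (p * r) * (q * s)
  shuffle = solve-∀

bound-bounded : ∀ p → PolynomiallyBounded (bound p)
bound-bounded arg        = const-bounded 1
bound-bounded nil        = const-bounded 1
bound-bounded (s ⊗ t)    = +-bounded (const-bounded 1) (+-bounded (bound-bounded s) (bound-bounded t))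
bound-bounded (hd s)     = +-bounded (const-bounded 1) (bound-bounded s)
bound-bounded (tl s)     = +-bounded (const-bounded 1) (bound-bounded s)
bound-bounded (if c s t) = +-bounded (const-bounded 1)
  (+-bounded (bound-bounded c) (+-bounded (bound-bounded s) (bound-bounded t)))
bound-bounded (s >>> t)  = +-bounded (const-bounded 1) (+-bounded (bound-bounded s) (bound-bounded t))
bound-bounded (loop s t) = +-bounded (+-bounded (const-bounded 7) (bound-bounded s))
  (*-bounded id-bounded (+-bounded (const-bounded 10) (bound-bounded t)))

-- Computing the clock: the size of a tree in unary

ones : ℕ → Tree → Tree
ones zero    y = y
ones (suc k) y = ones k (nil ∙ y)

ones-+ : ∀ j k y → ones (j + k) y ≡ ones k (ones j y)
ones-+ zero    k y = refl
ones-+ (suc j) k y = ones-+ j k (nil ∙ y)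

ones-codeUnary : ∀ j k → ones j (codeUnary k) ≡ codeUnary (j + k)
ones-codeUnary zero    k = refl
ones-codeUnary (suc j) k = trans (ones-codeUnary j (suc k)) (cong codeUnary (+-suc j k))

-- The state is a stack of trees paired with a counter. A round removes the top tree, pushes its two
-- children if it has any, and adds one mark to the counter.
visit : ∀ {m} → Term (suc m)
visit = if (hd (hd (var zero)))
  (cons (cons (hd (hd (hd (var zero)))) (cons (tl (hd (hd (var zero)))) (tl (hd (var zero)))))
        (cons nil (tl (var zero))))
  (cons (tl (hd (var zero))) (cons nil (tl (var zero))))

-- Visits a tree with a stack of pending subtrees.
sizeTerm : ∀ {m} → Term (suc m)
sizeTerm = tl (let-in (cons (cons (var zero) nil) nil) (while (hd (var zero)) visit))

-- Continuation style: the run that remains after x is a premise, so the runs for two children chain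
-- without cutting a `while` derivation in two. The factor 30 exceeds the exact costs 15 and 25 of a
-- round on a leaf and on an inner node.
visit-all : ∀ {m} {ρ : Vec Tree m} x rest out {v B} →
  (rest ∙ ones (size x) out) ∷ ρ ⊢ while (hd (var zero)) visit ⇓ v within B →
  ((x ∙ rest) ∙ out) ∷ ρ ⊢ while (hd (var zero)) visit ⇓ v within (size x * 30 + B)
visit-all nil rest out (_ , e , l≤) =
  _ , while-step (hd var) (if-nil (hd (hd var)) (cons (tl (hd var)) (cons nil (tl var)))) e ,
  +-mono-≤ (m≤m+n _ 15) l≤
visit-all (s ∙ t) rest out {v} {B} (_ , e , l≤)
  with visit-all s (t ∙ rest) (nil ∙ out)
         (visit-all t rest (ones (size s) (nil ∙ out))
           (_ , subst (λ y → (rest ∙ y) ∷ _ ⊢ while (hd (var zero)) visit ⇓ v cost _)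
                  (ones-+ (size s) (size t) (nil ∙ out)) e , l≤))
... | _ , d , k≤ =
  _ , while-step (hd var)
        (if-cons (hd (hd var)) (cons (cons (hd (hd (hd var))) (cons (tl (hd (hd var))) (tl (hd var))))
                                     (cons nil (tl var)))) d ,
  ≤-trans (+-mono-≤ (m≤m+n _ 5) k≤) (≤-reflexive (shuffle (size s) (size t) B))
  where
  shuffle : ∀ p q r → 30 + (p * 30 + (q * 30 + r)) ≡ (suc (p + q)) * 30 + r
  shuffle = solve-∀

sizeTerm-correct : ∀ {m} {ρ : Vec Tree m} x →
  x ∷ ρ ⊢ sizeTerm ⇓ codeUnary (size x) within (10 + size x * 30)
sizeTerm-correct {ρ = ρ} x
  with visit-all {ρ = x ∷ ρ} x nil nil
         (_ , subst (λ y → (nil ∙ y) ∷ x ∷ ρ ⊢ while (hd (var zero)) visit ⇓ nil ∙ y cost 3)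
                (sym (trans (ones-codeUnary (size x) 0) (cong codeUnary (+-identityʳ (size x)))))
                (while-stop (hd var)) , ≤-refl)
... | _ , d , k≤ = _ ,
  subst (λ y → x ∷ ρ ⊢ sizeTerm ⇓ y cost _)
    (trans (ones-codeUnary (size x) 0) (cong codeUnary (+-identityʳ (size x))))
    (tl (let-in (cons (cons var nil) nil) d)) ,
  ≤-trans (+-monoʳ-≤ 7 k≤) (≤-reflexive (shuffle (size x * 30)))
  where
  shuffle : ∀ p → 7 + (p + 3) ≡ 10 + p
  shuffle = solve-∀

-- The second `let-in` copies the input to variable zero, so that the clock, which is the size of
-- the input, sits right behind it as `compile` expects.
program : Prog → Term 1
program p = let-in sizeTerm (let-in (var (suc zero)) (compile p zero))

size-nonZero : ∀ x → NonZero (size x)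
size-nonZero nil     = _
size-nonZero (_ ∙ _) = _

program-correct : ∀ p x →
  x ∷ [] ⊢ program p ⇓ ⟦ p ⟧ (size x) x within (13 + size x * 30 + bound p (size x))
program-correct p x =
  let k , d , k≤ = sizeTerm-correct {ρ = []} x
      l , e , l≤ = compile-correct p zero {size x} refl x
  in _ , let-in d (let-in var e) ,
     ≤-trans (s≤s (+-mono-≤ k≤ (s≤s (s≤s l≤)))) (≤-reflexive (shuffle (size x * 30) (bound p (size x))))
  where
  shuffle : ∀ q r → 1 + (10 + q + (2 + r)) ≡ 13 + q + r
  shuffle = solve-∀

-- The clock bounds the number of steps but not the size of the result, which sharing could make
-- large; hence the separate bound h.
program-polynomial : ∀ p {h} → PolynomiallyBounded h → ∃[ a ] ∃[ e ] ∀ x {y} →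
  ⟦ p ⟧ (size x) x ≡ y → size y ≤ h (size x) → Computes (program p) x y (a * size x ^ e)
program-polynomial p {h} hp =
  let a , e , q = +-bounded (+-bounded (+-bounded (const-bounded 13)
                    (*-bounded id-bounded (const-bounded 30))) (bound-bounded p)) hp
  in a , e , correct a e q
  where
  correct : ∀ a e →
    (∀ K → .{{_ : NonZero K}} → 13 + K * 30 + bound p K + h K ≤ a * K ^ e) →
    ∀ x {y} → ⟦ p ⟧ (size x) x ≡ y → size y ≤ h (size x) → Computes (program p) x y (a * size x ^ e)
  correct a e q x refl y≤ =
    let k , d , k≤ = program-correct p x in
    k , d , ≤-trans (+-mono-≤ k≤ y≤) (q (size x) {{size-nonZero x}})

-- The input of a program is an environment, given as the list of its
-- components.
rest #_ : ℕ → Prog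
rest zero    = arg
rest (suc i) = tl (rest i)
# i          = hd (rest i)

infix 9 #_

⊤ₚ : Prog
⊤ₚ = nil ⊗ nil

-- A loop consumes a list from the front, which is the order of `foldl`; reversing first makes
-- `foldₚ` a `foldr`.
reverseₚ : Prog → Prog
reverseₚ xs = tl (loop (xs ⊗ nil) (if (hd arg) (tl (hd arg) ⊗ hd (hd arg) ⊗ tl arg) arg))

-- foldₚ xs z t is foldr over the first K elements of xs; the program t is run
-- on the list element, the accumulator and the input, in this order.
foldₚ : Prog → Prog → Prog → Prog
foldₚ xs z t = hd (tl (loop (reverseₚ xs ⊗ z ⊗ arg)
  (if (hd arg) (tl (hd arg) ⊗ ((hd (hd arg) ⊗ hd (tl arg) ⊗ rest 2) >>> t) ⊗ rest 2) arg)))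

mapₚ : Prog → Prog → Prog
mapₚ xs t = foldₚ xs nil (((# 0 ⊗ rest 2) >>> t) ⊗ # 1)

dropₚ : Prog → Prog → Prog
dropₚ i xs = foldₚ i xs (tl (# 1))

infixl 8 _!_
_!_ : Prog → Prog → Prog
xs ! i = hd (dropₚ i xs)

infix 7 _==_
-- Unary numbers are equal when both truncated differences vanish, and dropping as many entries as i
-- has from j computes such a difference.
_==_ : Prog → Prog → Prog
i == j = if (dropₚ i j) nil (if (dropₚ j i) nil ⊤ₚ)

infixr 6 _++ₚ_
_++ₚ_ : Prog → Prog → Prog
xs ++ₚ ys = foldₚ xs ys (# 0 ⊗ # 1)

-- Entry i of the result is i in unary: each step of the fold increments the indices of the tail and
-- puts zero in front.
indices : Prog → Prog
indices xs = foldₚ xs nil (nil ⊗ mapₚ (# 1) (nil ⊗ # 0))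

-- Values of the list programs

list : List Tree → Tree
list = codeList (λ t → t)

spine : Tree → List Tree
spine nil     = []
spine (s ∙ t) = s ∷ spine t

spine-list : ∀ ts → spine (list ts) ≡ ts
spine-list []       = refl
spine-list (t ∷ ts) = cong (t ∷_) (spine-list ts)

tab : ∀ {m} → (Fin m → Tree) → Tree
tab f = list (List.tabulate f)

tab-cong : ∀ {m} {f g : Fin m → Tree} → (∀ i → f i ≡ g i) → tab f ≡ tab g
tab-cong eq = cong list (tabulate-cong eq)

codeVec-tab : ∀ {A : Set} {n} (code : A → Tree) (xs : Vec A n) →
  codeVec code xs ≡ tab (code ∘ lookup xs)
codeVec-tab code []       = refl
codeVec-tab code (x ∷ xs) = cong (code x ∙_) (codeVec-tab code xs)

codeVec-tabulate : ∀ {A : Set} {n} (code : A → Tree) (f : Fin n → A) →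
  codeVec code (Vec.tabulate f) ≡ tab (code ∘ f)
codeVec-tabulate {n = zero}  code f = refl
codeVec-tabulate {n = suc n} code f = cong (code (f zero) ∙_) (codeVec-tabulate code (f ∘ suc))

codeMatrix-tab : ∀ {m n} (M : Fin m → Fin n → ℕ) →
  codeMatrix M ≡ tab (λ i → tab (λ j → codeℕ (M i j)))
codeMatrix-tab M = trans (codeVec-tabulate (codeVec codeℕ) _)
  (tab-cong (λ i → codeVec-tabulate codeℕ (M i)))

codeUnary-list : ∀ j → codeUnary j ≡ list (List.replicate j nil)
codeUnary-list zero    = refl
codeUnary-list (suc j) = cong (nil ∙_) (codeUnary-list j)

isCons : Tree → Bool
isCons nil     = false
isCons (_ ∙ _) = true

isCons-codeBool : ∀ b → isCons (codeBool b) ≡ b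
isCons-codeBool false = refl
isCons-codeBool true  = refl

ifᵀ-isCons : ∀ t x y → ifᵀ t x y ≡ (if isCons t then x else y)
ifᵀ-isCons nil     x y = refl
ifᵀ-isCons (_ ∙ _) x y = refl

tails : ℕ → Tree → Tree
tails zero    t = t
tails (suc j) t = tail (tails j t)

tails-suc : ∀ j t → tails (suc j) t ≡ tails j (tail t)
tails-suc zero    t = refl
tails-suc (suc j) t = cong tail (tails-suc j t)

head-tails : ∀ {m} (f : Fin m → Tree) i → head (tails (toℕ i) (tab f)) ≡ f i
head-tails f zero    = refl
head-tails f (suc i) = trans (cong head (tails-suc (toℕ i) (tab f))) (head-tails (f ∘ suc) i)

tails-codeUnary : ∀ i j → tails i (codeUnary j) ≡ codeUnary (j ∸ i)
tails-codeUnary zero    j       = refl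
tails-codeUnary (suc i) zero    = trans (tails-suc i nil) (trans (tails-codeUnary i 0) (cong codeUnary (0∸n≡0 i)))
tails-codeUnary (suc i) (suc j) = trans (tails-suc i (codeUnary (suc j))) (tails-codeUnary i j)

iter-fixed : ∀ {A : Set} k {f : A → A} {x} → f x ≡ x → iter k f x ≡ x
iter-fixed zero            eq = refl
iter-fixed (suc k) {f} {x} eq = trans (cong (iter k f) eq) (iter-fixed k eq)

infix 3 _∣_⊢_⟶_
-- A record, since the bare equation would unfold `⟦ p ⟧` and the program could no longer be
-- inferred from the goal.
record Evaluates (K : ℕ) (ρ : Tree) (p : Prog) (v : Tree) : Set where
  constructor ⟨_⟩
  field value : ⟦ p ⟧ K ρ ≡ v

_∣_⊢_⟶_ : ℕ → Tree → Prog → Tree → Set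
_∣_⊢_⟶_ = Evaluates

module _ {K : ℕ} where

  reverse-loop : ∀ k t us →
    tail (iter k (⟦ if (hd arg) (tl (hd arg) ⊗ hd (hd arg) ⊗ tl arg) arg ⟧ K) (t ∙ list us))
      ≡ list (List.take k (spine t) ʳ++ us)
  reverse-loop zero    t       us = refl
  reverse-loop (suc k) nil     us = cong tail (iter-fixed k refl)
  reverse-loop (suc k) (s ∙ t) us = reverse-loop k t (s ∷ us)

  reverse-sem : ∀ xs ρ → ⟦ reverseₚ xs ⟧ K ρ ≡ list (List.take K (spine (⟦ xs ⟧ K ρ)) ʳ++ [])
  reverse-sem xs ρ = reverse-loop K (⟦ xs ⟧ K ρ) []

  fold-loop : ∀ t ρ k us a → length us ≤ k →
    head (tail (iter k
      (⟦ if (hd arg) (tl (hd arg) ⊗ ((hd (hd arg) ⊗ hd (tl arg) ⊗ rest 2) >>> t) ⊗ rest 2) arg ⟧ K)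
      (list us ∙ a ∙ ρ)))
      ≡ foldl (λ a y → ⟦ t ⟧ K (y ∙ a ∙ ρ)) a us
  fold-loop t ρ k       []       a _         = cong (head ∘ tail) (iter-fixed k refl)
  fold-loop t ρ (suc k) (u ∷ us) a (s≤s len) = fold-loop t ρ k us (⟦ t ⟧ K (u ∙ a ∙ ρ)) len

  -- No length is assumed: the clock cuts the list off after K entries. `fold-list` excludes this
  -- case, whereas `budget-⟶` exploits it to keep d within unary reach.
  fold-take : ∀ xs z t ρ → ⟦ foldₚ xs z t ⟧ K ρ ≡
    foldr (λ y a → ⟦ t ⟧ K (y ∙ a ∙ ρ)) (⟦ z ⟧ K ρ) (List.take K (spine (⟦ xs ⟧ K ρ)))
  fold-take xs z t ρ rewrite reverse-sem xs ρ =
    trans (fold-loop t ρ K (us ʳ++ []) (⟦ z ⟧ K ρ) len) (foldl-ʳ++ _ (⟦ z ⟧ K ρ) us)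
    where
    us = List.take K (spine (⟦ xs ⟧ K ρ))
    len : length (us ʳ++ []) ≤ K
    len = begin
      length (us ʳ++ [])                     ≡⟨ length-reverse us ⟩
      length us                              ≡⟨ length-take K (spine (⟦ xs ⟧ K ρ)) ⟩
      K ⊓ length (spine (⟦ xs ⟧ K ρ))        ≤⟨ m⊓n≤m K _ ⟩
      K                                      ∎
      where open ≤-Reasoning

  fold-list : ∀ {xs} z t {ρ us} → K ∣ ρ ⊢ xs ⟶ list us → length us ≤ K →
    ⟦ foldₚ xs z t ⟧ K ρ ≡ foldr (λ y a → ⟦ t ⟧ K (y ∙ a ∙ ρ)) (⟦ z ⟧ K ρ) us
  fold-list {xs} z t {ρ} {us} ⟨ eq ⟩ len = trans (fold-take xs z t ρ)
    (cong (foldr _ (⟦ z ⟧ K ρ))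
      (trans (cong (List.take K) (trans (cong spine eq) (spine-list us))) (take-all K us len)))

  fold-tab : ∀ {xs} z t {ρ m} {f : Fin m → Tree} → K ∣ ρ ⊢ xs ⟶ tab f → m ≤ K →
    ⟦ foldₚ xs z t ⟧ K ρ ≡ foldr (λ y a → ⟦ t ⟧ K (y ∙ a ∙ ρ)) (⟦ z ⟧ K ρ) (List.tabulate f)
  fold-tab z t {f = f} xs⟶ m≤K =
    fold-list z t xs⟶ (subst (_≤ K) (sym (length-tabulate f)) m≤K)

  ⟶-cong : ∀ {p ρ v w} → v ≡ w → K ∣ ρ ⊢ p ⟶ v → K ∣ ρ ⊢ p ⟶ w
  ⟶-cong refl d = d

  ⟶-⊗ : ∀ {s t ρ v w} → K ∣ ρ ⊢ s ⟶ v → K ∣ ρ ⊢ t ⟶ w → K ∣ ρ ⊢ s ⊗ t ⟶ v ∙ w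
  ⟶-⊗ ⟨ refl ⟩ ⟨ refl ⟩ = ⟨ refl ⟩

  ⟶-hd : ∀ {s ρ v} → K ∣ ρ ⊢ s ⟶ v → K ∣ ρ ⊢ hd s ⟶ head v
  ⟶-hd ⟨ refl ⟩ = ⟨ refl ⟩

  ⟶-tl : ∀ {s ρ v} → K ∣ ρ ⊢ s ⟶ v → K ∣ ρ ⊢ tl s ⟶ tail v
  ⟶-tl ⟨ refl ⟩ = ⟨ refl ⟩

  ⟶->>> : ∀ {s t ρ v w} → K ∣ ρ ⊢ s ⟶ v → K ∣ v ⊢ t ⟶ w → K ∣ ρ ⊢ s >>> t ⟶ w
  ⟶->>> ⟨ refl ⟩ ⟨ refl ⟩ = ⟨ refl ⟩

  ⟶-if : ∀ {c s t ρ b v w} → K ∣ ρ ⊢ c ⟶ b → K ∣ ρ ⊢ s ⟶ v → K ∣ ρ ⊢ t ⟶ w →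
    K ∣ ρ ⊢ if c s t ⟶ (if isCons b then v else w)
  ⟶-if {b = b} ⟨ refl ⟩ ⟨ refl ⟩ ⟨ refl ⟩ = ⟨ ifᵀ-isCons b _ _ ⟩

  ⟶-ifᵇ : ∀ {c s t ρ b v w} → K ∣ ρ ⊢ c ⟶ codeBool b → K ∣ ρ ⊢ s ⟶ v → K ∣ ρ ⊢ t ⟶ w →
    K ∣ ρ ⊢ if c s t ⟶ (if b then v else w)
  ⟶-ifᵇ {b = b} {v} {w} c⟶ s⟶ t⟶ =
    ⟶-cong (cong (if_then v else w) (isCons-codeBool b)) (⟶-if c⟶ s⟶ t⟶)

  -- A simulation argument: when t acts on codes as g acts on data, the folds correspond as well, so
  -- each program below only has to be checked for one step.
  fold-tabulate : ∀ {xs z t ρ m} {A : Set} (code : A → Tree) {f : Fin m → Tree} {g : Fin m → A → A} {a} →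
    K ∣ ρ ⊢ xs ⟶ tab f → m ≤ K → K ∣ ρ ⊢ z ⟶ code a →
    (∀ i a → K ∣ f i ∙ code a ∙ ρ ⊢ t ⟶ code (g i a)) →
    K ∣ ρ ⊢ foldₚ xs z t ⟶ code (foldr g a (List.allFin m))
  fold-tabulate {z = z} {t} {ρ} {m} {A} code {f} {g} {a} xs⟶ m≤K ⟨ z≡ ⟩ t⟶ =
    ⟨ trans (fold-tab z t xs⟶ m≤K) (go (λ i → i)) ⟩
    where
    go : ∀ {l} (h : Fin l → Fin m) →
      foldr (λ y a → ⟦ t ⟧ K (y ∙ a ∙ ρ)) (⟦ z ⟧ K ρ) (List.tabulate (f ∘ h)) ≡ code (foldr g a (List.tabulate h))
    go {zero}  h = z≡
    go {suc l} h rewrite go (h ∘ suc) = Evaluates.value (t⟶ (h zero) (foldr g a (List.tabulate (h ∘ suc))))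

  map-tab : ∀ {xs t ρ m} {f g : Fin m → Tree} → K ∣ ρ ⊢ xs ⟶ tab f → m ≤ K →
    (∀ i → K ∣ f i ∙ ρ ⊢ t ⟶ g i) → K ∣ ρ ⊢ mapₚ xs t ⟶ tab g
  map-tab {t = t} {ρ} {f = f} {g} xs⟶ m≤K t⟶ = 
    ⟨ trans (fold-tab nil (((# 0 ⊗ rest 2) >>> t) ⊗ # 1) xs⟶ m≤K) (go f g t⟶) ⟩
    where
    go : ∀ {m} (f g : Fin m → Tree) → (∀ i → K ∣ f i ∙ ρ ⊢ t ⟶ g i) →
      foldr (λ y a → ⟦ t ⟧ K (y ∙ ρ) ∙ a) nil (List.tabulate f) ≡ tab g
    go {zero}  f g t⟶ = refl
    go {suc m} f g t⟶ = cong₂ _∙_ (Evaluates.value (t⟶ zero)) (go (f ∘ suc) (g ∘ suc) (t⟶ ∘ suc))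

  drop-tails : ∀ {i xs ρ j t} → K ∣ ρ ⊢ i ⟶ codeUnary j → j ≤ K → K ∣ ρ ⊢ xs ⟶ t →
    K ∣ ρ ⊢ dropₚ i xs ⟶ tails j t
  drop-tails {xs = xs} {ρ} {j} i⟶ j≤K ⟨ refl ⟩ =
    ⟨ trans (fold-list xs (tl (# 1)) (⟶-cong (codeUnary-list j) i⟶)
               (subst (_≤ K) (sym (length-replicate j)) j≤K)) (go j) ⟩
    where
    go : ∀ j → foldr (λ _ → tail) (⟦ xs ⟧ K ρ) (List.replicate j nil) ≡ tails j (⟦ xs ⟧ K ρ)
    go zero    = refl
    go (suc j) = cong tail (go j)

  !-tab : ∀ {xs i ρ m} {f : Fin m → Tree} {j} → K ∣ ρ ⊢ xs ⟶ tab f → K ∣ ρ ⊢ i ⟶ codeFin j → m ≤ K →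
    K ∣ ρ ⊢ xs ! i ⟶ f j
  !-tab {f = f} {j} xs⟶ i⟶ m≤K = ⟶-cong (head-tails f j)
    (⟶-hd (drop-tails i⟶ (≤-trans (<⇒≤ (toℕ<n j)) m≤K) xs⟶))

  ==-unary : ∀ {s t ρ i j} → K ∣ ρ ⊢ s ⟶ codeUnary i → K ∣ ρ ⊢ t ⟶ codeUnary j → i ≤ K → j ≤ K →
    K ∣ ρ ⊢ s == t ⟶ codeBool (i ≡ᵇ j)
  ==-unary {i = i} {j} s⟶ t⟶ i≤K j≤K = ⟶-cong (go i j)
    (⟶-if (⟶-cong (tails-codeUnary i j) (drop-tails s⟶ i≤K t⟶)) ⟨ refl ⟩
      (⟶-if (⟶-cong (tails-codeUnary j i) (drop-tails t⟶ j≤K s⟶)) ⟨ refl ⟩ ⟨ refl ⟩))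
    where
    go : ∀ i j → (if isCons (codeUnary (j ∸ i)) then nil
                  else (if isCons (codeUnary (i ∸ j)) then nil else (nil ∙ nil))) ≡ codeBool (i ≡ᵇ j)
    go zero    zero    = refl
    go zero    (suc j) = refl
    go (suc i) zero    = refl
    go (suc i) (suc j) = go i j

  ++-tab : ∀ {xs ys ρ k l} {f : Fin k → Tree} {g : Fin l → Tree} →
    K ∣ ρ ⊢ xs ⟶ tab f → K ∣ ρ ⊢ ys ⟶ tab g → k ≤ K →
    K ∣ ρ ⊢ xs ++ₚ ys ⟶ tab ([ f , g ]′ ∘ splitAt k)
  ++-tab {ys = ys} {f = f} {g} xs⟶ ⟨ ys≡ ⟩ k≤K =
    ⟨ trans (fold-tab ys (# 0 ⊗ # 1) xs⟶ k≤K) (trans (cong (λ z → foldr _∙_ z (List.tabulate f)) ys≡) (go f)) ⟩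
    where
    go : ∀ {k} (f : Fin k → Tree) → foldr _∙_ (tab g) (List.tabulate f) ≡ tab ([ f , g ]′ ∘ splitAt k)
    go {zero}  f = refl
    go {suc k} f = cong (f zero ∙_)
      (trans (go (f ∘ suc)) (tab-cong (λ i → sym ([,]-map (splitAt k i)))))

  indices-tab : ∀ {xs ρ m} {f : Fin m → Tree} → K ∣ ρ ⊢ xs ⟶ tab f → m ≤ K →
    K ∣ ρ ⊢ indices xs ⟶ tab (codeFin {m})
  indices-tab {ρ = ρ} {f = f} xs⟶ m≤K = 
    ⟨ trans (fold-tab nil (nil ⊗ mapₚ (# 1) (nil ⊗ # 0)) xs⟶ m≤K) (go f m≤K) ⟩
    where
    go : ∀ {m} (f : Fin m → Tree) → m ≤ K →
      foldr (λ y a → nil ∙ ⟦ mapₚ (# 1) (nil ⊗ # 0) ⟧ K (y ∙ a ∙ ρ)) nil (List.tabulate f) ≡ tab (codeFin {m})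
    go {zero}  f m≤K = refl
    go {suc m} f m≤K = cong (nil ∙_)
      (Evaluates.value (map-tab {# 1} {nil ⊗ # 0} {f zero ∙ _ ∙ ρ} ⟨ go (f ∘ suc) (<⇒≤ m≤K) ⟩ (<⇒≤ m≤K) (λ i → ⟨ refl ⟩)))

  ⟶-ifᶜ : ∀ {A : Set} (code : A → Tree) {c s t ρ v b x y} → K ∣ ρ ⊢ c ⟶ v → isCons v ≡ b →
    K ∣ ρ ⊢ s ⟶ code x → K ∣ ρ ⊢ t ⟶ code y → K ∣ ρ ⊢ if c s t ⟶ code (if b then x else y)
  ⟶-ifᶜ code {b = b} c⟶ refl s⟶ t⟶ = ⟶-cong (sym (if-float code b)) (⟶-if c⟶ s⟶ t⟶)

-- Graph search

nonEmpty : ∀ {A : Set} → List A → Bool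
nonEmpty []      = false
nonEmpty (_ ∷ _) = true

-- Breadth-first search from node zero; a path is stored as the list of its
-- nodes, from its end back to zero.
module Search {m} (E : Fin (suc m) → Fin (suc m) → Bool) where

  Node : Set
  Node = Fin (suc m)

  Paths : Set
  Paths = Node → List Node

  -- Requiring `v ∉ˡ p` keeps paths simple, so that the pushes along a path act on distinct edges.
  data Path : Node → List Node → Set where
    source : Path zero (zero ∷ [])
    extend : ∀ {u v p} → Path u p → E u v ≡ true → v ∉ˡ p → Path v (v ∷ p)

  reached : Paths → Node → Bool
  reached P v = nonEmpty (P v)

  via : Paths → Node → Node → List Node → List Node
  via P v u p = if reached P u then (if E u v then v ∷ P u else p) else p

  first : Paths → Node → List Node
  first P v = foldr (via P v) [] (allFin (suc m))

  step : Paths → Paths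
  step P v = if reached P v then P v else first P v

  start : Paths
  start zero    = zero ∷ []
  start (suc v) = []

  opaque
    search : Paths
    search = foldr (λ _ → step) start (allFin (suc m))

  -- `stays` records that no reached node has an edge to v; when no node is `found`, this is what
  -- makes the reached set closed.
  data Step (P : Paths) (v : Node) : Set where
    keep  : reached P v ≡ true → step P v ≡ P v → Step P v
    found : ∀ u → reached P v ≡ false → reached P u ≡ true → E u v ≡ true → step P v ≡ v ∷ P u → Step P v
    stays : reached P v ≡ false → step P v ≡ [] → (∀ u → reached P u ≡ true → E u v ≡ false) → Step P v

  step-view : ∀ P v → Step P v
  step-view P v with reached P v in eq
  ... | true  = keep eq (cong (if_then P v else first P v) eq)
  ... | false with scan (allFin (suc m))
    where
    scan : ∀ us → (∃[ u ] (reached P u ≡ true × E u v ≡ true × foldr (via P v) [] us ≡ v ∷ P u))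
             ⊎ (foldr (via P v) [] us ≡ [] × (∀ u → u ∈ˡ us → reached P u ≡ true → E u v ≡ false))
    scan [] = inj₂ (refl , λ _ ())
    scan (u ∷ us) with reached P u in r | E u v in e | scan us
    ... | true  | true  | _                   = inj₁ (u , r , e , refl)
    ... | true  | false | inj₁ x              = inj₁ x
    ... | true  | false | inj₂ (eq , h)    = inj₂ (eq , λ { _ (here refl) _ → e ; w (there w∈) → h w w∈ })
    ... | false | _     | inj₁ x              = inj₁ x
    ... | false | _     | inj₂ (eq , h)    =
      inj₂ (eq , λ { _ (here refl) r′ → contradiction (trans (sym r) r′) λ () ; w (there w∈) → h w w∈ })
  ...   | inj₁ (u , r , e , eq′) = found u eq r e (trans (cong (if_then P v else first P v) eq) eq′)
  ...   | inj₂ (eq′ , h)         = stays eq (trans (cong (if_then P v else first P v) eq) eq′) (λ u → h u (∈-allFin u))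

  step-reached : ∀ P v → reached P v ≡ true → reached (step P) v ≡ true
  step-reached P v r with step-view P v
  ... | keep _ eq          = trans (cong nonEmpty eq) r
  ... | found _ r′ _ _ _   = contradiction (trans (sym r) r′) λ ()
  ... | stays r′ _ _        = contradiction (trans (sym r) r′) λ ()

  Closed : Paths → Set
  Closed P = ∀ u v → reached P u ≡ true → E u v ≡ true → reached P v ≡ true

  count : Paths → ℕ
  count P = ∣ tabulate (reached P) ∣

  step-closed : ∀ P → Closed P → Closed (step P)
  step-closed P closed u v r e = step-reached P v (closed u v (back u r) e)
    where
    back : ∀ u → reached (step P) u ≡ true → reached P u ≡ true
    back u r with step-view P u
    ... | keep r′ _         = r′
    ... | found w _ r′ e _  = closed w u r′ e
    ... | stays _ eq _       = contradiction (trans (sym r) (cong nonEmpty eq)) λ ()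

  closed-or-grows : ∀ P → Closed P ⊎ count P < count (step P)
  closed-or-grows P
    with any? (λ v → (reached P v Bool.≟ false) ×-dec (reached (step P) v Bool.≟ true))
  ... | yes (v , new , r) = inj₂ (p⊂q⇒∣p∣<∣q∣
          ( (λ {x} x∈ → to (step P) (step-reached P x (from P x∈)))
          , v , to (step P) r , λ v∈ → contradiction (trans (sym new) (from P v∈)) λ ()))
    where
    to : ∀ P {x} → reached P x ≡ true → x ∈ tabulate (reached P)
    to P {x} r = lookup⇒[]= x _ (trans (lookup∘tabulate (reached P) x) r)
    from : ∀ P {x} → x ∈ tabulate (reached P) → reached P x ≡ true
    from P {x} x∈ = trans (sym (lookup∘tabulate (reached P) x)) ([]=⇒lookup x∈)
  ... | no stuck = inj₁ closed
    where
    closed : Closed P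
    closed u v r e with step-view P v
    ... | keep r′ _            = r′
    ... | found _ new _ _ eq   = contradiction (v , new , cong nonEmpty eq) stuck
    ... | stays _ _ h           = contradiction (trans (sym e) (h u r)) λ ()

  opaque
    unfolding search

    -- A round that does not start from a closed set reaches a new node. Counting from the one node
    -- of `start`, `suc m` such rounds would reach more than `suc m` nodes.
    search-closed : Closed search
    search-closed with go (allFin (suc m))
      where
      go : ∀ {A : Set} (us : List A) → Closed (foldr (λ _ → step) start us)
             ⊎ length us < count (foldr (λ _ → step) start us)
      go [] = inj₂ (s≤s z≤n)
      go (u ∷ us) with go us
      ... | inj₁ closed = inj₁ (step-closed _ closed)
      ... | inj₂ l≤ with closed-or-grows (foldr (λ _ → step) start us)
      ...   | inj₁ closed = inj₁ (step-closed _ closed)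
      ...   | inj₂ grows  = inj₂ (≤-<-trans l≤ grows)
    ... | inj₁ closed = closed
    ... | inj₂ l<     = contradiction (∣p∣≤n (tabulate (reached search)))
                          (<⇒≱ (subst (_< count search) (length-tabulate (λ i → i)) l<))

  -- The number l counts rounds. Since all nodes of a stored path are reached, a newly found node
  -- does not lie on it, and the extended path is again simple.
  Sound : ℕ → Paths → Set
  Sound l P = ∀ v → reached P v ≡ true →
    Path v (P v) × All (λ u → reached P u ≡ true) (P v) × length (P v) ≤ suc l

  step-sound : ∀ {l} P → Sound l P → Sound (suc l) (step P)
  step-sound {l} P sound v r with step-view P v
  ... | keep r′ eq with sound v r′
  ...   | path , all , len rewrite eq = path , All.map (λ {u} → step-reached P u) all , m≤n⇒m≤1+n len
  step-sound {l} P sound v r | found u new r′ e eq with sound u r′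
  ...   | path , all , len = subst Good (sym eq)
            ( extend path e (λ v∈ → contradiction (trans (sym new) (All.lookup all v∈)) λ ())
            , cong nonEmpty eq ∷ All.map (λ {u} → step-reached P u) all , s≤s len )
    where
    Good : List Node → Set
    Good p = Path v p × All (λ u → reached (step P) u ≡ true) p × length p ≤ suc (suc l)
  step-sound {l} P sound v r | stays _ eq _ = contradiction (trans (sym r) (cong nonEmpty eq)) λ ()

  step-zero : ∀ {A : Set} (us : List A) → reached (foldr (λ _ → step) start us) zero ≡ true
  step-zero []       = refl
  step-zero (u ∷ us) = step-reached (foldr (λ _ → step) start us) zero (step-zero us)

  opaque
    unfolding search

    search-sound : ∀ v → reached search v ≡ true → Path v (search v) × length (search v) ≤ suc (suc m)
    search-sound v r with go (allFin (suc m)) v r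
      where
      go : ∀ {A : Set} (us : List A) → Sound (length us) (foldr (λ _ → step) start us)
      go [] zero r  = source , refl ∷ [] , ≤-refl
      go (u ∷ us)   = step-sound _ (go us)
    ... | path , _ , len = path , subst (λ l → length (search v) ≤ suc l) (length-tabulate {n = suc m} (λ i → i)) len

    search-zero : reached search zero ≡ true
    search-zero = step-zero (allFin (suc m))

    search-unfold : search ≡ foldr (λ _ → step) start (allFin (suc m))
    search-unfold = refl

-- Flows and augmenting paths

opaque
  ∑ : ∀ {n} → (Fin n → ℕ) → ℕ
  ∑ = Sum.sum

  ∑-suc : ∀ {n} (f : Fin (suc n) → ℕ) → ∑ f ≡ f zero + ∑ (f ∘ suc)
  ∑-suc f = refl

  ∑-vec : ∀ {n} (f : Fin n → ℕ) → Vec.sum (Vec.tabulate f) ≡ ∑ f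
  ∑-vec {zero}  f = refl
  ∑-vec {suc n} f = cong (f zero +_) (∑-vec (f ∘ suc))

  ∑-cong : ∀ {n} {f g : Fin n → ℕ} → (∀ i → f i ≡ g i) → ∑ f ≡ ∑ g
  ∑-cong = Sum.sum-cong-≗

  ∑-+ : ∀ {n} (f g : Fin n → ℕ) → ∑ (λ i → f i + g i) ≡ ∑ f + ∑ g
  ∑-+ = Sum.∑-distrib-+

  ∑-comm : ∀ {m n} (f : Fin m → Fin n → ℕ) → ∑ (λ i → ∑ (f i)) ≡ ∑ (λ j → ∑ (λ i → f i j))
  ∑-comm = Sum.∑-comm

  *-∑ : ∀ {n} k (f : Fin n → ℕ) → k * ∑ f ≡ ∑ (λ i → k * f i)
  *-∑ = Sum.*-distribˡ-sum

  ∑-mono : ∀ {n} {f g : Fin n → ℕ} → (∀ i → f i ≤ g i) → ∑ f ≤ ∑ g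
  ∑-mono {zero}  f≤g = z≤n
  ∑-mono {suc n} f≤g = +-mono-≤ (f≤g zero) (∑-mono (f≤g ∘ suc))

  ∑-mono-≡ : ∀ {n} {f g : Fin n → ℕ} → (∀ i → f i ≤ g i) → ∑ g ≤ ∑ f → ∀ i → f i ≡ g i
  ∑-mono-≡ {suc n} {f} {g} f≤g ∑g≤∑f zero = ≤-antisym (f≤g zero)
    (+-cancelʳ-≤ (∑ (g ∘ suc)) (g zero) (f zero)
      (≤-trans ∑g≤∑f (+-monoʳ-≤ (f zero) (∑-mono (f≤g ∘ suc)))))
  ∑-mono-≡ {suc n} {f} {g} f≤g ∑g≤∑f (suc i) = ∑-mono-≡ (f≤g ∘ suc)
    (+-cancelˡ-≤ (g zero) (∑ (g ∘ suc)) (∑ (f ∘ suc))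
      (≤-trans ∑g≤∑f (+-monoˡ-≤ (∑ (f ∘ suc)) (f≤g zero)))) i

  ∑-zero : ∀ {n} {f : Fin n → ℕ} → (∀ i → f i ≡ 0) → ∑ f ≡ 0
  ∑-zero {n} f≡0 = trans (∑-cong f≡0) (Sum.sum-replicate-zero n)

𝟙 : Bool → ℕ
𝟙 true  = 1
𝟙 false = 0

infix 4 _≡ᶠ_
_≡ᶠ_ : ∀ {n} → Fin n → Fin n → Bool
i ≡ᶠ j = toℕ i ≡ᵇ toℕ j

≡ᶠ-true : ∀ {n} {i j : Fin n} → (i ≡ᶠ j) ≡ true → i ≡ j
≡ᶠ-true {i = i} {j} eq = toℕ-injective (≡ᵇ⇒≡ (toℕ i) (toℕ j) (subst T (sym eq) tt))

≡ᶠ-refl : ∀ {n} (i : Fin n) → (i ≡ᶠ i) ≡ true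
≡ᶠ-refl zero    = refl
≡ᶠ-refl (suc i) = ≡ᶠ-refl i

≢⇒≡ᶠ-false : ∀ {n} {i j : Fin n} → i ≢ j → (i ≡ᶠ j) ≡ false
≢⇒≡ᶠ-false {i = i} {j} i≢j with i ≡ᶠ j in eq
... | true  = contradiction (≡ᶠ-true eq) i≢j
... | false = refl

∑-δ : ∀ {n} (a : Fin n) → ∑ (λ i → 𝟙 (a ≡ᶠ i)) ≡ 1
∑-δ zero    = trans (∑-suc _) (cong suc (∑-zero (λ i → refl)))
∑-δ (suc a) = trans (∑-suc _) (∑-δ a)

-- Symbolic, so that augmentation never meets the finite number that replaces infinity in the
-- network.
data Capacity : Set where
  none unit inf : Capacity

Fits : Capacity → ℕ → Set
Fits none k = k ≤ 0
Fits unit k = k ≤ 1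
Fits inf  k = ⊤

Fits-mono : ∀ c {j k} → j ≤ k → Fits c k → Fits c j
Fits-mono none = ≤-trans
Fits-mono unit = ≤-trans
Fits-mono inf  _ _ = tt

isPos : ℕ → Bool
isPos zero    = false
isPos (suc _) = true

-- The residual capacity of an edge depends only on whether the flow through
-- it, and the flow through its reverse, are positive.
residual : Capacity → Bool → Bool → Bool
residual none p q = q
residual unit p q = if q then true else not p
residual inf  p q = true

module Augment {m} (cap : Fin (suc m) → Fin (suc m) → Capacity) where

  Node : Set
  Node = Fin (suc m)

  FlowMap : Set
  FlowMap = Node → Node → ℕ

  Residual : FlowMap → Node → Node → Bool
  Residual f u v = residual (cap u v) (isPos (f u v)) (isPos (f v u))

  -- `push` moves one unit from u to v: it cancels flow on the reverse edge if there is any and uses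
  -- the forward edge otherwise.
  decrement increment push : Node → Node → FlowMap → FlowMap
  decrement u v f x y = if u ≡ᶠ x then (if v ≡ᶠ y then pred (f x y) else f x y) else f x y
  increment u v f x y = if u ≡ᶠ x then (if v ≡ᶠ y then suc (f x y) else f x y) else f x y
  push u v f x y = if isPos (f v u) then decrement v u f x y else increment u v f x y

  pushStep : Node → Node × FlowMap → Node × FlowMap
  pushStep v (u , f) = v , push u v f

  augment : List Node → FlowMap → FlowMap
  augment p f = proj₂ (foldr pushStep (zero , f) p)

  out inn : FlowMap → Node → ℕ
  out f x = ∑ (λ y → f x y)
  inn f x = ∑ (λ y → f y x)

  -- From f to g, the excess out − inn has grown by one at a and shrunk by one
  -- at b.
  record Shift (f g : FlowMap) (a b : Node) : Set where
    constructor shifted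
    field balance : ∀ x → out g x + inn f x + 𝟙 (b ≡ᶠ x) ≡ out f x + inn g x + 𝟙 (a ≡ᶠ x)
  open Shift

  record Bump (f g : FlowMap) (a b : Node) : Set where
    constructor bumped
    field entry : ∀ x y → g x y ≡ f x y + 𝟙 (a ≡ᶠ x) * 𝟙 (b ≡ᶠ y)
  open Bump

  bump-out : ∀ {f g a b} → Bump f g a b → ∀ x → out g x ≡ out f x + 𝟙 (a ≡ᶠ x)
  bump-out {f} {g} {a} {b} bump x = begin
    out g x                                                     ≡⟨ ∑-cong (entry bump x) ⟩
    ∑ (λ y → f x y + 𝟙 (a ≡ᶠ x) * 𝟙 (b ≡ᶠ y))                ≡⟨ ∑-+ (f x) (λ y → 𝟙 (a ≡ᶠ x) * 𝟙 (b ≡ᶠ y)) ⟩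
    out f x + ∑ (λ y → 𝟙 (a ≡ᶠ x) * 𝟙 (b ≡ᶠ y))              ≡⟨ cong (out f x +_) (*-∑ (𝟙 (a ≡ᶠ x)) (λ y → 𝟙 (b ≡ᶠ y))) ⟨
    out f x + 𝟙 (a ≡ᶠ x) * ∑ (λ y → 𝟙 (b ≡ᶠ y))              ≡⟨ cong (λ k → out f x + 𝟙 (a ≡ᶠ x) * k) (∑-δ b) ⟩
    out f x + 𝟙 (a ≡ᶠ x) * 1                                    ≡⟨ cong (out f x +_) (*-identityʳ _) ⟩
    out f x + 𝟙 (a ≡ᶠ x)                                        ∎
    where open ≡-Reasoning

  bump-inn : ∀ {f g a b} → Bump f g a b → ∀ y → inn g y ≡ inn f y + 𝟙 (b ≡ᶠ y)
  bump-inn {f} {g} {a} {b} bump y = begin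
    inn g y                                                     ≡⟨ ∑-cong (λ x → trans (entry bump x y) (cong (f x y +_) (*-comm (𝟙 (a ≡ᶠ x)) _))) ⟩
    ∑ (λ x → f x y + 𝟙 (b ≡ᶠ y) * 𝟙 (a ≡ᶠ x))                ≡⟨ ∑-+ (λ x → f x y) (λ x → 𝟙 (b ≡ᶠ y) * 𝟙 (a ≡ᶠ x)) ⟩
    inn f y + ∑ (λ x → 𝟙 (b ≡ᶠ y) * 𝟙 (a ≡ᶠ x))              ≡⟨ cong (inn f y +_) (*-∑ (𝟙 (b ≡ᶠ y)) (λ x → 𝟙 (a ≡ᶠ x))) ⟨
    inn f y + 𝟙 (b ≡ᶠ y) * ∑ (λ x → 𝟙 (a ≡ᶠ x))              ≡⟨ cong (λ k → inn f y + 𝟙 (b ≡ᶠ y) * k) (∑-δ a) ⟩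
    inn f y + 𝟙 (b ≡ᶠ y) * 1                                    ≡⟨ cong (inn f y +_) (*-identityʳ _) ⟩
    inn f y + 𝟙 (b ≡ᶠ y)                                        ∎
    where open ≡-Reasoning

  bump-shift : ∀ {f g a b} → Bump f g a b → Shift f g a b
  bump-shift {f} {g} {a} {b} bump = shifted λ x → trans
    (cong (λ o → o + inn f x + 𝟙 (b ≡ᶠ x)) (bump-out bump x))
    (trans (shuffle (out f x) (𝟙 (a ≡ᶠ x)) (inn f x) (𝟙 (b ≡ᶠ x)))
      (cong (λ i → out f x + i + 𝟙 (a ≡ᶠ x)) (sym (bump-inn bump x))))
    where
    shuffle : ∀ o α i β → o + α + i + β ≡ o + (i + β) + α
    shuffle = solve-∀

  shift-sym : ∀ {f g a b} → Shift f g a b → Shift g f b a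
  shift-sym (shifted sh) = shifted λ x → sym (sh x)

  shift-trans : ∀ {f g h a b c} → Shift f g a b → Shift g h b c → Shift f h a c
  shift-trans {f} {g} {h} {a} {b} {c} (shifted sh) (shifted sh′) = shifted λ x →
    +-cancelˡ-≡ (out g x + inn g x + 𝟙 (b ≡ᶠ x)) _ _
      (trans (lhs (out g x) (inn g x) (𝟙 (b ≡ᶠ x)) (out h x) (inn f x) (𝟙 (c ≡ᶠ x)))
        (trans (cong₂ _+_ (sh x) (sh′ x))
          (rhs (out f x) (inn g x) (𝟙 (a ≡ᶠ x)) (out g x) (inn h x) (𝟙 (b ≡ᶠ x)))))
    where
    lhs : ∀ og ig β oh i γ → (og + ig + β) + (oh + i + γ) ≡ (og + i + β) + (oh + ig + γ)
    lhs = solve-∀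
    rhs : ∀ o ig α og ih β → (o + ig + α) + (og + ih + β) ≡ (og + ig + β) + (o + ih + α)
    rhs = solve-∀

  push-bump : ∀ u v f → Bump f (push u v f) u v ⊎ Bump (push u v f) f v u
  push-bump u v f with isPos (f v u) in pos
  ... | false = inj₁ (bumped up)
    where
    up : ∀ x y → (if u ≡ᶠ x then (if v ≡ᶠ y then suc (f x y) else f x y) else f x y)
                   ≡ f x y + 𝟙 (u ≡ᶠ x) * 𝟙 (v ≡ᶠ y)
    up x y with u ≡ᶠ x | v ≡ᶠ y
    ... | true  | true  = sym (+-comm (f x y) 1)
    ... | true  | false = sym (+-identityʳ _)
    ... | false | _     = sym (+-identityʳ _)
  ... | true  = inj₂ (bumped down)
    where
    down : ∀ x y → f x y ≡ (if v ≡ᶠ x then (if u ≡ᶠ y then pred (f x y) else f x y) else f x y)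
                   + 𝟙 (v ≡ᶠ x) * 𝟙 (u ≡ᶠ y)
    down x y with v ≡ᶠ x in eq | u ≡ᶠ y in eq′
    ... | true  | false = sym (+-identityʳ _)
    ... | false | _     = sym (+-identityʳ _)
    ... | true  | true  with ≡ᶠ-true {i = v} {x} eq | ≡ᶠ-true {i = u} {y} eq′
    ...   | refl | refl with f v u
    ...     | suc k = +-comm 1 k

  -- Cancelling a unit on the reverse edge is a bump from the new map back to the old one with
  -- swapped ends; reading it backwards swaps the ends again, so both kinds of push shift the excess
  -- alike.
  push-shift : ∀ u v f → Shift f (push u v f) u v
  push-shift u v f with push-bump u v f
  ... | inj₁ bump = bump-shift bump
  ... | inj₂ bump = shift-sym (bump-shift bump)

  push-≤ : ∀ u v f x y → push u v f x y ≤ suc (f x y)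
  push-≤ u v f x y with isPos (f v u) | v ≡ᶠ x | u ≡ᶠ y | u ≡ᶠ x | v ≡ᶠ y
  ... | true  | true  | true  | _     | _     = m≤n⇒m≤1+n pred[n]≤n
  ... | true  | true  | false | _     | _     = n≤1+n _
  ... | true  | false | _     | _     | _     = n≤1+n _
  ... | false | _     | _     | true  | true  = ≤-refl
  ... | false | _     | _     | true  | false = n≤1+n _
  ... | false | _     | _     | false | _     = n≤1+n _

  -- The first alternative is for edges that avoid the new node v, the second for edges other than
  -- (u, v) and (v, u), where each inequality of pairs is witnessed by a component.
  push-unchanged : ∀ u v f x y → (x ≢ v × y ≢ v) ⊎ (x ≢ u ⊎ y ≢ v) × (x ≢ v ⊎ y ≢ u) →
    push u v f x y ≡ f x y
  push-unchanged u v f x y h = go (split h)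
    where
    split : (x ≢ v × y ≢ v) ⊎ (x ≢ u ⊎ y ≢ v) × (x ≢ v ⊎ y ≢ u) → (x ≢ u ⊎ y ≢ v) × (x ≢ v ⊎ y ≢ u)
    split (inj₁ (x≢v , y≢v)) = inj₂ y≢v , inj₁ x≢v
    split (inj₂ h)           = h
    go : (x ≢ u ⊎ y ≢ v) × (x ≢ v ⊎ y ≢ u) → push u v f x y ≡ f x y
    go (h₁ , h₂) with isPos (f v u) | v ≡ᶠ x in vx | u ≡ᶠ y in uy | u ≡ᶠ x in ux | v ≡ᶠ y in vy
    go (h₁ , inj₁ x≢v) | true | true  | true  | _ | _ = contradiction (sym (≡ᶠ-true {i = v} vx)) x≢v
    go (h₁ , inj₂ y≢u) | true | true  | true  | _ | _ = contradiction (sym (≡ᶠ-true {i = u} uy)) y≢u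
    go (h₁ , h₂)       | true | true  | false | _ | _ = refl
    go (h₁ , h₂)       | true | false | _     | _ | _ = refl
    go (inj₁ x≢u , h₂) | false | _ | _ | true  | true  = contradiction (sym (≡ᶠ-true {i = u} ux)) x≢u
    go (inj₂ y≢v , h₂) | false | _ | _ | true  | true  = contradiction (sym (≡ᶠ-true {i = v} vy)) y≢v
    go (h₁ , h₂)       | false | _ | _ | true  | false = refl
    go (h₁ , h₂)       | false | _ | _ | false | _     = refl

  FitsAll : FlowMap → Set
  FitsAll f = ∀ x y → Fits (cap x y) (f x y)

  push-fits : ∀ u v f → Residual f u v ≡ true → FitsAll f → FitsAll (push u v f)
  push-fits u v f res fits x y with isPos (f v u) in pos | v ≡ᶠ x | u ≡ᶠ y | u ≡ᶠ x in ux | v ≡ᶠ y in vy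
  ... | true  | true  | true  | _     | _     = Fits-mono (cap x y) pred[n]≤n (fits x y)
  ... | true  | true  | false | _     | _     = fits x y
  ... | true  | false | _     | _     | _     = fits x y
  ... | false | _     | _     | true  | false = fits x y
  ... | false | _     | _     | false | _     = fits x y
  ... | false | _     | _     | true  | true  with ≡ᶠ-true {i = u} {x} ux | ≡ᶠ-true {i = v} {y} vy
  -- The reverse edge carries no flow here, so the residual capacity leaves only an infinite edge or
  -- a unit edge without flow.
  ...   | refl | refl with cap u v | f u v
  ...     | inf  | _    = tt
  ...     | unit | zero = ≤-refl

  -- `unchanged` ensures that an edge that was residual for f is still residual when the path gets
  -- to it. `at-most` will keep the entries of the flow below the number of rounds.
  record Augmented (f : FlowMap) (u : Node) (p : List Node) (s : Node × FlowMap) : Set where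
    private g = proj₂ s
    field
      end       : proj₁ s ≡ u
      fits      : FitsAll g
      unchanged : ∀ x y → x ∉ˡ p ⊎ y ∉ˡ p → g x y ≡ f x y
      at-most   : ∀ x y → g x y ≤ suc (f x y)
      shift     : Shift f g zero u

  module _ (f : FlowMap) (fits-f : FitsAll f) (cap-loop : cap zero zero ≡ inf) where
    open Search (Residual f) using (Path; source; extend)

    -- Following a path starts by pushing one unit around the loop at zero.
    augmented : ∀ {u p} → Path u p → Augmented f u p (foldr pushStep (zero , f) p)
    augmented source = record
      { end       = refl
      ; fits      = push-fits zero zero f (cong (λ c → residual c _ _) cap-loop) fits-f
      ; unchanged = λ x y h → push-unchanged zero zero f x y (inj₂ (swap x y h , swap x y h))
      ; at-most   = push-≤ zero zero f
      ; shift     = push-shift zero zero f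
      }
      where
      swap : ∀ x y → x ∉ˡ zero ∷ [] ⊎ y ∉ˡ zero ∷ [] → x ≢ zero ⊎ y ≢ zero
      swap x y (inj₁ x∉) = inj₁ λ { refl → x∉ (here refl) }
      swap x y (inj₂ y∉) = inj₂ λ { refl → y∉ (here refl) }
    augmented (extend {u} {v} {p} path e v∉) with foldr pushStep (zero , f) p | augmented path
    ... | .u , g | record { end = refl ; fits = fits ; unchanged = unchanged ; at-most = at-most ; shift = shift } = record
      { end       = refl
      ; fits      = push-fits u v g residual-g fits
      ; unchanged = λ { x y (inj₁ x∉) → trans (push-unchanged u v g x y
                            (inj₂ (inj₁ (λ { refl → x∉ (there (end∈ path)) }) , inj₁ (λ { refl → x∉ (here refl) }))))
                            (unchanged x y (inj₁ (x∉ ∘ there)))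
                      ; x y (inj₂ y∉) → trans (push-unchanged u v g x y
                            (inj₂ (inj₂ (λ { refl → y∉ (here refl) }) , inj₂ (λ { refl → y∉ (there (end∈ path)) }))))
                            (unchanged x y (inj₂ (y∉ ∘ there))) }
      ; at-most   = at-most′
      ; shift     = shift-trans shift (push-shift u v g)
      }
      where
      end∈ : ∀ {u p} → Path u p → u ∈ˡ p
      end∈ source         = here refl
      end∈ (extend _ _ _) = here refl
      residual-g : Residual g u v ≡ true
      residual-g = trans (cong₂ (λ j k → residual (cap u v) (isPos j) (isPos k))
                           (unchanged u v (inj₂ v∉)) (unchanged v u (inj₁ v∉))) e
      at-most′ : ∀ x y → push u v g x y ≤ suc (f x y)
      at-most′ x y with x ≟ᶠ v | y ≟ᶠ v
      ... | yes refl | _        = subst (λ k → push u v g x y ≤ suc k) (unchanged x y (inj₁ v∉)) (push-≤ u v g x y)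
      ... | no _     | yes refl = subst (λ k → push u v g x y ≤ suc k) (unchanged x y (inj₂ v∉)) (push-≤ u v g x y)
      ... | no x≢v   | no y≢v   = ≤-trans (≤-reflexive (push-unchanged u v g x y (inj₁ (x≢v , y≢v)))) (at-most x y)

-- Cuts and the Ford-Fulkerson method

isUnit : Capacity → Bool
isUnit none = false
isUnit unit = true
isUnit inf  = false

-- Complementary slackness on one edge, where `k` is the flow on the reverse edge. Infinite edges
-- are excluded because they always have residual capacity.
saturated : ∀ c {j k} → residual c (isPos j) (isPos k) ≡ false → Fits c j →
  c ≢ inf × k ≡ 0 × j ≡ 𝟙 (isUnit c)
saturated none {zero} {zero} _ _     = (λ ()) , refl , refl
saturated unit {1}    {zero} _ _     = (λ ()) , refl , refl
saturated unit {suc (suc _)} {zero} _ (s≤s ())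

unsaturated : ∀ c {j k} → c ≢ inf → k ≡ 0 → j ≡ 𝟙 (isUnit c) → residual c (isPos j) (isPos k) ≡ false
unsaturated none _     refl refl = refl
unsaturated unit _     refl refl = refl
unsaturated inf  c≢inf _    _    = contradiction refl c≢inf

fits-unit : ∀ c {j} → c ≢ inf → Fits c j → j ≤ 𝟙 (isUnit c)
fits-unit none _     fits = fits
fits-unit unit _     fits = fits
fits-unit inf  c≢inf _    = contradiction refl c≢inf

module FordFulkerson {m} (cap : Fin (suc m) → Fin (suc m) → Capacity)
  (cap-zero : cap zero zero ≡ inf) (t : Fin (suc m)) (t≢0 : t ≢ zero) where

  open Augment cap public

  Conserved : FlowMap → Set
  Conserved f = ∀ x → x ≢ zero → x ≢ t → out f x ≡ inn f x

  Cut : Set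
  Cut = Node → Bool

  Separates : Cut → Set
  Separates S = S zero ≡ true × S t ≡ false

  crossing : Cut → FlowMap → FlowMap
  crossing S f x y = 𝟙 (S x) * 𝟙 (not (S y)) * f x y

  total : FlowMap → ℕ
  total f = ∑ (λ x → ∑ (f x))

  forward backward : Cut → FlowMap → ℕ
  forward S f  = total (crossing S f)
  backward S f = total (crossing (not ∘ S) f)

  -- Only unit edges count, so `forward S units` is the capacity of the cut S provided that no
  -- infinite edge crosses it.
  units : FlowMap
  units x y = 𝟙 (isUnit (cap x y))

  total-cong : ∀ {f g} → (∀ x y → f x y ≡ g x y) → total f ≡ total g
  total-cong f≡g = ∑-cong (λ x → ∑-cong (f≡g x))

  total-+ : ∀ f g → total (λ x y → f x y + g x y) ≡ total f + total g
  total-+ f g = trans (∑-cong (λ x → ∑-+ (f x) (g x)))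
    (∑-+ (λ x → ∑ (f x)) (λ x → ∑ (g x)))

  𝟙-split : ∀ b k → k ≡ 𝟙 b * k + 𝟙 (not b) * k
  𝟙-split true  k = sym (trans (+-identityʳ _) (+-identityʳ k))
  𝟙-split false k = sym (+-identityʳ k)

  module _ (S : Cut) (f : FlowMap) where

    inside : FlowMap
    inside x y = 𝟙 (S x) * 𝟙 (S y) * f x y

    weighted-out : ∑ (λ x → 𝟙 (S x) * out f x) ≡ total inside + forward S f
    weighted-out = trans
      (∑-cong (λ x → *-∑ (𝟙 (S x)) (f x)))
      (trans (total-cong split) (total-+ inside (crossing S f)))
      where
      split : ∀ x y → 𝟙 (S x) * f x y ≡ inside x y + crossing S f x y
      split x y = trans (cong (𝟙 (S x) *_) (𝟙-split (S y) (f x y)))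
        (shuffle (𝟙 (S x)) (𝟙 (S y)) (𝟙 (not (S y))) (f x y))
        where
        shuffle : ∀ a b c k → a * (b * k + c * k) ≡ a * b * k + a * c * k
        shuffle = solve-∀

    weighted-inn : ∑ (λ y → 𝟙 (S y) * inn f y) ≡ total inside + backward S f
    weighted-inn = trans
      (∑-cong (λ y → *-∑ (𝟙 (S y)) (λ x → f x y)))
      (trans (∑-comm (λ y x → 𝟙 (S y) * f x y))
        (trans (total-cong split) (total-+ inside (crossing (not ∘ S) f))))
      where
      split : ∀ x y → 𝟙 (S y) * f x y ≡ inside x y + crossing (not ∘ S) f x y
      split x y with S x | S y
      ... | true  | true  = sym (+-identityʳ _)
      ... | true  | false = refl
      ... | false | true  = refl
      ... | false | false = refl

    -- Summing outflow and inflow over S counts the edges inside S on both sides. Conservation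
    -- removes every node but zero, and what remains are the crossing edges. The additive form
    -- avoids subtraction in `ℕ`.
    cut-identity : Separates S → Conserved f → forward S f + inn f zero ≡ backward S f + out f zero
    cut-identity (S0 , St) conserved = +-cancelˡ-≡ (total inside) _ _ (begin
      total inside + (forward S f + inn f zero)               ≡⟨ +-assoc (total inside) _ _ ⟨
      total inside + forward S f + inn f zero                 ≡⟨ cong (_+ inn f zero) weighted-out ⟨
      ∑ (λ x → 𝟙 (S x) * out f x) + inn f zero              ≡⟨ cong (_+ inn f zero) (∑-suc (λ x → 𝟙 (S x) * out f x)) ⟩
      𝟙 (S zero) * out f zero + tail-out + inn f zero         ≡⟨ cong (λ b → 𝟙 b * out f zero + tail-out + inn f zero) S0 ⟩
      1 * out f zero + tail-out + inn f zero                  ≡⟨ cong (λ k → 1 * out f zero + k + inn f zero) tails-agree ⟩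
      1 * out f zero + tail-inn + inn f zero                  ≡⟨ shuffle (out f zero) tail-inn (inn f zero) ⟩
      1 * inn f zero + tail-inn + out f zero                  ≡⟨ cong (λ b → 𝟙 b * inn f zero + tail-inn + out f zero) S0 ⟨
      𝟙 (S zero) * inn f zero + tail-inn + out f zero         ≡⟨ cong (_+ out f zero) (∑-suc (λ x → 𝟙 (S x) * inn f x)) ⟨
      ∑ (λ x → 𝟙 (S x) * inn f x) + out f zero              ≡⟨ cong (_+ out f zero) weighted-inn ⟩
      total inside + backward S f + out f zero                ≡⟨ +-assoc (total inside) _ _ ⟩
      total inside + (backward S f + out f zero)              ∎)
      where
      open ≡-Reasoning
      tail-out = ∑ (λ x → 𝟙 (S (suc x)) * out f (suc x))
      tail-inn = ∑ (λ x → 𝟙 (S (suc x)) * inn f (suc x))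
      shuffle : ∀ a b c → 1 * a + b + c ≡ 1 * c + b + a
      shuffle = solve-∀
      -- Nodes outside S have weight zero, and the target is one of them, so conservation is
      -- available wherever the weight is one.
      tails-agree : tail-out ≡ tail-inn
      tails-agree = ∑-cong λ x → same x (S (suc x)) refl
        where
        same : ∀ x b → S (suc x) ≡ b → 𝟙 b * out f (suc x) ≡ 𝟙 b * inn f (suc x)
        same x false _  = refl
        same x true  Sx = cong (1 *_) (conserved (suc x) (λ ())
          λ { refl → contradiction (trans (sym Sx) St) λ () })

  NoInf : Cut → Set
  NoInf S = ∀ x y → S x ≡ true → S y ≡ false → cap x y ≢ inf

  crossing-≤ : ∀ {S f} → NoInf S → FitsAll f → ∀ x y → crossing S f x y ≤ crossing S units x y
  crossing-≤ {S} {f} noInf fits x y with S x in Sx | S y in Sy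
  ... | true  | true  = z≤n
  ... | true  | false = *-monoʳ-≤ 1 (fits-unit (cap x y) (noInf x y Sx Sy) (fits x y))
  ... | false | _     = z≤n

  weak-duality : ∀ S f → Separates S → NoInf S → FitsAll f → Conserved f →
    out f zero ≤ inn f zero + forward S units
  weak-duality S f sep noInf fits conserved = begin
    out f zero                       ≤⟨ m≤n+m (out f zero) (backward S f) ⟩
    backward S f + out f zero        ≡⟨ cut-identity S f sep conserved ⟨
    forward S f + inn f zero         ≤⟨ +-monoˡ-≤ (inn f zero) (∑-mono (λ x → ∑-mono (crossing-≤ noInf fits x))) ⟩
    forward S units + inn f zero     ≡⟨ +-comm (forward S units) (inn f zero) ⟩
    inn f zero + forward S units     ∎
    where open ≤-Reasoning

  Blocked : FlowMap → Cut → Set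
  Blocked f S = ∀ x y → S x ≡ true → S y ≡ false → Residual f x y ≡ false

  -- Without residual edges leaving S, forward edges are full and backward edges are empty, so weak
  -- duality holds with equality.
  blocked-value : ∀ S f → Separates S → Blocked f S → FitsAll f → Conserved f →
    out f zero ≡ inn f zero + forward S units
  blocked-value S f sep blocked fits conserved = begin
    out f zero                       ≡⟨ cong (_+ out f zero) back≡0 ⟨
    backward S f + out f zero        ≡⟨ cut-identity S f sep conserved ⟨
    forward S f + inn f zero         ≡⟨ cong (_+ inn f zero) (total-cong fwd) ⟩
    forward S units + inn f zero     ≡⟨ +-comm (forward S units) (inn f zero) ⟩
    inn f zero + forward S units     ∎
    where
    open ≡-Reasoning
    fwd : ∀ x y → crossing S f x y ≡ crossing S units x y
    fwd x y with S x in Sx | S y in Sy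
    ... | true  | true  = refl
    ... | true  | false = cong (1 *_) (proj₂ (proj₂ (saturated (cap x y) {f x y} {f y x} (blocked x y Sx Sy) (fits x y))))
    ... | false | _     = refl
    bwd : ∀ x y → crossing (not ∘ S) f x y ≡ 0
    bwd x y with S x in Sx | S y in Sy
    ... | true  | _     = refl
    ... | false | false = refl
    ... | false | true  = trans (+-identityʳ _)
      (proj₁ (proj₂ (saturated (cap y x) {f y x} {f x y} (blocked y x Sy Sx) (fits y x))))
    back≡0 : backward S f ≡ 0
    back≡0 = ∑-zero (λ x → ∑-zero (bwd x))

  -- A converse of `blocked-value`: if the value reaches the capacity of the cut, the cut identity
  -- has no slack left on any edge. This applies to flows that do not come from augmentation.
  value-blocks : ∀ S f → Separates S → NoInf S → FitsAll f → Conserved f →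
    inn f zero + forward S units ≤ out f zero → Blocked f S
  value-blocks S f sep noInf fits conserved value x y Sx Sy =
    unsaturated (cap x y) (noInf x y Sx Sy) fyx≡0 fxy≡
    where
    crosses = crossing-≤ {S} {f} noInf fits
    key : backward S f + forward S units ≤ forward S f
    key = +-cancelʳ-≤ (inn f zero) _ _ (begin
      backward S f + forward S units + inn f zero    ≡⟨ +-assoc (backward S f) _ _ ⟩
      backward S f + (forward S units + inn f zero)  ≡⟨ cong (backward S f +_) (+-comm (forward S units) _) ⟩
      backward S f + (inn f zero + forward S units)  ≤⟨ +-monoʳ-≤ (backward S f) value ⟩
      backward S f + out f zero                      ≡⟨ cut-identity S f sep conserved ⟨
      forward S f + inn f zero                       ∎)
      where open ≤-Reasoning
    -- The entrywise inequalities add up to an equality, so they are tight, first for the row sums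
    -- and then within each row.
    fwd : ∀ x y → crossing S f x y ≡ crossing S units x y
    fwd x = ∑-mono-≡ (crosses x) (≤-reflexive (sym
      (∑-mono-≡ (λ x → ∑-mono (crosses x)) (≤-trans (m≤n+m _ (backward S f)) key) x)))
    back≡0 : backward S f ≡ 0
    back≡0 = n≤0⇒n≡0 (+-cancelʳ-≤ (forward S units) _ _
      (≤-trans key (∑-mono (λ x → ∑-mono (crosses x)))))
    bwd : ∀ x y → 0 ≡ crossing (not ∘ S) f x y
    bwd x = ∑-mono-≡ {g = crossing (not ∘ S) f x} (λ _ → z≤n)
      (≤-reflexive (trans (sym (∑-mono-≡ {f = λ _ → 0} {g = λ x → ∑ (crossing (not ∘ S) f x)} (λ _ → z≤n)
        (≤-trans (≤-reflexive back≡0) z≤n) x)) (sym (∑-zero {f = λ _ → 0} (λ _ → refl)))))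
    fxy≡ : f x y ≡ units x y
    fxy≡ = *-cancelˡ-≡ _ _ 1 (subst (λ k → k * f x y ≡ k * units x y) (cong₂ (λ a b → 𝟙 a * 𝟙 (not b)) Sx Sy) (fwd x y))
    fyx≡0 : f y x ≡ 0
    fyx≡0 = trans (sym (+-identityʳ _)) (sym (subst (λ k → 0 ≡ k * f y x)
      (cong₂ (λ a b → 𝟙 (not a) * 𝟙 (not b)) Sy (cong not Sx)) (bwd y x)))

  paths : FlowMap → Node → List Node
  paths f = Search.search (Residual f)

  reachable : FlowMap → Cut
  reachable f v = nonEmpty (paths f v)

  Maximal : FlowMap → Set
  Maximal f = reachable f t ≡ false

  reachable-separates : ∀ f → Maximal f → Separates (reachable f)
  reachable-separates f max = Search.search-zero (Residual f) , max

  reachable-blocked : ∀ f → Blocked f (reachable f)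
  reachable-blocked f x y Sx Sy with Residual f x y in eq
  ... | false = refl
  ... | true  = contradiction (trans (sym (Search.search-closed (Residual f) x y Sx eq)) Sy) λ ()

  reachable-noInf : ∀ f → FitsAll f → NoInf (reachable f)
  reachable-noInf f fits x y Sx Sy =
    proj₁ (saturated (cap x y) {f x y} {f y x} (reachable-blocked f x y Sx Sy) (fits x y))

  blocked-maximal : ∀ S f → Separates S → Blocked f S → Maximal f
  blocked-maximal S f (S0 , St) blocked with reachable f t in r
  ... | false = refl
  ... | true  = contradiction (trans (sym (stays (proj₁ (Search.search-sound (Residual f) t r)))) St) λ ()
    where
    open Search (Residual f) using (Path; source; extend)
    stays : ∀ {v p} → Path v p → S v ≡ true
    stays source = S0
    stays (extend {u} {v} path e _) with S v in Sv
    ... | true  = refl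
    ... | false = contradiction (trans (sym e) (blocked u v (stays path) Sv)) λ ()

  -- The number j counts successful augmentations: each raises the value by exactly one and every
  -- entry by at most one.
  record Valid (j : ℕ) (f : FlowMap) : Set where
    field
      fits      : FitsAll f
      small     : ∀ x y → f x y ≤ j
      conserved : Conserved f
      value     : out f zero ≡ inn f zero + j

  round : FlowMap → FlowMap
  round f = augment (paths f t) f

  opaque
    maxFlow : FlowMap
    maxFlow = foldr (λ _ → round) (λ _ _ → 0) (allFin (suc m))

    maxFlow-unfold : maxFlow ≡ foldr (λ _ → round) (λ _ _ → 0) (allFin (suc m))
    maxFlow-unfold = refl

  -- The stored path to an unreached target is empty, and augmenting along it does nothing, so the
  -- rounds left on the clock are harmless.
  round-maximal : ∀ f → Maximal f → round f ≡ f
  round-maximal f max with paths f t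
  ... | [] = refl

  round-valid : ∀ {j} f → Valid j f → reachable f t ≡ true → Valid (suc j) (round f)
  round-valid {j} f valid r
    with augmented f (Valid.fits valid) cap-zero (proj₁ (Search.search-sound (Residual f) t r))
  ... | aug = record
    { fits      = Augmented.fits aug
    ; small     = λ x y → ≤-trans (Augmented.at-most aug x y) (s≤s (small x y))
    ; conserved = λ x x≢0 x≢t → +-cancelʳ-≡ (inn f x) _ _ (begin
        out g x + inn f x                  ≡⟨ +-identityʳ _ ⟨
        out g x + inn f x + 0              ≡⟨ cong (λ b → out g x + inn f x + 𝟙 b) (≢⇒≡ᶠ-false (x≢t ∘ sym)) ⟨
        out g x + inn f x + 𝟙 (t ≡ᶠ x)     ≡⟨ balance x ⟩
        out f x + inn g x + 𝟙 (zero ≡ᶠ x)  ≡⟨ cong (λ b → out f x + inn g x + 𝟙 b) (≢⇒≡ᶠ-false (x≢0 ∘ sym)) ⟩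
        out f x + inn g x + 0              ≡⟨ +-identityʳ _ ⟩
        out f x + inn g x                  ≡⟨ cong (_+ inn g x) (conserved x x≢0 x≢t) ⟩
        inn f x + inn g x                  ≡⟨ +-comm (inn f x) (inn g x) ⟩
        inn g x + inn f x                  ∎)
    ; value     = +-cancelʳ-≡ (inn f zero) _ _ (begin
        out g zero + inn f zero                     ≡⟨ +-identityʳ _ ⟨
        out g zero + inn f zero + 0                 ≡⟨ cong (λ b → out g zero + inn f zero + 𝟙 b) (≢⇒≡ᶠ-false t≢0) ⟨
        out g zero + inn f zero + 𝟙 (t ≡ᶠ zero)     ≡⟨ balance zero ⟩
        out f zero + inn g zero + 1                 ≡⟨ cong (λ k → k + inn g zero + 1) value ⟩
        inn f zero + j + inn g zero + 1             ≡⟨ shuffle (inn f zero) j (inn g zero) ⟩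
        inn g zero + suc j + inn f zero             ∎)
    }
    where
    open ≡-Reasoning
    open Valid valid
    g = round f
    balance = Shift.balance (Augmented.shift aug)
    shuffle : ∀ a j b → a + j + b + 1 ≡ b + suc j + a
    shuffle = solve-∀

  zero-valid : Valid 0 (λ _ _ → 0)
  zero-valid = record
    { fits      = λ x y → zero-fits (cap x y)
    ; small     = λ _ _ → z≤n
    ; conserved = λ _ _ _ → refl
    ; value     = sym (+-identityʳ _)
    }
    where
    zero-fits : ∀ c → Fits c 0
    zero-fits none = z≤n
    zero-fits unit = z≤n
    zero-fits inf  = tt

  opaque
    unfolding maxFlow

    -- Every round that finds a path raises the value by one, and the cut S keeps the value at most
    -- m, so one of the `suc m` rounds finds none.
    maxFlow-maximal : ∀ S → Separates S → NoInf S → forward S units ≤ m →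
      ∃[ j ] (j ≤ m × Valid j maxFlow × Maximal maxFlow)
    maxFlow-maximal S sep noInf S≤m with go (allFin (suc m))
      where
      value-≤ : ∀ {j f} → Valid j f → j ≤ m
      value-≤ {j} {f} valid = ≤-trans (+-cancelˡ-≤ (inn f zero) _ _
        (≤-trans (≤-reflexive (sym value)) (weak-duality S f sep noInf fits conserved))) S≤m
        where open Valid valid
      go : ∀ {A : Set} (us : List A) → let f = foldr (λ _ → round) (λ _ _ → 0) us in
        (∃[ j ] (j ≤ m × Valid j f × Maximal f)) ⊎ Valid (length us) f × length us ≤ m
      go [] = inj₂ (zero-valid , z≤n)
      go (u ∷ us) with go us
      ... | inj₁ (j , j≤m , valid , max) =
        inj₁ (subst (λ g → ∃[ j ] (j ≤ m × Valid j g × Maximal g)) (sym (round-maximal _ max)) (j , j≤m , valid , max))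
      ... | inj₂ (valid , l≤m) = grow _ refl
        where
        f : FlowMap
        f = foldr (λ _ → round) (λ _ _ → 0) us
        grow : ∀ b → reachable f t ≡ b →
          (∃[ j ] (j ≤ m × Valid j (round f) × Maximal (round f))) ⊎ Valid (suc (length us)) (round f) × suc (length us) ≤ m
        grow true  r = let valid′ = round-valid f valid r in inj₂ (valid′ , value-≤ valid′)
        grow false r = inj₁ (subst (λ g → ∃[ j ] (j ≤ m × Valid j g × Maximal g)) (sym (round-maximal f r)) (length us , l≤m , valid , r))
    ... | inj₁ x       = x
    ... | inj₂ (_ , l≤m) = contradiction (subst (_≤ m) (length-tabulate {n = suc m} (λ i → i)) l≤m) 1+n≰n

-- Compact representations as implications

⋃⁺ : ∀ {n} {x : Fin n} {p} ps → p ∈ˡ ps → x ∈ p → x ∈ ⋃ ps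
⋃⁺ (p ∷ ps) (here refl) x∈ = x∈p∪q⁺ (inj₁ x∈)
⋃⁺ (p ∷ ps) (there p∈)  x∈ = x∈p∪q⁺ (inj₂ (⋃⁺ ps p∈ x∈))

⋃⁻ : ∀ {n} {x : Fin n} ps → x ∈ ⋃ ps → ∃[ p ] (p ∈ˡ ps × x ∈ p)
⋃⁻ []       x∈ = contradiction x∈ ∉⊥
⋃⁻ (p ∷ ps) x∈ with x∈p∪q⁻ p (⋃ ps) x∈
... | inj₁ x∈p = p , here refl , x∈p
... | inj₂ x∈⋃ with ⋃⁻ ps x∈⋃
...   | q , q∈ , x∈q = q , there q∈ , x∈q

-- The ground set is extended by two elements, zero in every set and
-- suc zero in no set, which take the labels of U₀ and U∞.
extended : ∀ {n} → Subset n → Fin (2 + n) → Bool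
extended Y zero          = true
extended Y (suc zero)    = false
extended Y (suc (suc v)) = lookup Y v

ClosedUnder : ∀ {k} → (Fin k → Fin k → Bool) → (Fin k → Bool) → Set
ClosedUnder R S = ∀ e e′ → R e e′ ≡ true → S e ≡ true → S e′ ≡ true

module Representation {n} {L : Subset n → Set} (C : CompactRepresentation L) where
  open CompactRepresentation C

  label : Fin (2 + n) → Maybe Vertex
  label zero          = just zero
  label (suc zero)    = nothing
  label (suc (suc v)) = lookup block v

  -- Elements of U∞ imply everything, in particular the extra element that is in no set, while those
  -- of U₀ are implied by the one that is in every set. Closure alone thus encodes both forced
  -- blocks.
  labelImplies : Maybe Vertex → Maybe Vertex → Bool
  labelImplies nothing  _        = true
  labelImplies (just i) nothing  = false
  labelImplies (just i) (just j) = (i ≡ᶠ j) ∨ lookup (lookup graph i) j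

  implies : Fin (2 + n) → Fin (2 + n) → Bool
  implies e e′ = labelImplies (label e) (label e′)

  ∈-class⁺ : ∀ {c v} → lookup block v ≡ c → v ∈ class c
  ∈-class⁺ {c} {v} eq = lookup⇒[]= v _ (trans (lookup∘tabulate _ v) (dec-true (Maybe.≡-dec Fin._≟_ (lookup block v) c) eq))

  ∈-class⁻ : ∀ {c v} → v ∈ class c → lookup block v ≡ c
  ∈-class⁻ {c} {v} v∈ with Maybe.≡-dec Fin._≟_ (lookup block v) c | trans (sym (lookup∘tabulate (λ w → does (Maybe.≡-dec Fin._≟_ (lookup block w) c)) v)) ([]=⇒lookup v∈)
  ... | yes eq | _  = eq
  ... | no _   | ()

  ∈-⋃U⁺ : ∀ {Z j v} → j ∈ Z → lookup block v ≡ just j → v ∈ ⋃U Z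
  ∈-⋃U⁺ {Z} {j} j∈ eq = ⋃⁺ _ (∈-map⁺ U (∈-filter⁺ (_∈? Z) (∈-allFin j) j∈)) (∈-class⁺ eq)

  ∈-⋃U⁻ : ∀ {Z v} → v ∈ ⋃U Z → ∃[ j ] (j ∈ Z × lookup block v ≡ just j)
  ∈-⋃U⁻ {Z} v∈ with ⋃⁻ (List.map U (filter (_∈? Z) (allFin (suc b)))) v∈
  ... | p , p∈ , v∈p with ∈-map⁻ U p∈
  ...   | j , j∈ , refl = j , proj₂ (∈-filter⁻ (_∈? Z) {xs = allFin (suc b)} j∈) , ∈-class⁻ v∈p

  labelled : ∀ {Z} → zero ∈ Z → ∀ e → extended (⋃U Z) e ≡ true → ∃[ j ] (j ∈ Z × label e ≡ just j)
  labelled         0∈Z zero          _  = zero , 0∈Z , refl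
  labelled {Z = Z} 0∈Z (suc (suc v)) v∈ = ∈-⋃U⁻ {Z} (lookup⇒[]= v (⋃U Z) v∈)

  unlabelled : ∀ {Z} e {j} → label e ≡ just j → j ∈ Z → extended (⋃U Z) e ≡ true
  unlabelled     zero          _  _  = refl
  unlabelled {Z} (suc (suc v)) eq j∈ = []=⇒lookup (∈-⋃U⁺ {Z} j∈ eq)

  ⋃U-closed : ∀ {Z} → zero ∈ Z → NoOutgoingEdge Z → ClosedUnder implies (extended (⋃U Z))
  ⋃U-closed {Z} 0∈Z noEdge e e′ e⇒e′ e∈ with labelled {Z} 0∈Z e e∈
  ... | i , i∈ , eq with label e′ in eq′ | subst (λ c → labelImplies c _ ≡ true) eq e⇒e′
  ...   | just j | i⇒j with i ≡ᶠ j in i≡j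
  ...     | true  = unlabelled {Z} e′ eq′ (subst (_∈ Z) (≡ᶠ-true {i = i} i≡j) i∈)
  ...     | false with j ∈? Z
  ...       | yes j∈ = unlabelled {Z} e′ eq′ j∈
  ...       | no j∉  = contradiction (Equivalence.from T-≡ i⇒j) (noEdge i∈ j∉)

  -- `union-form` leaves zero out of J, whereas `closed` speaks of vertex sets with zero; adding
  -- zero to J accounts for the separate `U zero` in the union.
  L⇒closed : ∀ {Y} → L Y → ClosedUnder implies (extended Y)
  L⇒closed {Y} LY with union-form LY
  ... | J , _ , eq = subst (λ Y → ClosedUnder implies (extended Y)) (sym Y≡)
        (⋃U-closed 0∈Z (Equivalence.from (closed (⁅ zero ⁆ ∪ J) 0∈Z) (subst L Y≡ LY)))
    where
    Z = ⁅ zero ⁆ ∪ J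
    0∈Z : zero ∈ Z
    0∈Z = x∈p∪q⁺ (inj₁ (x∈⁅x⁆ zero))
    to : ∀ {v} → v ∈ U zero ∪ ⋃U J → v ∈ ⋃U Z
    to v∈ with x∈p∪q⁻ (U zero) (⋃U J) v∈
    ... | inj₁ v∈U₀ = ∈-⋃U⁺ {Z} 0∈Z (∈-class⁻ v∈U₀)
    ... | inj₂ v∈⋃  with ∈-⋃U⁻ {J} v∈⋃
    ...   | j , j∈ , eq = ∈-⋃U⁺ {Z} (x∈p∪q⁺ {p = ⁅ zero ⁆} (inj₂ j∈)) eq
    from : ∀ {v} → v ∈ ⋃U Z → v ∈ U zero ∪ ⋃U J
    from v∈ with ∈-⋃U⁻ {Z} v∈
    ... | j , j∈ , eq with x∈p∪q⁻ ⁅ zero ⁆ J j∈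
    ...   | inj₂ j∈J = x∈p∪q⁺ (inj₂ (∈-⋃U⁺ {J} j∈J eq))
    ...   | inj₁ j∈0 = x∈p∪q⁺ (inj₁ (∈-class⁺ (trans eq (cong just (x∈⁅y⁆⇒x≡y zero j∈0)))))
    Y≡ : Y ≡ ⋃U Z
    Y≡ = trans eq (⊆-antisym to from)

  -- Elements with the same label imply each other, so a closed set is the union of the classes that
  -- it meets.
  closed⇒L : ∀ {Y} → ClosedUnder implies (extended Y) → L Y
  closed⇒L {Y} Y-closed = subst L (⊆-antisym ⋃U⊆Y Y⊆⋃U) (Equivalence.to (closed Z 0∈Z) noEdge)
    where
    -- U₀ may be empty, so zero is included outright; the extra element zero then serves as its
    -- witness in `Z⁻`.
    meets : Vertex → Bool
    meets zero      = true
    meets j@(suc _) = does (nonempty? (U j ∩ Y))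
    Z : Subset (suc b)
    Z = tabulate meets
    0∈Z : zero ∈ Z
    0∈Z = lookup⇒[]= zero Z refl
    Z⁺ : ∀ {j v} → lookup block v ≡ just j → v ∈ Y → j ∈ Z
    Z⁺ {zero}  eq v∈ = 0∈Z
    Z⁺ {suc j} eq v∈ = lookup⇒[]= (suc j) Z (trans (lookup∘tabulate meets (suc j))
      (dec-true (nonempty? _) (_ , x∈p∩q⁺ (∈-class⁺ eq , v∈))))
    Z⁻ : ∀ {j} → j ∈ Z → ∃[ e ] (label e ≡ just j × extended Y e ≡ true)
    Z⁻ {zero}  j∈ = zero , refl , refl
    Z⁻ {suc j} j∈ with nonempty? (U (suc j) ∩ Y) | trans (sym (lookup∘tabulate meets (suc j))) ([]=⇒lookup j∈)
    ... | no _         | ()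
    ... | yes (v , v∈) | _ with x∈p∩q⁻ (U (suc j)) Y v∈
    ...   | v∈U , v∈Y = suc (suc v) , ∈-class⁻ v∈U , []=⇒lookup v∈Y
    equivalent : ∀ i c → c ≡ just i → labelImplies (just i) c ≡ true
    equivalent i _ refl rewrite ≡ᶠ-refl i = refl
    ⋃U⊆Y : ∀ {v} → v ∈ ⋃U Z → v ∈ Y
    ⋃U⊆Y {v} v∈ with ∈-⋃U⁻ {Z} v∈
    ... | j , j∈ , eq with Z⁻ j∈
    ...   | e , eq′ , e∈ = lookup⇒[]= v Y (Y-closed e (suc (suc v))
            (subst (λ c → labelImplies c (lookup block v) ≡ true) (sym eq′) (equivalent j _ eq)) e∈)
    Y⊆⋃U : ∀ {v} → v ∈ Y → v ∈ ⋃U Z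
    Y⊆⋃U {v} v∈ with lookup block v in eq
    ... | just j  = ∈-⋃U⁺ {Z} (Z⁺ eq v∈) eq
    ... | nothing = contradiction
      (Y-closed (suc (suc v)) (suc zero) (cong (λ c → labelImplies c nothing) eq) ([]=⇒lookup v∈)) λ ()
    noEdge : NoOutgoingEdge Z
    noEdge {i} {zero}  i∈ j∉ _    = j∉ 0∈Z
    -- `implies` relates elements, so the edge acts through some element w of its target class.
    noEdge {i} {suc j} i∈ j∉ edge with Z⁻ i∈ | nonempty (suc j) (λ ())
    ... | e , eq , e∈ | w , w∈ = j∉ (Z⁺ (∈-class⁻ w∈) (lookup⇒[]= w Y (Y-closed e (suc (suc w)) e⇒w e∈)))
      where
      e⇒w : implies e (suc (suc w)) ≡ true
      e⇒w rewrite eq | ∈-class⁻ w∈ with i ≡ᶠ suc j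
      ... | true  = refl
      ... | false = Equivalence.to T-≡ edge

  -- The set of all vertices has no outgoing edge. A minimizer of each function yields a cut without
  -- infinite edges, which bounds the maximum flow.
  inhabited : ∃[ Y ] L Y
  inhabited = ⋃U full , Equivalence.to (closed full ∈⊤) (λ _ j∉ → contradiction ∈⊤ j∉)

-- The flow network and its cuts

∑-split : ∀ k {l} (f : Fin (k + l) → ℕ) → ∑ f ≡ ∑ (λ i → f (i ↑ˡ l)) + ∑ (λ j → f (k ↑ʳ j))
∑-split zero    f = cong (_+ ∑ f) (sym (∑-zero {zero} (λ ())))
∑-split (suc k) {l} f = begin
  ∑ f                                                                 ≡⟨ ∑-suc f ⟩
  f zero + ∑ (f ∘ suc)                                                ≡⟨ cong (f zero +_) (∑-split k (f ∘ suc)) ⟩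
  f zero + (∑ (λ i → f (suc i ↑ˡ l)) + ∑ (λ j → f (suc k ↑ʳ j)))      ≡⟨ +-assoc (f zero) _ _ ⟨
  f zero + ∑ (λ i → f (suc i ↑ˡ l)) + ∑ (λ j → f (suc k ↑ʳ j))        ≡⟨ cong (_+ ∑ (λ j → f (suc k ↑ʳ j))) (∑-suc (λ i → f (i ↑ˡ l))) ⟨
  ∑ (λ i → f (i ↑ˡ l)) + ∑ (λ j → f (suc k ↑ʳ j))                     ∎
  where open ≡-Reasoning

∑-pick : ∀ {n} (a : Fin n) (f : Fin n → ℕ) → ∑ (λ i → 𝟙 (a ≡ᶠ i) * f i) ≡ f a
∑-pick a f = begin
  ∑ (λ i → 𝟙 (a ≡ᶠ i) * f i)     ≡⟨ ∑-cong move ⟩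
  ∑ (λ i → f a * 𝟙 (a ≡ᶠ i))     ≡⟨ *-∑ (f a) (λ i → 𝟙 (a ≡ᶠ i)) ⟨
  f a * ∑ (λ i → 𝟙 (a ≡ᶠ i))     ≡⟨ cong (f a *_) (∑-δ a) ⟩
  f a * 1                        ≡⟨ *-identityʳ (f a) ⟩
  f a                            ∎
  where
  open ≡-Reasoning
  move : ∀ i → 𝟙 (a ≡ᶠ i) * f i ≡ f a * 𝟙 (a ≡ᶠ i)
  move i with a ≡ᶠ i in eq
  ... | false = sym (*-zeroʳ (f a))
  ... | true  = trans (+-identityʳ (f i)) (trans (cong f (sym (≡ᶠ-true eq))) (sym (*-identityʳ (f a))))

∣△∣-∑ : ∀ {n} (X Y : Subset n) → ∣ X △ Y ∣ ≡ ∑ (λ v → 𝟙 (lookup X v xor lookup Y v))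
∣△∣-∑ []      []      = sym (∑-zero {zero} (λ ()))
∣△∣-∑ (x ∷ X) (y ∷ Y) = trans (go x y) (sym (∑-suc _))
  where
  go : ∀ x y → ∣ (x ∷ X) △ (y ∷ Y) ∣ ≡ 𝟙 (x xor y) + ∑ (λ v → 𝟙 (lookup X v xor lookup Y v))
  go true  true  = ∣△∣-∑ X Y
  go true  false = cong suc (∣△∣-∑ X Y)
  go false true  = cong suc (∣△∣-∑ X Y)
  go false false = ∣△∣-∑ X Y

-- Two copies of the extended ground set.  A cut without edges of infinite
-- capacity is a pair of sets closed under R₀ and R₁, and its capacity is the
-- size of their symmetric difference.
module DoubleNetwork {n} (R₀ R₁ : Fin (2 + n) → Fin (2 + n) → Bool) (R₀-zero : R₀ zero zero ≡ true) where

  k : ℕ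
  k = 2 + n

  -- Infinite links tie the copies of each extra element together: both copies of zero lie on the
  -- source side and both copies of `suc zero` on the target side.
  link : Fin k → Capacity
  link zero          = inf
  link (suc zero)    = inf
  link (suc (suc _)) = unit

  cross : Fin k → Fin k → Capacity
  cross e e′ = if e ≡ᶠ e′ then link e else none

  capD : Fin k ⊎ Fin k → Fin k ⊎ Fin k → Capacity
  capD (inj₁ e) (inj₁ e′) = if R₀ e e′ then inf else none
  capD (inj₁ e) (inj₂ e′) = cross e e′
  capD (inj₂ e) (inj₁ e′) = cross e e′
  capD (inj₂ e) (inj₂ e′) = if R₁ e e′ then inf else none

  cap : Fin (k + k) → Fin (k + k) → Capacity
  cap x y = capD (splitAt k x) (splitAt k y)

  left right : Fin k → Fin (k + k)
  left e  = e ↑ˡ k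
  right e = k ↑ʳ e

  -- The loop at the source along which every augmentation starts.
  cap-zero : cap zero zero ≡ inf
  cap-zero = cong (if_then inf else none) R₀-zero

  target : Fin (k + k)
  target = suc zero

  open FordFulkerson cap cap-zero target (λ ()) public

  cap-ll : ∀ e e′ → cap (left e) (left e′) ≡ (if R₀ e e′ then inf else none)
  cap-ll e e′ = cong₂ capD (splitAt-↑ˡ k e k) (splitAt-↑ˡ k e′ k)

  cap-lr : ∀ e e′ → cap (left e) (right e′) ≡ cross e e′
  cap-lr e e′ = cong₂ capD (splitAt-↑ˡ k e k) (splitAt-↑ʳ k k e′)

  cap-rl : ∀ e e′ → cap (right e) (left e′) ≡ cross e e′
  cap-rl e e′ = cong₂ capD (splitAt-↑ʳ k k e) (splitAt-↑ˡ k e′ k)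

  cap-rr : ∀ e e′ → cap (right e) (right e′) ≡ (if R₁ e e′ then inf else none)
  cap-rr e e′ = cong₂ capD (splitAt-↑ʳ k k e) (splitAt-↑ʳ k k e′)

  module _ (S : Cut) where

    same-copy : ∀ {x} y b → cap x y ≡ (if b then inf else none) → crossing S units x y ≡ 0
    same-copy {x} y b eq = trans (cong (λ c → 𝟙 (S x) * 𝟙 (not (S y)) * 𝟙 (isUnit c)) eq)
      (trans (cong (𝟙 (S x) * 𝟙 (not (S y)) *_) (go b)) (*-zeroʳ (𝟙 (S x) * 𝟙 (not (S y)))))
      where
      go : ∀ b → 𝟙 (isUnit (if b then inf else none)) ≡ 0
      go true  = refl
      go false = refl

    other-copy : ∀ e (g : Fin k → Fin (k + k)) x → (∀ e′ → cap x (g e′) ≡ cross e e′) →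
      ∑ (λ e′ → crossing S units x (g e′)) ≡ 𝟙 (S x) * 𝟙 (not (S (g e))) * 𝟙 (isUnit (link e))
    other-copy e g x eq = trans (∑-cong term)
      (∑-pick e (λ e′ → 𝟙 (S x) * 𝟙 (not (S (g e′))) * 𝟙 (isUnit (link e))))
      where
      term : ∀ e′ → crossing S units x (g e′) ≡ 𝟙 (e ≡ᶠ e′) * (𝟙 (S x) * 𝟙 (not (S (g e′))) * 𝟙 (isUnit (link e)))
      term e′ rewrite eq e′ with e ≡ᶠ e′
      ... | true  = sym (+-identityʳ _)
      ... | false = *-zeroʳ (𝟙 (S x) * 𝟙 (not (S (g e′))))

    -- Edges within a copy and links of the extra elements are never of unit capacity. Of the two
    -- opposite links of an element of V, exactly one crosses if its copies are separated, and none
    -- otherwise.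
    forward-units : forward S units ≡
      ∑ (λ v → 𝟙 (S (left (suc (suc v))) xor S (right (suc (suc v)))))
    forward-units = begin
      forward S units                                                   ≡⟨ ∑-split k _ ⟩
      ∑ (λ e → ∑ (c (left e))) + ∑ (λ e → ∑ (c (right e)))              ≡⟨ cong₂ _+_ (∑-cong from-left) (∑-cong from-right) ⟩
      ∑ (λ e → L e * 𝟙 (isUnit (link e))) + ∑ (λ e → R e * 𝟙 (isUnit (link e)))
                                                                        ≡⟨ ∑-+ _ _ ⟨
      ∑ (λ e → L e * 𝟙 (isUnit (link e)) + R e * 𝟙 (isUnit (link e)))   ≡⟨ trans (∑-suc _) (cong₂ _+_ (vanish zero refl) (trans (∑-suc _) (cong₂ _+_ (vanish (suc zero) refl) (∑-cong unit-link)))) ⟩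
      ∑ (λ v → 𝟙 (S (left (suc (suc v))) xor S (right (suc (suc v)))))  ∎
      where
      open ≡-Reasoning
      c = crossing S units
      L R : Fin k → ℕ
      L e = 𝟙 (S (left e)) * 𝟙 (not (S (right e)))
      R e = 𝟙 (S (right e)) * 𝟙 (not (S (left e)))
      from-left : ∀ e → ∑ (c (left e)) ≡ L e * 𝟙 (isUnit (link e))
      from-left e = trans (∑-split k (c (left e))) (cong₂ _+_
        (∑-zero (λ e′ → same-copy (left e′) (R₀ e e′) (cap-ll e e′)))
        (other-copy e right (left e) (cap-lr e)))
      from-right : ∀ e → ∑ (c (right e)) ≡ R e * 𝟙 (isUnit (link e))
      from-right e = trans (∑-split k (c (right e))) (trans (cong₂ _+_
        (other-copy e left (right e) (cap-rl e))
        (∑-zero (λ e′ → same-copy (right e′) (R₁ e e′) (cap-rr e e′)))) (+-identityʳ _))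
      vanish : ∀ e → isUnit (link e) ≡ false → L e * 𝟙 (isUnit (link e)) + R e * 𝟙 (isUnit (link e)) ≡ 0
      vanish e eq rewrite eq = cong₂ _+_ (*-zeroʳ (L e)) (*-zeroʳ (R e))
      unit-link : ∀ v → let e = suc (suc v) in L e * 1 + R e * 1 ≡ 𝟙 (S (left e) xor S (right e))
      unit-link v with S (left (suc (suc v))) | S (right (suc (suc v)))
      ... | true  | true  = refl
      ... | true  | false = refl
      ... | false | true  = refl
      ... | false | false = refl

  module _ {Y₀ Y₁ : Subset n} where

    cut : Cut
    cut x = [ extended Y₀ , extended Y₁ ]′ (splitAt k x)

    cut-separates : Separates cut
    cut-separates = refl , refl

    cut-noInf : ClosedUnder R₀ (extended Y₀) → ClosedUnder R₁ (extended Y₁) → NoInf cut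
    cut-noInf closed₀ closed₁ x y = go (splitAt k x) (splitAt k y)
      where
      S = [ extended Y₀ , extended Y₁ ]′
      cross-noInf : ∀ e e′ → cross e e′ ≡ inf → e ≡ e′ × ∀ (Y Y′ : Subset n) → extended Y e ≡ extended Y′ e
      cross-noInf e e′ eq with e ≡ᶠ e′ in same
      cross-noInf zero       e′ eq | true = ≡ᶠ-true same , λ _ _ → refl
      cross-noInf (suc zero) e′ eq | true = ≡ᶠ-true same , λ _ _ → refl
      impossible : ∀ {A : Set} {b} → b ≡ true → b ≡ false → A
      impossible refl ()
      related : ∀ b → (if b then inf else none) ≡ inf → b ≡ true
      related true _ = refl
      go : ∀ x y → S x ≡ true → S y ≡ false → capD x y ≢ inf
      go (inj₁ e) (inj₁ e′) Sx Sy eq = impossible (closed₀ e e′ (related (R₀ e e′) eq) Sx) Sy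
      go (inj₂ e) (inj₂ e′) Sx Sy eq = impossible (closed₁ e e′ (related (R₁ e e′) eq) Sx) Sy
      go (inj₁ e) (inj₂ e′) Sx Sy eq with cross-noInf e e′ eq
      ... | refl , same = impossible (trans (same Y₁ Y₀) Sx) Sy
      go (inj₂ e) (inj₁ e′) Sx Sy eq with cross-noInf e e′ eq
      ... | refl , same = impossible (trans (same Y₀ Y₁) Sx) Sy

    cut-value : forward cut units ≡ ∣ Y₀ △ Y₁ ∣
    cut-value = trans (forward-units cut) (trans (∑-cong term) (sym (∣△∣-∑ Y₀ Y₁)))
      where
      term : ∀ v → 𝟙 (cut (left (suc (suc v))) xor cut (right (suc (suc v)))) ≡ 𝟙 (lookup Y₀ v xor lookup Y₁ v)
      term v = cong₂ (λ a b → 𝟙 (a xor b))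
        (cong [ extended Y₀ , extended Y₁ ]′ (splitAt-↑ˡ k (suc (suc v)) k))
        (cong [ extended Y₀ , extended Y₁ ]′ (splitAt-↑ʳ k k (suc (suc v))))

  module _ (S : Cut) (sep : Separates S) (noInf : NoInf S) where

    left-set right-set : Subset n
    left-set  = tabulate (λ v → S (left (suc (suc v))))
    right-set = tabulate (λ v → S (right (suc (suc v))))

    preserved : ∀ x y → cap x y ≡ inf → S x ≡ true → S y ≡ true
    preserved x y eq Sx with S y in Sy
    ... | true  = refl
    ... | false = contradiction eq (noInf x y Sx Sy)

    left-extended : ∀ e → extended left-set e ≡ S (left e)
    left-extended zero          = sym (proj₁ sep)
    left-extended (suc zero)    = sym (proj₂ sep)
    left-extended (suc (suc v)) = lookup∘tabulate _ v

    -- `Separates` speaks of the left copies of the extra elements only; their infinite links carry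
    -- it over to the right copies.
    right-extended : ∀ e → extended right-set e ≡ S (right e)
    right-extended zero          = sym (preserved (left zero) (right zero) (cap-lr zero zero) (proj₁ sep))
    right-extended (suc zero)    with S (right (suc zero)) in eq
    ... | false = refl
    ... | true  = trans (sym (proj₂ sep)) (preserved (right (suc zero)) (left (suc zero)) (cap-rl (suc zero) (suc zero)) eq)
    right-extended (suc (suc v)) = lookup∘tabulate _ v

    left-closed : ClosedUnder R₀ (extended left-set)
    left-closed e e′ r e∈ = trans (left-extended e′) (preserved (left e) (left e′)
      (trans (cap-ll e e′) (cong (if_then inf else none) r)) (trans (sym (left-extended e)) e∈))

    right-closed : ClosedUnder R₁ (extended right-set)
    right-closed e e′ r e∈ = trans (right-extended e′) (preserved (right e) (right e′)
      (trans (cap-rr e e′) (cong (if_then inf else none) r)) (trans (sym (right-extended e)) e∈))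

    sets-value : ∣ left-set △ right-set ∣ ≡ forward S units
    sets-value = trans (∣△∣-∑ left-set right-set) (trans
      (∑-cong (λ v → cong₂ (λ a b → 𝟙 (a xor b)) (lookup∘tabulate (λ v → S (left (suc (suc v)))) v)
                                                  (lookup∘tabulate (λ v → S (right (suc (suc v)))) v)))
      (sym (forward-units S)))

  module _ (f : FlowMap) (fits : FitsAll f) (conserved : Conserved f) (max : Maximal f) where

    private
      S     = reachable f
      sep   = reachable-separates f max
      noInf = reachable-noInf f fits

    minimizer₀ minimizer₁ : Subset n
    minimizer₀ = left-set S sep noInf
    minimizer₁ = right-set S sep noInf

    minimizer₀-closed : ClosedUnder R₀ (extended minimizer₀)
    minimizer₀-closed = left-closed S sep noInf

    minimizer₁-closed : ClosedUnder R₁ (extended minimizer₁)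
    minimizer₁-closed = right-closed S sep noInf

    minimal : ∀ Y₀ Y₁ → ClosedUnder R₀ (extended Y₀) → ClosedUnder R₁ (extended Y₁) →
      ∣ minimizer₀ △ minimizer₁ ∣ ≤ ∣ Y₀ △ Y₁ ∣
    minimal Y₀ Y₁ closed₀ closed₁ = +-cancelˡ-≤ (inn f zero) _ _ (begin
      inn f zero + ∣ minimizer₀ △ minimizer₁ ∣  ≡⟨ cong (inn f zero +_) (sets-value S sep noInf) ⟩
      inn f zero + forward S units              ≡⟨ blocked-value S f sep (reachable-blocked f) fits conserved ⟨
      out f zero                                ≤⟨ weak-duality cut f (cut-separates {Y₀} {Y₁}) (cut-noInf closed₀ closed₁) fits conserved ⟩
      inn f zero + forward cut units            ≡⟨ cong (inn f zero +_) cut-value ⟩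
      inn f zero + ∣ Y₀ △ Y₁ ∣                  ∎)
      where open ≤-Reasoning

-- Choosing a set between two minimizers

∣△∣-triangle : ∀ {n} (X Y Z : Subset n) → ∣ Y △ Z ∣ ≤ ∣ X △ Y ∣ + ∣ X △ Z ∣
∣△∣-triangle X Y Z = begin
  ∣ Y △ Z ∣                                                  ≡⟨ ∣△∣-∑ Y Z ⟩
  ∑ (λ v → 𝟙 (lookup Y v xor lookup Z v))                    ≤⟨ ∑-mono (λ v → go (lookup X v) (lookup Y v) (lookup Z v)) ⟩
  ∑ (λ v → 𝟙 (lookup X v xor lookup Y v) + 𝟙 (lookup X v xor lookup Z v))
                                                             ≡⟨ ∑-+ _ _ ⟩
  _                                                          ≡⟨ cong₂ _+_ (∣△∣-∑ X Y) (∣△∣-∑ X Z) ⟨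
  ∣ X △ Y ∣ + ∣ X △ Z ∣                                      ∎
  where
  open ≤-Reasoning
  go : ∀ x y z → 𝟙 (y xor z) ≤ 𝟙 (x xor y) + 𝟙 (x xor z)
  go true  true  true  = z≤n
  go true  true  false = ≤-refl
  go true  false true  = ≤-refl
  go true  false false = z≤n
  go false true  true  = z≤n
  go false true  false = ≤-refl
  go false false true  = ≤-refl
  go false false false = z≤n

choose : ∀ {n} → Bool → Bool → ℕ × ℕ × Subset n → ℕ × ℕ × Subset (suc n)
choose a b (p , q , X) =
  if a xor b then (if isPos p then (pred p , q , b ∷ X) else (p , pred q , a ∷ X))
  else (p , q , a ∷ X)

-- Follows B where A and B differ as long as the budget p lasts, and A
-- otherwise, charging those elements to q.
select : ∀ {n} → Subset n → Subset n → ℕ → ℕ → ℕ × ℕ × Subset n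
select []      []      p q = p , q , []
select (a ∷ A) (b ∷ B) p q = choose a b (select A B p q)

record Selected {n} (A B : Subset n) (p q : ℕ) (s : ℕ × ℕ × Subset n) : Set where
  field
    p-left : proj₁ s ≡ p ∸ ∣ A △ B ∣
    q-left : proj₁ (proj₂ s) ≡ q ∸ (∣ A △ B ∣ ∸ p)
    dist-A : ∣ proj₂ (proj₂ s) △ A ∣ ≡ p ⊓ ∣ A △ B ∣
    dist-B : ∣ proj₂ (proj₂ s) △ B ∣ ≡ ∣ A △ B ∣ ∸ p

select-correct : ∀ {n} (A B : Subset n) p q → Selected A B p q (select A B p q)
select-correct [] [] p q = record
  { p-left = refl ; q-left = sym (cong (q ∸_) (0∸n≡0 p)) ; dist-A = sym (⊓-zeroʳ p) ; dist-B = sym (0∸n≡0 p) }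
select-correct (a ∷ A) (b ∷ B) p q with select A B p q | select-correct A B p q
... | p′ , q′ , X | record { p-left = refl ; q-left = refl ; dist-A = dA ; dist-B = dB } = go a b
  where
  δ = ∣ A △ B ∣

  ⊓-suc : ∀ p δ → isPos (p ∸ δ) ≡ true → suc (p ⊓ δ) ≡ p ⊓ suc δ
  ⊓-suc (suc p) zero    _ = cong suc (sym (⊓-zeroʳ p))
  ⊓-suc (suc p) (suc δ) h = cong suc (⊓-suc p δ h)
  ⊓-same : ∀ p δ → isPos (p ∸ δ) ≡ false → p ⊓ δ ≡ p ⊓ suc δ
  ⊓-same zero    δ       _ = refl
  ⊓-same (suc p) (suc δ) h = cong suc (⊓-same p δ h)
  ∸-same : ∀ p δ → isPos (p ∸ δ) ≡ true → δ ∸ p ≡ suc δ ∸ p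
  ∸-same (suc p) zero    _ = sym (0∸n≡0 p)
  ∸-same (suc p) (suc δ) h = ∸-same p δ h
  ∸-suc : ∀ p δ → isPos (p ∸ δ) ≡ false → suc (δ ∸ p) ≡ suc δ ∸ p
  ∸-suc zero    δ       _ = refl
  ∸-suc (suc p) (suc δ) h = ∸-suc p δ h
  zero-same : ∀ p δ → isPos (p ∸ δ) ≡ false → p ∸ δ ≡ p ∸ suc δ
  zero-same zero    δ       _ = trans (0∸n≡0 δ) (sym (0∸n≡0 (suc δ)))
  zero-same (suc p) (suc δ) h = zero-same p δ h

  Goal : Bool → Bool → ℕ × ℕ × Subset _ → Set
  Goal a b = Selected (a ∷ A) (b ∷ B) p q

  follow-B : isPos (p ∸ δ) ≡ true → pred (p ∸ δ) ≡ p ∸ suc δ × q ∸ (δ ∸ p) ≡ q ∸ (suc δ ∸ p)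
  follow-B h = pred[m∸n]≡m∸[1+n] p δ , cong (q ∸_) (∸-same p δ h)

  follow-A : isPos (p ∸ δ) ≡ false → p ∸ δ ≡ p ∸ suc δ × pred (q ∸ (δ ∸ p)) ≡ q ∸ (suc δ ∸ p)
  follow-A h = zero-same p δ h , trans (pred[m∸n]≡m∸[1+n] q (δ ∸ p)) (cong (q ∸_) (∸-suc p δ h))

  go : ∀ a b → Goal a b (choose a b (p ∸ δ , q ∸ (δ ∸ p) , X))
  go true  true  = record { p-left = refl ; q-left = refl ; dist-A = dA ; dist-B = dB }
  go false false = record { p-left = refl ; q-left = refl ; dist-A = dA ; dist-B = dB }
  go true  false with isPos (p ∸ δ) in h
  ... | true  = record { p-left = proj₁ (follow-B h) ; q-left = proj₂ (follow-B h)
                       ; dist-A = trans (cong suc dA) (⊓-suc p δ h) ; dist-B = trans dB (∸-same p δ h) }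
  ... | false = record { p-left = proj₁ (follow-A h) ; q-left = proj₂ (follow-A h)
                       ; dist-A = trans dA (⊓-same p δ h) ; dist-B = trans (cong suc dB) (∸-suc p δ h) }
  go false true  with isPos (p ∸ δ) in h
  ... | true  = record { p-left = proj₁ (follow-B h) ; q-left = proj₂ (follow-B h)
                       ; dist-A = trans (cong suc dA) (⊓-suc p δ h) ; dist-B = trans dB (∸-same p δ h) }
  ... | false = record { p-left = proj₁ (follow-A h) ; q-left = proj₂ (follow-A h)
                       ; dist-A = trans dA (⊓-same p δ h) ; dist-B = trans (cong suc dB) (∸-suc p δ h) }

-- In `answer`, q starts one above the allowed distance, so it stays positive exactly when the
-- number of elements charged to it is within that distance.
answerOf : ∀ {n} → ℕ × ℕ × Subset n → Maybe (Subset n)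
answerOf (_ , q , X) = if isPos q then just X else nothing

-- The budget β is a unary truncation of d.
answer : ∀ {n} → Subset n → Subset n → ℕ → Maybe (Subset n)
answer A B β = answerOf (select A B β (suc β))

-- If β differs from d, both are at least K, and for K at least the number of elements neither
-- restricts any distance. No minimum with K is taken, as β may overshoot K.
Truncates : ℕ → ℕ → ℕ → Set
Truncates K d β = β ≡ d ⊎ K ≤ β × K ≤ d

module _ (I : RSMInstance 2) where
  open RSMInstance I

  relation : Fin 2 → Fin (2 + n) → Fin (2 + n) → Bool
  relation i = Representation.implies (compact i)

  answer-correct : ∀ {K β} → n ≤ K → Truncates K d β → ∀ Y₀ Y₁ →
    ClosedUnder (relation zero) (extended Y₀) → ClosedUnder (relation (suc zero)) (extended Y₁) →
    (∀ Y₀′ Y₁′ → ClosedUnder (relation zero) (extended Y₀′) → ClosedUnder (relation (suc zero)) (extended Y₁′) →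
      ∣ Y₀ △ Y₁ ∣ ≤ ∣ Y₀′ △ Y₁′ ∣) →
    Answers (answer Y₀ Y₁ β)
  answer-correct {K} {β} n≤K trunc Y₀ Y₁ closed₀ closed₁ minimal
    with select Y₀ Y₁ β (suc β) | select-correct Y₀ Y₁ β (suc β)
  ... | _ , q , X | record { q-left = q≡ ; dist-A = dA ; dist-B = dB } = go q q≡ trunc
    where
    δ = ∣ Y₀ △ Y₁ ∣
    δ≤K : δ ≤ K
    δ≤K = ≤-trans (∣p∣≤n (Y₀ △ Y₁)) n≤K

    robust : ∣ X △ Y₀ ∣ ≤ d → ∣ X △ Y₁ ∣ ≤ d → Robust X
    robust d₀ d₁ zero       = Y₀ , Representation.closed⇒L (compact zero) closed₀ , d₀
    robust d₀ d₁ (suc zero) = Y₁ , Representation.closed⇒L (compact (suc zero)) closed₁ , d₁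

    go : ∀ q → q ≡ suc β ∸ (δ ∸ β) → Truncates K d β → Answers (if isPos q then just X else nothing)
    go (suc q) q≡ (inj₁ refl) = robust
      (≤-trans (≤-reflexive dA) (m⊓n≤m d δ))
      (≤-trans (≤-reflexive dB) (s≤s⁻¹ (m<n∸o⇒o<n q≡)))
      where
      m<n∸o⇒o<n : suc q ≡ suc d ∸ (δ ∸ d) → δ ∸ d < suc d
      m<n∸o⇒o<n eq = ≰⇒> λ le → contradiction (trans eq (m≤n⇒m∸n≡0 le)) λ ()
    go (suc q) q≡ (inj₂ (K≤β , K≤d)) = robust
      (≤-trans (≤-reflexive dA) (≤-trans (m⊓n≤n β δ) (≤-trans δ≤K K≤d)))
      (≤-trans (≤-reflexive (trans dB (m≤n⇒m∸n≡0 (≤-trans δ≤K K≤β)))) z≤n)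
    go zero q≡ (inj₂ (K≤β , K≤d)) =
      contradiction (trans q≡ (cong (suc β ∸_) (m≤n⇒m∸n≡0 (≤-trans δ≤K K≤β)))) λ ()
    go zero q≡ (inj₁ refl) (X* , robust*) with robust* zero | robust* (suc zero)
    ... | Y₀′ , min₀ , d₀ | Y₁′ , min₁ , d₁ = <⇒≱ 2d<δ (begin
      δ                              ≤⟨ minimal Y₀′ Y₁′ (Representation.L⇒closed (compact zero) min₀)
                                          (Representation.L⇒closed (compact (suc zero)) min₁) ⟩
      ∣ Y₀′ △ Y₁′ ∣                  ≤⟨ ∣△∣-triangle X* Y₀′ Y₁′ ⟩
      ∣ X* △ Y₀′ ∣ + ∣ X* △ Y₁′ ∣    ≤⟨ +-mono-≤ d₀ d₁ ⟩
      d + d                          ∎)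
      where
      open ≤-Reasoning
      -- That q is used up means that more than d elements were charged to it, in addition to the d
      -- elements moved to the other minimizer.
      2d<δ : d + d < δ
      2d<δ = m≤n∸o⇒m+o≤n (m∸n≡0⇒m≤n (sym q≡))
        where
        m≤n∸o⇒m+o≤n : suc d ≤ δ ∸ d → suc d + d ≤ δ
        m≤n∸o⇒m+o≤n le = m≤o∸n⇒m+n≤o (suc d) (<⇒≤ (≰⇒> λ δ≤d → contradiction (≤-trans le (≤-reflexive (m≤n⇒m∸n≡0 δ≤d))) λ ())) le

-- The programs

-- The environment is v, u, the list of nodes, the capacities and the flow. A capacity is `inf` if
-- its code has a second entry.
residualₚ : Prog
residualₚ = if (tl c) ⊤ₚ (if c (if q ⊤ₚ (if p nil ⊤ₚ)) (if q ⊤ₚ nil))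
  where
  c = # 3 ! # 1 ! # 0
  p = rest 4 ! # 1 ! # 0
  q = rest 4 ! # 0 ! # 1

stepₚ : Prog
stepₚ = mapₚ (# 2) (if (P ! # 0) (P ! # 0) (foldₚ (# 3) nil
  (if (# 4 ! # 0) (if (rest 6 ! # 0 ! # 2) (# 2 ⊗ # 4 ! # 0) (# 1)) (# 1))))
  where P = # 2

searchₚ : Prog
searchₚ = foldₚ (# 0) (mapₚ (# 0) (if (# 0) nil (# 0 ⊗ nil))) stepₚ

reachₚ : Prog
reachₚ = # 0 ⊗ mapₚ (# 0) (mapₚ (# 1) residualₚ) >>> searchₚ

pushₚ : Prog
pushₚ = if (rest 3 ! # 1 ! # 0)
  (mapₚ (# 2) (mapₚ (# 3) (if (# 3 == # 1) (if (# 2 == # 0) (tl fxy) fxy) fxy)))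
  (mapₚ (# 2) (mapₚ (# 3) (if (# 2 == # 1) (if (# 3 == # 0) (nil ⊗ fxy) fxy) fxy)))
  where fxy = rest 5 ! # 1 ! # 0

augmentₚ : Prog
augmentₚ = tl (foldₚ (# 0) (nil ⊗ rest 2) (# 0 ⊗ (hd (# 1) ⊗ # 0 ⊗ # 3 ⊗ tl (# 1) >>> pushₚ)))

-- The target is node one, so its path is the second entry of the result of `reachₚ`.
roundₚ : Prog
roundₚ = hd (tl (# 0 ⊗ # 1 ⊗ rest 2 >>> reachₚ)) ⊗ # 0 ⊗ rest 2 >>> augmentₚ

maxFlowₚ : Prog
maxFlowₚ = foldₚ (# 0) (mapₚ (# 0) (mapₚ (# 1) nil)) (# 2 ⊗ rest 3 ⊗ # 1 >>> roundₚ)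

-- Codes of networks and values of the programs

matrix : ∀ {m n} → (Fin m → Fin n → Tree) → Tree
matrix τ = tab (λ i → tab (τ i))

matrix-cong : ∀ {m n} {σ τ : Fin m → Fin n → Tree} → (∀ i j → σ i j ≡ τ i j) → matrix σ ≡ matrix τ
matrix-cong eq = tab-cong (λ i → tab-cong (eq i))

-- These trees are also binary numerals: 0, 1, and n + 3 digits 1. The same matrix thus serves the
-- search with symbolic capacities and the instance of `MaximumFlow`.
codeCapacity : ℕ → Capacity → Tree
codeCapacity n none = nil
codeCapacity n unit = nil ∙ nil
codeCapacity n inf  = codeUnary (3 + n)

codePath : ∀ {m} → List (Fin m) → Tree
codePath = codeList codeFin

isCons-codePath : ∀ {m} (p : List (Fin m)) → isCons (codePath p) ≡ nonEmpty p
isCons-codePath []      = refl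
isCons-codePath (_ ∷ _) = refl

isCons-codeUnary : ∀ k → isCons (codeUnary k) ≡ isPos k
isCons-codeUnary zero    = refl
isCons-codeUnary (suc _) = refl

tail-codeUnary : ∀ k → tail (codeUnary k) ≡ codeUnary (pred k)
tail-codeUnary zero    = refl
tail-codeUnary (suc _) = refl

codeList-map : ∀ {A : Set} (code : A → Tree) xs → codeList code xs ≡ list (List.map code xs)
codeList-map code []       = refl
codeList-map code (x ∷ xs) = cong (code x ∙_) (codeList-map code xs)

module _ {K : ℕ} where

  !!-matrix : ∀ {xs i j ρ m n} {τ : Fin m → Fin n → Tree} {x y} → K ∣ ρ ⊢ xs ⟶ matrix τ →
    K ∣ ρ ⊢ i ⟶ codeFin x → K ∣ ρ ⊢ j ⟶ codeFin y → m ≤ K → n ≤ K →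
    K ∣ ρ ⊢ xs ! i ! j ⟶ τ x y
  !!-matrix xs⟶ i⟶ j⟶ m≤K n≤K = !-tab (!-tab xs⟶ i⟶ m≤K) j⟶ n≤K

  ==-fin : ∀ {s t ρ m} {i j : Fin m} → m ≤ K → K ∣ ρ ⊢ s ⟶ codeFin i → K ∣ ρ ⊢ t ⟶ codeFin j →
    K ∣ ρ ⊢ s == t ⟶ codeBool (i ≡ᶠ j)
  ==-fin {i = i} {j} m≤K s⟶ t⟶ = ==-unary s⟶ t⟶ (bound′ i) (bound′ j)
    where
    bound′ : ∀ i → toℕ i ≤ K
    bound′ i = ≤-trans (<⇒≤ (toℕ<n i)) m≤K

  module Programs {m} (m≤K : suc m ≤ K) (cap : Fin (suc m) → Fin (suc m) → Capacity) (w : ℕ) where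
    open Augment cap

    idx caps : Tree
    idx  = tab (codeFin {suc m})
    caps = matrix (λ u v → codeCapacity w (cap u v))

    residual-value : ∀ c q p x y → isCons x ≡ p → isCons y ≡ q →
      (if isCons (tail (codeCapacity w c)) then nil ∙ nil else
        (if isCons (codeCapacity w c) then (if isCons y then nil ∙ nil else (if isCons x then nil else nil ∙ nil))
         else (if isCons y then nil ∙ nil else nil))) ≡ codeBool (residual c p q)
    residual-value none true  p     x y refl e rewrite e = refl
    residual-value none false p     x y refl e rewrite e = refl
    residual-value unit true  p     x y refl e rewrite e = refl
    residual-value unit false true  x y e′ e rewrite e | e′ = refl
    residual-value unit false false x y e′ e rewrite e | e′ = refl
    residual-value inf  q p x y _ _ = refl

    -- Only signs of flow entries are read, so they may be in unary, as produced by `maxFlowₚ`, or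
    -- in binary, as in a solution of `MaximumFlow`.
    module _ {τ : Node → Node → Tree} {f : FlowMap} (τ≈f : ∀ u v → isCons (τ u v) ≡ isPos (f u v)) where
      open Search (Residual f) using (Paths; search; search-unfold; step; start; via)

      residual-⟶ : ∀ u v → K ∣ codeFin v ∙ codeFin u ∙ idx ∙ caps ∙ matrix τ ⊢ residualₚ ⟶ codeBool (Residual f u v)
      residual-⟶ u v = ⟶-cong (residual-value (cap u v) (isPos (f v u)) (isPos (f u v)) (τ u v) (τ v u) (τ≈f u v) (τ≈f v u))
        (⟶-if (⟶-tl c⟶) ⟨ refl ⟩ (⟶-if c⟶ (⟶-if q⟶ ⟨ refl ⟩ (⟶-if p⟶ ⟨ refl ⟩ ⟨ refl ⟩)) (⟶-if q⟶ ⟨ refl ⟩ ⟨ refl ⟩)))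
        where
        c⟶ = !!-matrix {xs = # 3} {# 1} {# 0} {τ = λ u v → codeCapacity w (cap u v)} {u} {v} ⟨ refl ⟩ ⟨ refl ⟩ ⟨ refl ⟩ m≤K m≤K
        p⟶ = !!-matrix {xs = rest 4} {# 1} {# 0} {τ = τ} {u} {v} ⟨ refl ⟩ ⟨ refl ⟩ ⟨ refl ⟩ m≤K m≤K
        q⟶ = !!-matrix {xs = rest 4} {# 0} {# 1} {τ = τ} {v} {u} ⟨ refl ⟩ ⟨ refl ⟩ ⟨ refl ⟩ m≤K m≤K

      R : Tree
      R = matrix (λ u v → codeBool (Residual f u v))

      codePaths : Paths → Tree
      codePaths P = tab (codePath ∘ P)

      step-⟶ : ∀ y P → K ∣ y ∙ codePaths P ∙ idx ∙ R ⊢ stepₚ ⟶ codePaths (step P)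
      step-⟶ y P = map-tab ⟨ refl ⟩ m≤K λ v →
        ⟶-ifᶜ codePath (P⟶ v) (isCons-codePath (P v)) (P⟶ v)
          (fold-tabulate codePath {f = codeFin} {g = via P v} ⟨ refl ⟩ m≤K ⟨ refl ⟩ λ u p →
            let Pu⟶ = !-tab {xs = # 4} {# 0} {f = codePath ∘ P} {u} ⟨ refl ⟩ ⟨ refl ⟩ m≤K
                E⟶  = !!-matrix {xs = rest 6} {# 0} {# 2} {τ = λ u v → codeBool (Residual f u v)} {u} {v} ⟨ refl ⟩ ⟨ refl ⟩ ⟨ refl ⟩ m≤K m≤K
            in ⟶-ifᶜ codePath Pu⟶ (isCons-codePath (P u))
                 (⟶-ifᶜ codePath E⟶ (isCons-codeBool (Residual f u v)) (⟶-⊗ ⟨ refl ⟩ Pu⟶) ⟨ refl ⟩) ⟨ refl ⟩)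
        where
        P⟶ : ∀ v → K ∣ codeFin v ∙ y ∙ codePaths P ∙ idx ∙ R ⊢ # 2 ! # 0 ⟶ codePath (P v)
        P⟶ v = !-tab {f = codePath ∘ P} {v} ⟨ refl ⟩ ⟨ refl ⟩ m≤K

      search-⟶ : K ∣ idx ∙ R ⊢ searchₚ ⟶ codePaths search
      search-⟶ = subst (λ P → K ∣ idx ∙ R ⊢ searchₚ ⟶ codePaths P) (sym search-unfold)
        (fold-tabulate codePaths {f = codeFin} {g = λ _ → step} ⟨ refl ⟩ m≤K
          (map-tab {f = codeFin} {g = codePath ∘ start} ⟨ refl ⟩ m≤K λ { zero → ⟨ refl ⟩ ; (suc v) → ⟨ refl ⟩ })
          (λ u P → step-⟶ (codeFin u) P))

      reach-⟶ : K ∣ idx ∙ caps ∙ matrix τ ⊢ reachₚ ⟶ codePaths search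
      reach-⟶ = ⟶->>> (⟶-⊗ ⟨ refl ⟩ (map-tab ⟨ refl ⟩ m≤K λ u → map-tab ⟨ refl ⟩ m≤K λ v → residual-⟶ u v)) search-⟶

    codeFlow : FlowMap → Tree
    codeFlow f = matrix (λ u v → codeUnary (f u v))

    push-⟶ : ∀ u v f → K ∣ codeFin u ∙ codeFin v ∙ idx ∙ codeFlow f ⊢ pushₚ ⟶ codeFlow (push u v f)
    push-⟶ u v f = ⟶-cong (sym (codeFlow-if (isPos (f v u)) {decrement v u f} {increment u v f}))
      (⟶-ifᶜ codeFlow
        (!!-matrix {xs = rest 3} {# 1} {# 0} {τ = λ x y → codeUnary (f x y)} {v} {u} ⟨ refl ⟩ ⟨ refl ⟩ ⟨ refl ⟩ m≤K m≤K)
        (isCons-codeUnary (f v u))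
        (map-tab ⟨ refl ⟩ m≤K λ x → map-tab ⟨ refl ⟩ m≤K λ y →
          ⟶-ifᶜ codeUnary (==-fin {s = # 3} {# 1} {i = v} {x} m≤K ⟨ refl ⟩ ⟨ refl ⟩) (isCons-codeBool (v ≡ᶠ x))
            (⟶-ifᶜ codeUnary (==-fin {s = # 2} {# 0} {i = u} {y} m≤K ⟨ refl ⟩ ⟨ refl ⟩) (isCons-codeBool (u ≡ᶠ y))
              (⟶-cong (tail-codeUnary (f x y)) (⟶-tl (fxy⟶ x y))) (fxy⟶ x y)) (fxy⟶ x y))
        (map-tab ⟨ refl ⟩ m≤K λ x → map-tab ⟨ refl ⟩ m≤K λ y →
          ⟶-ifᶜ codeUnary (==-fin {s = # 2} {# 1} {i = u} {x} m≤K ⟨ refl ⟩ ⟨ refl ⟩) (isCons-codeBool (u ≡ᶠ x))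
            (⟶-ifᶜ codeUnary (==-fin {s = # 3} {# 0} {i = v} {y} m≤K ⟨ refl ⟩ ⟨ refl ⟩) (isCons-codeBool (v ≡ᶠ y))
              (⟶-⊗ ⟨ refl ⟩ (fxy⟶ x y)) (fxy⟶ x y)) (fxy⟶ x y)))
      where
      fxy⟶ : ∀ x y → K ∣ codeFin y ∙ codeFin x ∙ codeFin u ∙ codeFin v ∙ idx ∙ codeFlow f ⊢ rest 5 ! # 1 ! # 0
                          ⟶ codeUnary (f x y)
      fxy⟶ x y = !!-matrix {xs = rest 5} {# 1} {# 0} {τ = λ x y → codeUnary (f x y)} {x} {y} ⟨ refl ⟩ ⟨ refl ⟩ ⟨ refl ⟩ m≤K m≤K
      codeFlow-if : ∀ b {g h : FlowMap} → codeFlow (λ x y → if b then g x y else h x y) ≡ codeFlow (if b then g else h)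
      codeFlow-if true  = refl
      codeFlow-if false = refl

    codeState : Node × FlowMap → Tree
    codeState (u , f) = codeFin u ∙ codeFlow f

    augment-⟶ : ∀ p f → length p ≤ K → K ∣ codePath p ∙ idx ∙ codeFlow f ⊢ augmentₚ ⟶ codeFlow (augment p f)
    augment-⟶ p f len = ⟶-tl ⟨ trans
      (fold-list {xs = # 0} (nil ⊗ rest 2) body ⟨ codeList-map codeFin p ⟩ (subst (_≤ K) (sym (length-map codeFin p)) len))
      (go p) ⟩
      where
      body = # 0 ⊗ (hd (# 1) ⊗ # 0 ⊗ # 3 ⊗ tl (# 1) >>> pushₚ)
      go : ∀ q → foldr (λ y a → ⟦ body ⟧ K (y ∙ a ∙ codePath p ∙ idx ∙ codeFlow f)) (nil ∙ codeFlow f) (List.map codeFin q)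
                   ≡ codeState (foldr pushStep (zero , f) q)
      go []      = refl
      go (v ∷ q) rewrite go q with foldr pushStep (zero , f) q
      ... | u , g = Evaluates.value (⟶-⊗ {s = # 0} {t = hd (# 1) ⊗ # 0 ⊗ # 3 ⊗ tl (# 1) >>> pushₚ}
                      {ρ = codeFin v ∙ codeState (u , g) ∙ codePath p ∙ idx ∙ codeFlow f} ⟨ refl ⟩ (⟶->>> ⟨ refl ⟩ (push-⟶ u v g)))

  module MaxFlowProgram {m} (m<K : 3 + m ≤ K) (cap : Fin (2 + m) → Fin (2 + m) → Capacity)
    (cap-zero : cap zero zero ≡ inf) (w : ℕ) where

    private m≤K = <⇒≤ m<K

    open FordFulkerson cap cap-zero (suc zero) (λ ())
    open Programs m≤K cap w

    round-⟶ : ∀ f → K ∣ idx ∙ caps ∙ codeFlow f ⊢ roundₚ ⟶ codeFlow (round f)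
    round-⟶ f = ⟶->>> (⟶-⊗ {t = # 0 ⊗ rest 2} (⟶-hd (⟶-tl (⟶->>> {s = # 0 ⊗ # 1 ⊗ rest 2} ⟨ refl ⟩
        (reach-⟶ {τ = λ u v → codeUnary (f u v)} (λ u v → isCons-codeUnary (f u v)))))) ⟨ refl ⟩)
      (augment-⟶ (paths f (suc zero)) f (path-length (reachable f (suc zero)) refl))
      where
      -- The bound from `search-sound` is one above the number of nodes; hence `3 + m ≤ K` for
      -- `2 + m` nodes.
      path-length : ∀ b → reachable f (suc zero) ≡ b → length (paths f (suc zero)) ≤ K
      path-length true  r = ≤-trans (proj₂ (Search.search-sound (Residual f) (suc zero) r)) m<K
      path-length false r with paths f (suc zero)
      ... | [] = z≤n

    maxFlow-⟶ : K ∣ idx ∙ caps ⊢ maxFlowₚ ⟶ codeFlow maxFlow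
    maxFlow-⟶ = subst (λ f → K ∣ idx ∙ caps ⊢ maxFlowₚ ⟶ codeFlow f) (sym maxFlow-unfold)
      (fold-tabulate codeFlow {f = codeFin} {g = λ _ → round} ⟨ refl ⟩ m≤K
        (map-tab {f = codeFin} ⟨ refl ⟩ m≤K λ u → map-tab {f = codeFin} ⟨ refl ⟩ m≤K λ v → ⟨ refl ⟩)
        (λ u f → ⟶->>> {s = # 2 ⊗ rest 3 ⊗ # 1} ⟨ refl ⟩ (round-⟶ f)))

-- The label of U∞ is nil and any other label is one above its vertex in unary, so labels compare as
-- unary numbers and `tl` recovers the vertex.
impliesₚ : Prog
impliesₚ = if lx (if ly (if (lx == ly) ⊤ₚ (g ! tl lx ! tl ly)) nil) ⊤ₚ
  where
  lx = hd (tl (tl (# 0)))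
  ly = hd (tl (tl (# 1)))
  g  = tl (tl (tl (# 0)))

-- A node of the network is given as its copy, its element of the extended
-- ground set, the label of that element, and the graph on the labels.
capacityₚ : Prog
capacityₚ = if (hd (# 0)) (if (hd (# 1)) same cross′) (if (hd (# 1)) cross′ same)
  where
  same   = if impliesₚ (rest 2) nil
  cross′ = if (hd (tl (# 0)) == hd (tl (# 1))) (if (tl (hd (tl (# 0)))) ⊤ₚ (rest 2)) nil

-- The entries `⊤ₚ` and `nil` put in front of the blocks are the labels of U₀ and U∞, for the two
-- extra elements.
nodesₚ : Prog → Prog
nodesₚ copy = mapₚ (indices (⊤ₚ ⊗ nil ⊗ # 0)) (copy ⊗ # 0 ⊗ (⊤ₚ ⊗ nil ⊗ # 1) ! # 0 ⊗ rest 2)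

capacitiesₚ : Prog
capacitiesₚ = ((# 2 >>> nodesₚ nil) ++ₚ (# 3 >>> nodesₚ ⊤ₚ)) ⊗ nil ⊗ nil ⊗ nil ⊗ # 0
  >>> mapₚ (# 0) (mapₚ (# 1) (# 1 ⊗ # 0 ⊗ rest 3 >>> capacityₚ))

-- Horner's scheme in unary: for each digit the accumulator is folded over itself, and the clock
-- lets this doubling add at most K marks.
budgetₚ : Prog
budgetₚ = foldₚ arg nil (foldₚ (# 1) (if (# 0) (nil ⊗ nil ⊗ # 1) (nil ⊗ # 1)) (nil ⊗ # 1))

chooseₚ : Prog
chooseₚ = if a (if b same diff) (if b diff same)
  where
  a b p q X same diff : Prog
  a = if (# 2 ! # 0) ⊤ₚ nil
  b = if (# 3 ! # 0) ⊤ₚ nil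
  p = hd (# 1)
  q = hd (tl (# 1))
  X = tl (tl (# 1))
  same = p ⊗ q ⊗ a ⊗ X
  diff = if p (tl p ⊗ q ⊗ b ⊗ X) (p ⊗ tl q ⊗ a ⊗ X)

answerₚ : Prog
answerₚ = foldₚ (# 2) (rest 3 ⊗ (nil ⊗ rest 3) ⊗ nil) chooseₚ >>> if (# 1) (nil ⊗ rest 2) nil

selectₚ : Prog
selectₚ = tl (tl (# 0)) ⊗ tl (tl (dropₚ (nil ⊗ nil ⊗ # 1) (# 0))) ⊗ indices (# 1) ⊗ (rest 2 >>> budgetₚ)
  >>> answerₚ

-- A stored path is nonempty exactly for reached nodes, so the table of paths is used directly as
-- the cut.
postₚ : Prog
postₚ = (hd arg >>> capacitiesₚ) ⊗ arg
  >>> (indices (# 0) ⊗ # 0 ⊗ rest 2 >>> reachₚ) ⊗ hd (# 1) ⊗ hd (tl (# 1))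
  >>> selectₚ

solveₚ : Prog
solveₚ = arg ⊗ (capacitiesₚ >>> indices arg ⊗ arg >>> maxFlowₚ) >>> postₚ

preₚ : Prog
preₚ = nil ⊗ ⊤ₚ ⊗ capacitiesₚ

digits : ℕᵇ → List Tree
digits ℕᵇ.zero  = []
digits 2[1+ x ] = (nil ∙ nil) ∷ digits x
digits 1+[2 x ] = nil ∷ digits x

codeℕᵇ-digits : ∀ x → codeℕᵇ x ≡ list (digits x)
codeℕᵇ-digits ℕᵇ.zero  = refl
codeℕᵇ-digits 2[1+ x ] = cong ((nil ∙ nil) ∙_) (codeℕᵇ-digits x)
codeℕᵇ-digits 1+[2 x ] = cong (nil ∙_) (codeℕᵇ-digits x)

truncated : ℕ → ℕᵇ → ℕ
truncated K ℕᵇ.zero  = 0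
truncated K 2[1+ x ] = K ⊓ truncated K x + (2 + truncated K x)
truncated K 1+[2 x ] = K ⊓ truncated K x + (1 + truncated K x)

-- Here c is the new digit. Doubling is exact up to K, and once it is not, both numbers have already
-- reached K.
truncates-double : ∀ {K d β} c → Truncates K d β → Truncates K (d + (c + d)) (K ⊓ β + (c + β))
truncates-double {K} {d} c (inj₁ refl) with ≤-total K d
... | inj₂ d≤K = inj₁ (cong (_+ (c + d)) (m≥n⇒m⊓n≡n d≤K))
... | inj₁ K≤d = inj₂ ( ≤-trans K≤d (≤-trans (m≤n+m d c) (m≤n+m (c + d) (K ⊓ d)))
                      , ≤-trans K≤d (m≤m+n d (c + d)))
truncates-double {K} {d} {β} c (inj₂ (K≤β , K≤d)) =
  inj₂ (≤-trans K≤β (≤-trans (m≤n+m β c) (m≤n+m (c + β) (K ⊓ β))) , ≤-trans K≤d (m≤m+n d (c + d)))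

truncated-truncates : ∀ K x → Truncates K (ℕᵇ.toℕ x) (truncated K x)
truncated-truncates K ℕᵇ.zero  = inj₁ refl
truncated-truncates K 2[1+ x ] = subst (λ d → Truncates K d (truncated K 2[1+ x ])) (shuffle (ℕᵇ.toℕ x))
  (truncates-double 2 (truncated-truncates K x))
  where
  shuffle : ∀ d → d + (2 + d) ≡ 2 * suc d
  shuffle d = trans (+-suc d (suc d)) (cong (suc d +_) (sym (+-identityʳ (suc d))))
truncated-truncates K 1+[2 x ] = subst (λ d → Truncates K d (truncated K 1+[2 x ])) (shuffle (ℕᵇ.toℕ x))
  (truncates-double 1 (truncated-truncates K x))
  where
  shuffle : ∀ d → d + (1 + d) ≡ suc (2 * d)
  shuffle d = trans (+-suc d d) (cong (λ e → suc (d + e)) (sym (+-identityʳ d)))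

codeLabel : ∀ {b} → Maybe (Fin b) → Tree
codeLabel = codeMaybe codeFin

tails-tab : ∀ k {l} (h : Fin (k + l) → Tree) → tails k (tab h) ≡ tab (λ j → h (k ↑ʳ j))
tails-tab zero    h = refl
tails-tab (suc k) h = trans (tails-suc k (tab h)) (tails-tab k (h ∘ suc))

codeUnary-tab : ∀ n → codeUnary n ≡ tab {n} (λ _ → nil)
codeUnary-tab zero    = refl
codeUnary-tab (suc n) = cong (nil ∙_) (codeUnary-tab n)

codeSelection : ∀ {n} → ℕ × ℕ × Subset n → Tree
codeSelection (p , q , X) = codeUnary p ∙ codeUnary q ∙ codeVec codeBool X

codeAnswer : ∀ {n} → Maybe (Subset n) → Tree
codeAnswer = codeMaybe (codeVec codeBool)

module _ {K : ℕ} where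

  budget-⟶ : ∀ x → length (digits x) ≤ K → K ∣ codeℕᵇ x ⊢ budgetₚ ⟶ codeUnary (truncated K x)
  budget-⟶ x len = ⟨ trans (fold-list {xs = arg} nil body ⟨ codeℕᵇ-digits x ⟩ len) (go x) ⟩
    where
    inner : Prog
    inner = if (# 0) (nil ⊗ nil ⊗ # 1) (nil ⊗ # 1)
    body = foldₚ (# 1) inner (nil ⊗ # 1)
    ρ = codeℕᵇ x
    add : ∀ i j → foldr (λ _ a → nil ∙ a) (codeUnary j) (List.replicate i Tree.nil) ≡ codeUnary (i + j)
    add zero    j = refl
    add (suc i) j = cong (nil ∙_) (add i j)
    take-nils : ∀ j → List.take K (spine (codeUnary j)) ≡ List.replicate (K ⊓ j) nil
    take-nils = helper K
      where
      helper : ∀ K j → List.take K (spine (codeUnary j)) ≡ List.replicate (K ⊓ j) nil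
      helper zero    j       = refl
      helper (suc K) zero    = refl
      helper (suc K) (suc j) = cong (nil ∷_) (helper K j)
    digit : ∀ y c j → ⟦ inner ⟧ K (y ∙ codeUnary j ∙ ρ) ≡ codeUnary (c + j) →
      ⟦ body ⟧ K (y ∙ codeUnary j ∙ ρ) ≡ codeUnary (K ⊓ j + (c + j))
    digit y c j eq = trans (fold-take {K} (# 1) inner (nil ⊗ # 1) (y ∙ codeUnary j ∙ ρ))
      (trans (cong₂ (foldr (λ _ a → nil ∙ a)) eq (take-nils j)) (add (K ⊓ j) (c + j)))
    go : ∀ x → foldr (λ y a → ⟦ body ⟧ K (y ∙ a ∙ ρ)) nil (digits x) ≡ codeUnary (truncated K x)
    go ℕᵇ.zero  = refl
    go 2[1+ x ] rewrite go x = digit (nil ∙ nil) 2 (truncated K x) refl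
    go 1+[2 x ] rewrite go x = digit nil 1 (truncated K x) refl

  -- The list A has l further entries because the left copy is followed by the right copy, which is
  -- not cut off.
  module _ {n l : ℕ} (n+l≤K : n + l ≤ K) {α β : Fin n → Bool} {A : Fin (n + l) → Tree} {B : Fin n → Tree}
    (A≈α : ∀ e → isCons (A (e ↑ˡ l)) ≡ α e) (B≈β : ∀ e → isCons (B e) ≡ β e) where

    private n≤K = ≤-trans (m≤m+n n l) n+l≤K

    choose-⟶ : ∀ e {m} (s : ℕ × ℕ × Subset m) ρ →
      K ∣ codeFin e ∙ codeSelection s ∙ tab A ∙ tab B ∙ ρ ⊢ chooseₚ ⟶ codeSelection (choose (α e) (β e) s)
    choose-⟶ e s@(p , q , X) ρ = ⟶-cong (value (α e) (β e))
      (⟶-ifᵇ a⟶ (⟶-ifᵇ b⟶ same⟶ diff⟶) (⟶-ifᵇ b⟶ diff⟶ same⟶))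
      where
      env = codeFin e ∙ codeSelection s ∙ tab A ∙ tab B ∙ ρ
      same diff : ℕ × ℕ × Subset _
      same = p , q , α e Vec.∷ X
      diff = if isPos p then (pred p , q , β e Vec.∷ X) else (p , pred q , α e Vec.∷ X)
      normalise : ∀ {t v b} → K ∣ env ⊢ t ⟶ v → isCons v ≡ b → K ∣ env ⊢ if t ⊤ₚ nil ⟶ codeBool b
      normalise {b = b} t⟶ eq = ⟶-cong (cong codeBool (η b)) (⟶-ifᶜ codeBool {x = true} {false} t⟶ eq ⟨ refl ⟩ ⟨ refl ⟩)
        where
        η : ∀ b → (if b then true else false) ≡ b
        η true  = refl
        η false = refl
      a⟶ : K ∣ env ⊢ if (# 2 ! # 0) ⊤ₚ nil ⟶ codeBool (α e)
      a⟶ = normalise (!-tab {xs = # 2} {# 0} {f = A} {e ↑ˡ l} ⟨ refl ⟩ ⟨ cong codeUnary (sym (toℕ-↑ˡ e l)) ⟩ n+l≤K) (A≈α e)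
      b⟶ : K ∣ env ⊢ if (# 3 ! # 0) ⊤ₚ nil ⟶ codeBool (β e)
      b⟶ = normalise (!-tab {xs = # 3} {# 0} {f = B} {e} ⟨ refl ⟩ ⟨ refl ⟩ n≤K) (B≈β e)
      same⟶ = ⟶-⊗ {s = hd (# 1)} ⟨ refl ⟩ (⟶-⊗ {s = hd (tl (# 1))} ⟨ refl ⟩ (⟶-⊗ {t = tl (tl (# 1))} a⟶ ⟨ refl ⟩))
      diff⟶ = ⟶-ifᶜ codeSelection {hd (# 1)} {b = isPos p} {x = pred p , q , β e Vec.∷ X} {p , pred q , α e Vec.∷ X}
        ⟨ refl ⟩ (isCons-codeUnary p)
        (⟶-⊗ {s = tl (hd (# 1))} ⟨ tail-codeUnary p ⟩ (⟶-⊗ {s = hd (tl (# 1))} ⟨ refl ⟩ (⟶-⊗ {t = tl (tl (# 1))} b⟶ ⟨ refl ⟩)))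
        (⟶-⊗ {s = hd (# 1)} ⟨ refl ⟩ (⟶-⊗ {s = tl (hd (tl (# 1)))} ⟨ tail-codeUnary q ⟩ (⟶-⊗ {t = tl (tl (# 1))} a⟶ ⟨ refl ⟩)))
      value : ∀ a b →
        (if a then (if b then codeSelection same else codeSelection diff) else (if b then codeSelection diff else codeSelection same))
          ≡ codeSelection (if a xor b then diff else same)
      value true  true  = refl
      value true  false = refl
      value false true  = refl
      value false false = refl

    answer-⟶ : ∀ p → K ∣ tab A ∙ tab B ∙ tab (codeFin {n}) ∙ codeUnary p ⊢ answerₚ
      ⟶ codeAnswer (answer (Vec.tabulate α) (Vec.tabulate β) p)
    answer-⟶ p = ⟶->>> {v = codeSelection (select (Vec.tabulate α) (Vec.tabulate β) p (suc p))}
      ⟨ trans (fold-tab {xs = # 2} (rest 3 ⊗ (nil ⊗ rest 3) ⊗ nil) chooseₚ ⟨ refl ⟩ n≤K) (go (λ i → i)) ⟩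
      (finish (select (Vec.tabulate α) (Vec.tabulate β) p (suc p)))
      where
      ρ = tab (codeFin {n}) ∙ codeUnary p
      go : ∀ {m} (h : Fin m → Fin n) →
        foldr (λ y a → ⟦ chooseₚ ⟧ K (y ∙ a ∙ tab A ∙ tab B ∙ ρ)) (codeSelection {0} (p , suc p , Vec.[]))
          (List.tabulate (codeFin ∘ h))
          ≡ codeSelection (select (Vec.tabulate (α ∘ h)) (Vec.tabulate (β ∘ h)) p (suc p))
      go {zero}  h = refl
      go {suc m} h rewrite go (h ∘ suc) =
        Evaluates.value (choose-⟶ (h zero) (select (Vec.tabulate (α ∘ h ∘ suc)) (Vec.tabulate (β ∘ h ∘ suc)) p (suc p)) ρ)
      finish : ∀ {n} (s : ℕ × ℕ × Subset n) → K ∣ codeSelection s ⊢ if (# 1) (nil ⊗ rest 2) nil ⟶ codeAnswer (answerOf s)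
      finish (p , q , X) = ⟶-ifᶜ codeAnswer {x = just X} {nothing} ⟨ refl ⟩ (isCons-codeUnary q) ⟨ refl ⟩ ⟨ refl ⟩

  module _ (I : RSMInstance 2) where
    open RSMInstance I

    graphOf : Fin 2 → Tree
    graphOf i = codeVec (codeVec codeBool) (CompactRepresentation.graph (compact i))

    -- K is kept apart from the size of the instance, since the program that reads a given flow has
    -- a larger input and thus a larger clock.
    record Sufficient : Set where
      field
        nodes  : suc ((2 + n) + (2 + n)) ≤ K
        graph  : ∀ i → suc (CompactRepresentation.b (compact i)) ≤ K
        budget : length (digits (fromℕ d)) ≤ K

    module _ (enough : Sufficient) where
      open DoubleNetwork (relation I zero) (relation I (suc zero)) refl

      private
        m≤K : k + k ≤ K
        m≤K = <⇒≤ (Sufficient.nodes enough)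
        k≤K : k ≤ K
        k≤K = ≤-trans (m≤m+n k k) m≤K

      codeNode : Bool → (i : Fin 2) → Fin k → Tree
      codeNode copy i e = codeBool copy ∙ codeFin e ∙ codeLabel (Representation.label (compact i) e) ∙ graphOf i

      implies-⟶ : ∀ i e e′ copy ρ → K ∣ codeNode copy i e ∙ codeNode copy i e′ ∙ ρ ⊢ impliesₚ ⟶ codeBool (relation I i e e′)
      implies-⟶ i e e′ copy ρ = go (label e) (label e′)
        where
        open CompactRepresentation (compact i) using (b; graph)
        open Representation (compact i) using (label; labelImplies)
        lemma : ∀ p q → (if p then nil ∙ nil else codeBool q) ≡ codeBool (p ∨ q)
        lemma true  q = refl
        lemma false q = refl
        graph-tab : graphOf i ≡ matrix (λ x y → codeBool (lookup (lookup graph x) y))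
        graph-tab = trans (codeVec-tab _ graph) (tab-cong (λ x → codeVec-tab codeBool (lookup graph x)))
        go : ∀ c c′ → K ∣ (codeBool copy ∙ codeFin e ∙ codeLabel c ∙ graphOf i) ∙ (codeBool copy ∙ codeFin e′ ∙ codeLabel c′ ∙ graphOf i) ∙ ρ
               ⊢ impliesₚ ⟶ codeBool (labelImplies c c′)
        go nothing  _        = ⟨ refl ⟩
        go (just x) nothing  = ⟨ refl ⟩
        go (just x) (just y) = ⟶-cong (lemma (x ≡ᶠ y) (lookup (lookup graph x) y))
          (⟶-if {c = lx} {if ly (if (lx == ly) ⊤ₚ (g ! tl lx ! tl ly)) nil} {⊤ₚ} ⟨ refl ⟩
            (⟶-if {c = ly} {if (lx == ly) ⊤ₚ (g ! tl lx ! tl ly)} {nil} ⟨ refl ⟩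
              (⟶-ifᵇ {c = lx == ly} {⊤ₚ} {g ! tl lx ! tl ly}
                (==-unary {s = lx} {ly} {i = suc (toℕ x)} {suc (toℕ y)} ⟨ refl ⟩ ⟨ refl ⟩ (≤-trans (toℕ<n x) (Sufficient.graph enough i))
                  (≤-trans (toℕ<n y) (Sufficient.graph enough i))) ⟨ refl ⟩
                (!!-matrix {xs = g} {tl lx} {tl ly} {τ = λ x y → codeBool (lookup (lookup graph x) y)} ⟨ graph-tab ⟩ ⟨ refl ⟩ ⟨ refl ⟩
                  (Sufficient.graph enough i) (Sufficient.graph enough i)))
              ⟨ refl ⟩) ⟨ refl ⟩)
          where
          lx = hd (tl (tl (# 0)))
          ly = hd (tl (tl (# 1)))
          g  = tl (tl (tl (# 0)))

      codeNodeD : Fin k ⊎ Fin k → Tree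
      codeNodeD = [ codeNode false zero , codeNode true (suc zero) ]′

      capacity-⟶ : ∀ x y → K ∣ codeNodeD x ∙ codeNodeD y ∙ codeUnary (3 + n) ⊢ capacityₚ ⟶ codeCapacity n (capD x y)
      capacity-⟶ x y = go x y
        where
        env : Fin k ⊎ Fin k → Fin k ⊎ Fin k → Tree
        env x y = codeNodeD x ∙ codeNodeD y ∙ codeUnary (3 + n)
        sameₚ crossₚ : Prog
        sameₚ  = if impliesₚ (rest 2) nil
        crossₚ = if (hd (tl (# 0)) == hd (tl (# 1))) (if (tl (hd (tl (# 0)))) ⊤ₚ (rest 2)) nil
        same-⟶ : ∀ i copy e e′ → K ∣ codeNode copy i e ∙ codeNode copy i e′ ∙ codeUnary (3 + n) ⊢ sameₚ
                   ⟶ codeCapacity n (if relation I i e e′ then inf else none)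
        same-⟶ i copy e e′ = ⟶-ifᶜ (codeCapacity n) {x = inf} {none} (implies-⟶ i e e′ copy _)
          (isCons-codeBool (relation I i e e′)) ⟨ refl ⟩ ⟨ refl ⟩
        linkₚ : ∀ copy i e copy′ i′ e′ → K ∣ codeNode copy i e ∙ codeNode copy′ i′ e′ ∙ codeUnary (3 + n)
                  ⊢ if (tl (hd (tl (# 0)))) ⊤ₚ (rest 2) ⟶ codeCapacity n (link e)
        linkₚ copy i zero          copy′ i′ e′ = ⟨ refl ⟩
        linkₚ copy i (suc zero)    copy′ i′ e′ = ⟨ refl ⟩
        linkₚ copy i (suc (suc _)) copy′ i′ e′ = ⟨ refl ⟩
        cross-⟶ : ∀ copy i e copy′ i′ e′ → K ∣ codeNode copy i e ∙ codeNode copy′ i′ e′ ∙ codeUnary (3 + n) ⊢ crossₚ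
                   ⟶ codeCapacity n (cross e e′)
        cross-⟶ copy i e copy′ i′ e′ = ⟶-ifᶜ (codeCapacity n) {x = link e} {none}
          (==-fin {s = hd (tl (# 0))} {hd (tl (# 1))} {i = e} {e′} k≤K ⟨ refl ⟩ ⟨ refl ⟩) (isCons-codeBool (e ≡ᶠ e′))
          (linkₚ copy i e copy′ i′ e′) ⟨ refl ⟩
        go : ∀ x y → K ∣ env x y ⊢ capacityₚ ⟶ codeCapacity n (capD x y)
        go (inj₁ e) (inj₁ e′) = ⟨ Evaluates.value (same-⟶ zero false e e′) ⟩
        go (inj₂ e) (inj₂ e′) = ⟨ Evaluates.value (same-⟶ (suc zero) true e e′) ⟩
        go (inj₁ e) (inj₂ e′) = ⟨ Evaluates.value (cross-⟶ false zero e true (suc zero) e′) ⟩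
        go (inj₂ e) (inj₁ e′) = ⟨ Evaluates.value (cross-⟶ true (suc zero) e false zero e′) ⟩

      labels-⟶ : ∀ i j ρ → K ∣ ρ ⊢ # j ⟶ codeVec (codeMaybe codeFin) (CompactRepresentation.block (compact i)) →
        K ∣ ρ ⊢ ⊤ₚ ⊗ nil ⊗ # j ⟶ tab (λ e → codeLabel (Representation.label (compact i) e))
      labels-⟶ i j ρ d = ⟶-⊗ ⟨ refl ⟩ (⟶-⊗ ⟨ refl ⟩
        (⟶-cong (codeVec-tab (codeMaybe codeFin) (CompactRepresentation.block (compact i))) d))

      nodes-⟶ : ∀ i copy copyₚ → (∀ ρ → K ∣ ρ ⊢ copyₚ ⟶ codeBool copy) →
        K ∣ codeCompactRepresentation (compact i) ⊢ nodesₚ copyₚ ⟶ tab (codeNode copy i)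
      nodes-⟶ i copy copyₚ copy⟶ = map-tab (indices-tab {f = labelTree} (labels-⟶ i 0 _ ⟨ refl ⟩) k≤K) k≤K λ e →
        ⟶-⊗ (copy⟶ _) (⟶-⊗ {t = (⊤ₚ ⊗ nil ⊗ # 1) ! # 0 ⊗ rest 2} ⟨ refl ⟩
          (⟶-⊗ {t = rest 2} (!-tab {f = labelTree} {e} (labels-⟶ i 1 (codeFin e ∙ codeCompactRepresentation (compact i)) ⟨ refl ⟩) ⟨ refl ⟩ k≤K) ⟨ refl ⟩))
        where
        labelTree : Fin k → Tree
        labelTree = λ e → codeLabel (Representation.label (compact i) e)

      input : Tree
      input = Problem.codeᴵ (RobustSubmodularMinimizer 2) I

      capacities-⟶ : K ∣ input ⊢ capacitiesₚ ⟶ matrix (λ x y → codeCapacity n (cap x y))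
      capacities-⟶ = ⟶->>> {v = tab (codeNodeD ∘ splitAt k) ∙ codeUnary (3 + n)}
        (⟶-⊗ {t = nil ⊗ nil ⊗ nil ⊗ # 0}
          (++-tab (⟶->>> {s = # 2} ⟨ refl ⟩ (nodes-⟶ zero false nil (λ _ → ⟨ refl ⟩)))
                  (⟶->>> {s = # 3} ⟨ refl ⟩ (nodes-⟶ (suc zero) true ⊤ₚ (λ _ → ⟨ refl ⟩))) k≤K) ⟨ refl ⟩)
        (map-tab {xs = # 0} {f = codeNodeD ∘ splitAt k} ⟨ refl ⟩ m≤K λ x →
          map-tab {xs = # 1} {f = codeNodeD ∘ splitAt k} ⟨ refl ⟩ m≤K λ y →
            ⟶->>> {s = # 1 ⊗ # 0 ⊗ rest 3} ⟨ refl ⟩ (capacity-⟶ (splitAt k x) (splitAt k y)))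

      module _ (S : Cut) (h : Fin (k + k) → Tree) (h≈S : ∀ x → isCons (h x) ≡ S x) where

        decision : Maybe (Subset n)
        decision = answer (Vec.tabulate (λ v → S (left (suc (suc v))))) (Vec.tabulate (λ v → S (right (suc (suc v)))))
          (truncated K (fromℕ d))

        select-⟶ : K ∣ tab h ∙ codeUnary n ∙ codeℕ d ⊢ selectₚ ⟶ codeAnswer decision
        select-⟶ = ⟶->>> {v = tab (λ x → h (suc (suc x))) ∙ tab (λ v → h (right (suc (suc v)))) ∙ tab (codeFin {n}) ∙ codeUnary (truncated K (fromℕ d))}
          (⟶-⊗ {s = tl (tl (# 0))} ⟨ refl ⟩
            (⟶-⊗ {s = tl (tl (dropₚ (nil ⊗ nil ⊗ # 1) (# 0)))}
              (⟶-cong (cong (λ t → tail (tail t)) (tails-tab k h))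
                (⟶-tl (⟶-tl (drop-tails {i = nil ⊗ nil ⊗ # 1} {# 0} {j = k} ⟨ refl ⟩ k≤K ⟨ refl ⟩))))
              (⟶-⊗ (indices-tab {xs = # 1} {f = λ (_ : Fin n) → nil} ⟨ codeUnary-tab n ⟩ (≤-trans (m≤n+m n 2) k≤K))
                (⟶->>> {s = rest 2} ⟨ refl ⟩ (budget-⟶ (fromℕ d) (Sufficient.budget enough))))))
          (answer-⟶ {n} {k} (≤-trans (m≤n+m (n + k) 2) m≤K) (λ v → h≈S (left (suc (suc v)))) (λ v → h≈S (right (suc (suc v)))) _)

      post-⟶ : ∀ {τ : Node → Node → Tree} {f : FlowMap} → (∀ u v → isCons (τ u v) ≡ isPos (f u v)) →
        K ∣ input ∙ matrix τ ⊢ postₚ ⟶ codeAnswer (decision (reachable f) (codePath ∘ paths f) (λ v → isCons-codePath (paths f v)))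
      post-⟶ {τ} {f} τ≈f = ⟶->>>
        (⟶->>> {v = C ∙ input ∙ matrix τ} (⟶-⊗ {t = arg} (⟶->>> {s = hd arg} ⟨ refl ⟩ capacities-⟶) ⟨ refl ⟩)
          (⟶-⊗ {t = hd (# 1) ⊗ hd (tl (# 1))}
            (⟶->>> (⟶-⊗ {t = # 0 ⊗ rest 2} (indices-tab {xs = # 0} {f = λ x → tab (λ y → codeCapacity n (cap x y))} ⟨ refl ⟩ m≤K) ⟨ refl ⟩)
              (Programs.reach-⟶ m≤K cap n {τ = τ} {f} τ≈f)) ⟨ refl ⟩))
        (select-⟶ (reachable f) (codePath ∘ paths f) (λ v → isCons-codePath (paths f v)))
        where
        C = matrix (λ x y → codeCapacity n (cap x y))

      solve-⟶ : K ∣ input ⊢ solveₚ ⟶ codeAnswer (decision (reachable maxFlow) (codePath ∘ paths maxFlow) (λ v → isCons-codePath (paths maxFlow v)))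
      solve-⟶ = ⟶->>> (⟶-⊗ {s = arg} ⟨ refl ⟩
        (⟶->>> (⟶->>> capacities-⟶ (⟶-⊗ {t = arg}
            (indices-tab {xs = arg} {f = λ x → tab (λ y → codeCapacity n (cap x y))} ⟨ refl ⟩ m≤K) ⟨ refl ⟩))
          (MaxFlowProgram.maxFlow-⟶ (Sufficient.nodes enough) cap cap-zero n)))
        (post-⟶ {f = maxFlow} (λ u v → isCons-codeUnary (maxFlow u v)))

      pre-⟶ : K ∣ input ⊢ preₚ ⟶ nil ∙ (nil ∙ nil) ∙ matrix (λ x y → codeCapacity n (cap x y))
      pre-⟶ = ⟶-⊗ ⟨ refl ⟩ (⟶-⊗ ⟨ refl ⟩ capacities-⟶)

-- Sizes of inputs and outputs, and the network with finite capacities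

RSM : Problem
RSM = RobustSubmodularMinimizer 2

size-codeUnary : ∀ j → size (codeUnary j) ≡ suc (j + j)
size-codeUnary zero    = refl
size-codeUnary (suc j) = cong (2 +_) (trans (size-codeUnary j) (sym (+-suc j j)))

length-≤-size : ∀ {A : Set} (code : A → Tree) xs → length xs ≤ size (codeList code xs)
length-≤-size code []       = z≤n
length-≤-size code (x ∷ xs) = s≤s (≤-trans (length-≤-size code xs) (m≤n+m _ (size (code x))))

size-codeList : ∀ {A : Set} (code : A → Tree) {c} → (∀ x → size (code x) ≤ c) → ∀ xs →
  size (codeList code xs) ≤ 1 + length xs * suc c
size-codeList code         code≤ []       = ≤-refl
size-codeList code {c = c} code≤ (x ∷ xs) = s≤s (≤-trans (+-mono-≤ (code≤ x) (size-codeList code code≤ xs))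
  (≤-reflexive (+-suc c (length xs * suc c))))

size-codeVec : ∀ {A : Set} {n} (code : A → Tree) {c} → (∀ x → size (code x) ≤ c) → (xs : Vec A n) →
  size (codeVec code xs) ≤ 1 + n * suc c
size-codeVec code {c = c} code≤ xs = subst (λ l → size (codeVec code xs) ≤ 1 + l * suc c) (length-toList xs)
  (size-codeList code code≤ (Vec.toList xs))

size-tab : ∀ {m c} (f : Fin m → Tree) → (∀ i → size (f i) ≤ c) → size (tab f) ≤ 1 + m * suc c
size-tab {zero}      f f≤ = ≤-refl
size-tab {suc m} {c} f f≤ = s≤s (≤-trans (+-mono-≤ (f≤ zero) (size-tab (f ∘ suc) (f≤ ∘ suc)))
  (≤-reflexive (+-suc c (m * suc c))))

size-codeBool : ∀ b → size (codeBool b) ≤ 3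
size-codeBool false = s≤s z≤n
size-codeBool true  = ≤-refl

size-codeAnswer : ∀ {n} (S : Maybe (Subset n)) → size (codeAnswer S) ≤ 3 + n * 4
size-codeAnswer nothing  = s≤s z≤n
size-codeAnswer (just X) = s≤s (s≤s (size-codeVec codeBool size-codeBool X))

-- The number 2^j - 1. With digits 1 and 2 its numeral is j times the digit 1, whose code is that of
-- j in unary.
power : ℕ → ℕᵇ
power zero    = ℕᵇ.zero
power (suc j) = 1+[2 power j ]

codeℕ-power : ∀ j → codeℕ (ℕᵇ.toℕ (power j)) ≡ codeUnary j
codeℕ-power j = trans (cong codeℕᵇ (ℕᵇ.fromℕ-toℕ (power j))) (go j)
  where
  go : ∀ j → codeℕᵇ (power j) ≡ codeUnary j
  go zero    = refl
  go (suc j) = cong (nil ∙_) (go j)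

-- The left side is one less than the number of nodes and bounds the entries of `maxFlow`, so these
-- fit the number that stands for infinity.
power-≥ : ∀ n → suc n + (2 + n) ≤ ℕᵇ.toℕ (power (3 + n))
power-≥ zero    = s≤s (s≤s (s≤s z≤n))
power-≥ (suc n) = begin
  2 + n + (3 + n)                    ≡⟨ shuffle n ⟩
  2 + (suc n + (2 + n))              ≤⟨ s≤s (+-mono-≤ (≤-trans (s≤s z≤n) (power-≥ n)) (power-≥ n)) ⟩
  suc (x + x)                        ≡⟨ cong (λ y → suc (x + y)) (+-identityʳ x) ⟨
  suc (2 * x)                        ∎
  where
  open ≤-Reasoning
  x = ℕᵇ.toℕ (power (3 + n))
  shuffle : ∀ n → 2 + n + (3 + n) ≡ 2 + (suc n + (2 + n))
  shuffle = solve-∀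

isCons-codeℕ : ∀ j → isCons (codeℕ j) ≡ isPos j
isCons-codeℕ zero    = refl
isCons-codeℕ (suc j) with fromℕ (suc j) in eq
... | ℕᵇ.zero  = contradiction (trans (sym (ℕᵇ.toℕ-fromℕ (suc j))) (cong ℕᵇ.toℕ eq)) λ ()
... | 2[1+ _ ] = refl
... | 1+[2 _ ] = refl

-- Turns optimality, stated for integer values, into the subtraction-free inequality that
-- `value-blocks` takes.
⊖-≤ : ∀ i j o i′ → (i + j) ℤ.⊖ i ℤ.≤ o ℤ.⊖ i′ → i′ + j ≤ o
⊖-≤ i j o i′ le = go (≤-<-connex i′ o)
  where
  j≤ : ℤ.+ j ℤ.≤ o ℤ.⊖ i′
  j≤ = subst (ℤ._≤ o ℤ.⊖ i′) (trans (ℤ.⊖-≥ (m≤m+n i j)) (cong ℤ.+_ (m+n∸m≡n i j))) le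
  go : i′ ≤ o ⊎ o < i′ → i′ + j ≤ o
  go (inj₁ i′≤o) = ≤-trans (+-monoʳ-≤ i′ (ℤ.drop‿+≤+ (subst (ℤ.+ j ℤ.≤_) (ℤ.⊖-≥ i′≤o) j≤)))
    (≤-reflexive (m+[n∸m]≡n i′≤o))
  go (inj₂ o<i′) with i′ ∸ o in eq | subst (ℤ.+ j ℤ.≤_) (ℤ.⊖-< o<i′) j≤
  ... | zero  | _ = contradiction (m∸n≡0⇒m≤n eq) (<⇒≱ o<i′)
  ... | suc _ | ()

Computes-mono : ∀ {t x y B B′} → B ≤ B′ → Computes t x y B → Computes t x y B′
Computes-mono B≤ (k , d , le) = k , d , ≤-trans le B≤

module _ (I : RSMInstance 2) where
  open RSMInstance I hiding (f)
  open DoubleNetwork (relation I zero) (relation I (suc zero)) refl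

  private code = Problem.codeᴵ RSM I

  size-input : suc (k + k) ≤ size code
  size-input = begin
    suc (k + k)                       ≡⟨ shuffle n ⟩
    2 + (suc (n + n) + 2)             ≡⟨ cong (λ s → 2 + (s + 2)) (size-codeUnary n) ⟨
    2 + (size (codeUnary n) + 2)      ≤⟨ s≤s (≤-trans (≤-reflexive (sym (+-suc (size (codeUnary n)) 2)))
                                           (+-monoʳ-≤ (size (codeUnary n)) (s≤s (≤-trans (s≤s (s≤s z≤n)) (m≤n+m _ (size (codeℕ d))))))) ⟩
    size code                         ∎
    where
    open ≤-Reasoning
    shuffle : ∀ n → suc ((2 + n) + (2 + n)) ≡ 2 + (suc (n + n) + 2)
    shuffle = solve-∀

  n≤size : n ≤ size code
  n≤size = ≤-trans (m≤n+m n 2) (≤-trans (≤-trans (m≤m+n k k) (n≤1+n _)) size-input)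

  sufficient : ∀ {K} → size code ≤ K → Sufficient {K} I
  sufficient {K} code≤K = record
    { nodes  = ≤-trans size-input code≤K
    ; graph  = λ i → ≤-trans (graph≤ i) (≤-trans (compact≤ i) code≤K)
    ; budget = ≤-trans (digits≤ (fromℕ d)) (≤-trans (≤-trans (m≤m+n _ _)
                 (≤-trans (n≤1+n _) (≤-trans (m≤n+m _ (size (codeUnary n))) (n≤1+n _)))) code≤K)
    }
    where
    rows : ∀ i → ℕ
    rows i = size (codeVec (codeVec codeBool) (CompactRepresentation.graph (compact i)))
    graph≤ : ∀ i → suc (CompactRepresentation.b (compact i)) ≤ size (codeCompactRepresentation (compact i))
    graph≤ i = ≤-trans (subst (_≤ rows i) (length-toList (CompactRepresentation.graph (compact i)))
        (length-≤-size (codeVec codeBool) (Vec.toList (CompactRepresentation.graph (compact i)))))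
      (≤-trans (m≤n+m (rows i) _) (n≤1+n _))
    tailSize : ∀ s t → size t ≤ size (s ∙ t)
    tailSize s t = ≤-trans (m≤n+m (size t) (size s)) (n≤1+n _)
    headSize : ∀ s t → size s ≤ size (s ∙ t)
    headSize s t = ≤-trans (m≤m+n (size s) (size t)) (n≤1+n _)
    C : Fin 2 → Tree
    C i = codeCompactRepresentation (compact i)
    compacts≤ : size (C zero ∙ C (suc zero) ∙ nil) ≤ size code
    compacts≤ = ≤-trans (tailSize (codeℕ d) (C zero ∙ C (suc zero) ∙ nil)) (tailSize (codeUnary n) (codeℕ d ∙ C zero ∙ C (suc zero) ∙ nil))
    compact≤ : ∀ i → size (C i) ≤ size code
    compact≤ zero       = ≤-trans (headSize (C zero) (C (suc zero) ∙ nil)) compacts≤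
    compact≤ (suc zero) = ≤-trans (headSize (C (suc zero)) nil) (≤-trans (tailSize (C zero) (C (suc zero) ∙ nil)) compacts≤)
    digits≤ : ∀ x → length (digits x) ≤ size (codeℕᵇ x)
    digits≤ ℕᵇ.zero  = z≤n
    digits≤ 2[1+ x ] = s≤s (≤-trans (digits≤ x) (m≤n+m _ 3))
    digits≤ 1+[2 x ] = s≤s (≤-trans (digits≤ x) (n≤1+n _))

  decision-correct : ∀ {K} (enough : Sufficient {K} I) f → FitsAll f → Conserved f → Maximal f →
    Answers (decision I enough (reachable f) (codePath ∘ paths f) (λ v → isCons-codePath (paths f v)))
  decision-correct {K} enough f fits conserved max =
    answer-correct I (≤-trans (m≤n+m n 2) (≤-trans (m≤m+n k k) (<⇒≤ (Sufficient.nodes enough))))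
      (subst (λ d → Truncates K d (truncated K (fromℕ (RSMInstance.d I)))) (ℕᵇ.toℕ-fromℕ d) (truncated-truncates K (fromℕ d)))
      (minimizer₀ f fits conserved max) (minimizer₁ f fits conserved max)
      (minimizer₀-closed f fits conserved max) (minimizer₁-closed f fits conserved max)
      (minimal f fits conserved max)

  -- Any pair of minimizers is a cut without infinite edges whose capacity is at most n, which is
  -- below the number of rounds.
  maxFlow-valid : ∃[ j ] (j ≤ suc n + k × Valid j maxFlow × Maximal maxFlow)
  maxFlow-valid with Representation.inhabited (compact zero) | Representation.inhabited (compact (suc zero))
  ... | Y₀ , Y₀∈ | Y₁ , Y₁∈ = maxFlow-maximal (cut {Y₀} {Y₁}) (cut-separates {Y₀} {Y₁})
    (cut-noInf (Representation.L⇒closed (compact zero) Y₀∈) (Representation.L⇒closed (compact (suc zero)) Y₁∈))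
    (≤-trans (≤-reflexive cut-value) (≤-trans (∣p∣≤n (Y₀ △ Y₁)) (≤-trans (n≤1+n n) (m≤m+n (suc n) k))))

  capacityDigits : Capacity → ℕ
  capacityDigits none = 0
  capacityDigits unit = 1
  capacityDigits inf  = 3 + n

  capacityValue : Capacity → ℕ
  capacityValue c = ℕᵇ.toℕ (power (capacityDigits c))

  network : Network
  network = record
    { n        = k + k
    ; source   = zero
    ; target   = suc zero
    ; distinct = λ ()
    ; capacity = λ x y → capacityValue (cap x y)
    }

  code-network : nil ∙ (nil ∙ nil) ∙ matrix (λ x y → codeCapacity n (cap x y)) ≡ Problem.codeᴵ MaximumFlow network
  code-network = cong (λ t → nil ∙ (nil ∙ nil) ∙ t) (trans
    (matrix-cong (λ x y → entry (cap x y)))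
    (sym (codeMatrix-tab (λ x y → capacityValue (cap x y)))))
    where
    entry : ∀ c → codeCapacity n c ≡ codeℕ (capacityValue c)
    entry none = refl
    entry unit = refl
    entry inf  = sym (codeℕ-power (3 + n))

  -- Although found with infinite capacities, this flow respects the finite ones because its entries
  -- are bounded by its value.
  maxFlow-flow : Flow network
  maxFlow-flow = record
    { flow      = maxFlow
    ; bounded   = λ x y → let _ , j≤ , valid , _ = maxFlow-valid in
        bounded (cap x y) (Valid.fits valid x y) (≤-trans (Valid.small valid x y) j≤)
    ; conserved = λ v v≢s v≢t → let _ , _ , valid , _ = maxFlow-valid in
        trans (∑-vec _) (trans (sym (Valid.conserved valid v v≢s v≢t)) (sym (∑-vec _)))
    }
    where
    bounded : ∀ c {l} → Fits c l → l ≤ suc n + k → l ≤ capacityValue c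
    bounded none fits _  = fits
    bounded unit fits _  = fits
    bounded inf  _    l≤ = ≤-trans l≤ (power-≥ n)

  module _ (R : Flow network) where

    φ : FlowMap
    φ = Flow.flow R

    φ-fits : FitsAll φ
    φ-fits x y = fits (cap x y) (Flow.bounded R x y)
      where
      fits : ∀ c {l} → l ≤ capacityValue c → Fits c l
      fits none le = le
      fits unit le = le
      fits inf  _  = tt

    φ-conserved : Conserved φ
    φ-conserved v v≢s v≢t = trans (sym (∑-vec _)) (trans (sym (Flow.conserved R v v≢s v≢t)) (∑-vec _))

    -- Augmenting φ could exceed the finite bounds that stand for infinity, so
    -- φ is compared with maxFlow, whose entries are small: the value of φ is
    -- at least that of maxFlow, hence φ saturates the cut that blocks maxFlow.
    optimal⇒maximal : (∀ ψ → Flow.value ψ ℤ.≤ Flow.value R) → Maximal φ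
    optimal⇒maximal optimal = let j , _ , valid , max = maxFlow-valid in go j valid max
      where
      le : out maxFlow zero ℤ.⊖ inn maxFlow zero ℤ.≤ out φ zero ℤ.⊖ inn φ zero
      le = subst₂ ℤ._≤_ (cong₂ ℤ._⊖_ (∑-vec (λ y → maxFlow zero y)) (∑-vec (λ x → maxFlow x zero)))
             (cong₂ ℤ._⊖_ (∑-vec (λ y → φ zero y)) (∑-vec (λ x → φ x zero))) (optimal maxFlow-flow)
      S : Cut
      S = reachable maxFlow
      go : ∀ j → Valid j maxFlow → Maximal maxFlow → Maximal φ
      go j valid max = blocked-maximal S φ sep
        (value-blocks S φ sep (reachable-noInf maxFlow (Valid.fits valid)) φ-fits φ-conserved value)
        where
        sep = reachable-separates maxFlow max
        j≡ : forward S units ≡ j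
        j≡ = +-cancelˡ-≡ (inn maxFlow zero) _ _ (trans
          (sym (blocked-value S maxFlow sep (reachable-blocked maxFlow) (Valid.fits valid) (Valid.conserved valid)))
          (Valid.value valid))
        value : inn φ zero + forward S units ≤ out φ zero
        value = subst (λ l → inn φ zero + l ≤ out φ zero) (sym j≡)
          (⊖-≤ (inn maxFlow zero) j (out φ zero) (inn φ zero)
            (subst (λ o → o ℤ.⊖ inn maxFlow zero ℤ.≤ out φ zero ℤ.⊖ inn φ zero) (Valid.value valid) le))

-- Polynomial bounds and the two claims

answerSize : ℕ → ℕ
answerSize K = 3 + K * 4

answerSize-bounded : PolynomiallyBounded answerSize
answerSize-bounded = +-bounded (const-bounded 3) (*-bounded id-bounded (const-bounded 4))

size-answer : ∀ I {K} → size (Problem.codeᴵ RSM I) ≤ K → (S : Maybe (Subset (RSMInstance.n I))) →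
  size (codeAnswer S) ≤ answerSize K
size-answer I code≤K S = ≤-trans (size-codeAnswer S) (+-monoʳ-≤ 3 (*-monoˡ-≤ 4 (≤-trans (n≤size I) code≤K)))

ComputedBy : Prog → (ℕ → ℕ) → ℕ → ℕ → Set
ComputedBy p h a e = ∀ x {y} → size x ∣ x ⊢ p ⟶ y → size y ≤ h (size x) → Computes (program p) x y (a * size x ^ e)

computedBy : ∀ p {h} → PolynomiallyBounded h → ∃[ a ] ∃[ e ] ComputedBy p h a e
computedBy p h-bounded = let a , e , computes = program-polynomial p h-bounded in
  a , e , λ x x⟶y → computes x (Evaluates.value x⟶y)

solvable : PolynomialTimeSolvable RSM
solvable = let a , e , computes = computedBy solveₚ answerSize-bounded in program solveₚ , a , e , solve a e computes
  where
  solve : ∀ a e → ComputedBy solveₚ answerSize a e → ∀ I → ∃[ S ] (Problem.Correct RSM I S ×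
    Computes (program solveₚ) (Problem.codeᴵ RSM I) (Problem.codeˢ RSM {I} S) (a * size (Problem.codeᴵ RSM I) ^ e))
  solve a e computes I =
    S , correct , computes (Problem.codeᴵ RSM I) (solve-⟶ I enough) (size-answer I ≤-refl S)
    where
    open DoubleNetwork (relation I zero) (relation I (suc zero)) refl
    enough = sufficient I ≤-refl
    S = decision I enough (reachable maxFlow) (codePath ∘ paths maxFlow) (λ v → isCons-codePath (paths maxFlow v))
    correct : Problem.Correct RSM I S
    correct = let _ , _ , valid , max = maxFlow-valid I in
      decision-correct I enough maxFlow (Valid.fits valid) (Valid.conserved valid) max

networkSize : ℕ → ℕ
networkSize K = 7 + K * (2 + K * (3 + K))

networkSize-bounded : PolynomiallyBounded networkSize
networkSize-bounded = +-bounded (const-bounded 7) (*-bounded id-bounded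
  (+-bounded (const-bounded 2) (*-bounded id-bounded (+-bounded (const-bounded 3) id-bounded))))

size-network : ∀ I → size (Problem.codeᴵ MaximumFlow (network I)) ≤ networkSize (size (Problem.codeᴵ RSM I))
size-network I = subst (λ t → size t ≤ networkSize K) (code-network I)
  (+-monoʳ-≤ 6 (≤-trans (size-tab row λ x → size-tab (λ y → codeCapacity n (cap x y)) λ y → entry (cap x y))
    (+-monoʳ-≤ 1 (*-mono-≤ m≤K (+-monoʳ-≤ 2 (*-monoˡ-≤ (3 + K) m≤K))))))
  where
  open DoubleNetwork (relation I zero) (relation I (suc zero)) refl
  n = RSMInstance.n I
  row : Fin (k + k) → Tree
  row x = tab (λ y → codeCapacity n (cap x y))
  K = size (Problem.codeᴵ RSM I)
  m≤K : k + k ≤ K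
  m≤K = <⇒≤ (size-input I)
  entry : ∀ c → size (codeCapacity n c) ≤ 2 + K
  entry none = s≤s z≤n
  entry unit = s≤s (s≤s (≤-trans (s≤s z≤n) (size-input I)))
  entry inf  = ≤-trans (≤-reflexive (trans (size-codeUnary (3 + n)) (shuffle n))) (s≤s (s≤s (size-input I)))
    where
    shuffle : ∀ n → suc ((3 + n) + (3 + n)) ≡ 2 + suc ((2 + n) + (2 + n))
    shuffle = solve-∀

via-maximumFlow : PolynomialTimeVia RSM MaximumFlow
via-maximumFlow =
  let a , e , pre-computes    = computedBy preₚ networkSize-bounded
      a′ , e′ , post-computes = computedBy postₚ answerSize-bounded
  in program preₚ , program postₚ , a + a′ , e + e′ , λ I →
    network I , pre a e a′ e′ pre-computes I , post a e a′ e′ post-computes I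
  where
  enlarge : ∀ a e a′ e′ s → .{{_ : NonZero s}} → a * s ^ e ≤ (a + a′) * s ^ (e + e′)
  enlarge a e a′ e′ s = *-mono-≤ (m≤m+n a a′) (^-monoʳ-≤ s (m≤m+n e e′))

  pre : ∀ a e a′ e′ → ComputedBy preₚ networkSize a e → ∀ I → let x = Problem.codeᴵ RSM I in
    Computes (program preₚ) x (Problem.codeᴵ MaximumFlow (network I)) ((a + a′) * size x ^ (e + e′))
  pre a e a′ e′ computes I = Computes-mono (enlarge a e a′ e′ (size x) {{size-nonZero x}})
    (computes x (⟶-cong (code-network I) (pre-⟶ I (sufficient I ≤-refl))) (size-network I))
    where x = Problem.codeᴵ RSM I

  post : ∀ a e a′ e′ → ComputedBy postₚ answerSize a′ e′ →
    ∀ I R → Problem.Correct MaximumFlow (network I) R →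
    let x = Problem.codeᴵ RSM I ∙ Problem.codeˢ MaximumFlow {network I} R in
    ∃[ S ] (Problem.Correct RSM I S × Computes (program postₚ) x (Problem.codeˢ RSM {I} S) ((a + a′) * size x ^ (e + e′)))
  post a e a′ e′ computes I R optimal =
    S , decision-correct I enough f (φ-fits I R) (φ-conserved I R) (optimal⇒maximal I R optimal) ,
    Computes-mono (subst₂ (λ b c → a′ * size x ^ e′ ≤ b * size x ^ c) (+-comm a′ a) (+-comm e′ e)
        (enlarge a′ e′ a e (size x) {{size-nonZero x}}))
      (computes x
        (subst (λ t → size x ∣ Problem.codeᴵ RSM I ∙ t ⊢ postₚ ⟶ codeAnswer S) (sym (codeMatrix-tab f))
          (post-⟶ I enough {f = f} (λ u v → isCons-codeℕ (f u v))))
        (size-answer I code≤ S))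
    where
    open DoubleNetwork (relation I zero) (relation I (suc zero)) refl
    f : FlowMap
    f = φ I R
    x = Problem.codeᴵ RSM I ∙ Problem.codeˢ MaximumFlow {network I} R
    code≤ : size (Problem.codeᴵ RSM I) ≤ size x
    code≤ = ≤-trans (m≤m+n _ _) (n≤1+n _)
    enough = sufficient I code≤
    S = decision I enough (reachable f) (codePath ∘ paths f) (λ v → isCons-codePath (paths f v))

theorem3p4 : PolynomialTimeSolvable (RobustSubmodularMinimizer 2) × PolynomialTimeVia (RobustSubmodularMinimizer 2) MaximumFlow
theorem3p4 = solvable , via-maximumFlow
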